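{- Let $\Gamma_1$ be a finite graph and let $\Gamma_2$ be an arbitrary (finite or countably infinite) graph, with no common vertices. Let $v_1\in\mathcal V(\Gamma_1)$, $v_2\in\mathcal V(\Gamma_2)$, and let $\Gamma=\Gamma_1+\Gamma_2$ be the coupling of $\Gamma_1$ and $\Gamma_2$ by means of the bridge $\{v_1,v_2\}$. Let $\lambda\in\mathbb C$ be a regular point of $\Gamma_2$, i.e., $\lambda\in\rho(A(\Gamma_2))$. Then $\lambda$ belongs to the spectrum of $A(\Gamma)$ if and only if $$P(\lambda,\Gamma_1)-G(\lambda,\Gamma_2)\,P(\lambda,\Gamma_1\backslash v_1)=0.$$
   Context: Graphs are simple, connected, undirected, and finite or countably infinite, with vertex set $\mathcal V(\cdot)$ and edge set $\mathcal E(\cdot)$; they are locally finite (every vertex has finite degree). (The connectedness convention applies to $\Gamma_1$, $\Gamma_2$ and hence $\Gamma$; the subgraph $\Gamma_1\backslash v_1$ need not be connected.) Adjacency operator: for a graph $\Gamma$, $A(\Gamma)$ is the operator on $\ell^2(\mathcal V(\Gamma))$ (which is $\mathbb C^n$ if $\Gamma$ has $n$ vertices) acting on the standard basis $\{e_v\}_{v\in\mathcal V(\Gamma)}$ by $A(\Gamma)e_v=\sum_{u\sim v}e_u$, where $u\sim v$ means $\{u,v\}\in\mathcal E(\Gamma)$. It is defined on finite linear combinations of basis vectors, where it is symmetric, and is then replaced by its closure. If the vertex degrees are uniformly bounded, $A(\Gamma)$ is a bounded self-adjoint operator on the whole space. For a finite graph, $A(\Gamma)$ is the usual $0$-$1$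 adjacency matrix. Resolvent set and spectrum: $\rho(T)$ is the set of $\lambda\in\mathbb C$ such that $\lambda I-T$ is boundedly invertible, and the spectrum is $\sigma(T)=\mathbb C\setminus\rho(T)$. Coupling: $\Gamma=\Gamma_1+\Gamma_2$ by means of the bridge $\{v_1,v_2\}$ is the graph with $\mathcal V(\Gamma)=\mathcal V(\Gamma_1)\cup\mathcal V(\Gamma_2)$ and $\mathcal E(\Gamma)=\mathcal E(\Gamma_1)\cup\mathcal E(\Gamma_2)\cup\{\{v_1,v_2\}\}$, i.e., the two graphs are joined by one new edge between $v_1$ and $v_2$. Characteristic polynomial: for a finite graph $F$, $P(\lambda,F)=\det(\lambda I-A(F))$, with $P(\lambda,\emptyset)=1$ for the empty graph. For $v\in\mathcal V(F)$, $F\backslash v$ is the subgraph of $F$ induced by $\mathcal V(F)\setminus\{v\}$. Green's function: for $\lambda\in\rho(A(\Gamma_2))$, $G(\lambda,\Gamma_2)=\langle(\lambda I-A(\Gamma_2))^{ -1}e_{v_2},e_{v_2}\rangle$, i.e., the diagonal entry of the resolvent matrix at the vertex $v_2$ (the vertex of $\Gamma_2$ to which the bridge is attached, listed first in the enumeration of $\mathcal V(\Gamma_2)$). -}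

module Defs where

open import Algebra.Bundles using (CommutativeRing; Semiring)
import Algebra.Definitions.RawSemiring as RawSemiringDefs
open import Algebra.Module.Bundles using (LeftModule)
open import Algebra.Module.Morphism.Structures using (module LeftModuleMorphisms)
open import Algebra.Structures using (IsCommutativeRing)
open import Data.Empty using (⊥-elim)
open import Data.Fin.Base using (Fin; zero; suc; toℕ; punchIn; punchOut)
import Data.Fin.Properties as Finₚ
open import Data.List.Base using (List; []; _∷_; _++_; map; foldr)
open import Data.List.Membership.Propositional using (_∈_)
open import Data.List.Membership.Propositional.Properties
  using (∈-map⁺; ∈-map⁻; ∈-++⁺ˡ; ∈-++⁺ʳ; ∈-++⁻)
import Data.List.Membership.DecPropositional as DecMembership
open import Data.List.Relation.Binary.Disjoint.Propositional using (Disjoint)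
open import Data.List.Relation.Unary.All as All using ([]; _∷_)
open import Data.List.Relation.Unary.AllPairs using ([]; _∷_)
open import Data.List.Relation.Unary.Any using (here; there)
open import Data.List.Relation.Unary.Unique.Propositional using (Unique)
import Data.List.Relation.Unary.Unique.Propositional.Properties as Uniqueₚ
open import Data.Nat.Base as ℕ using (ℕ; zero; suc)
import Data.Nat.Properties as ℕₚ
open import Data.Product.Base using (Σ-syntax; ∃-syntax; _×_; _,_; proj₁; proj₂)
open import Data.Rational.Base as ℚ using (ℚ; 0ℚ; 1ℚ)
import Data.Rational.Properties as ℚₚ
open import Data.Sum.Base using (_⊎_; inj₁; inj₂)
import Data.Sum.Properties as Sumₚ
open import Function.Bundles using (_↔_; _⇔_; Inverse; Equivalence; mk↔ₛ′; mk⇔)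
open import Level using (0ℓ)
open import Relation.Binary.Construct.Closure.ReflexiveTransitive using (Star)
open import Relation.Binary.Definitions using (DecidableEquality; Decidable)
open import Relation.Binary.PropositionalEquality
  using (_≡_; _≢_; refl; sym; trans; cong; cong₂; subst)
open import Relation.Nullary using (¬_; yes; no)
open import Relation.Nullary.Decidable using (dec⇒maybe; map′)
open import Tactic.RingSolver using (solve-∀)
open import Tactic.RingSolver.Core.AlmostCommutativeRing
  using (AlmostCommutativeRing; fromCommutativeRing)

-- The library's operations on ℚ unfold on neutral arguments to large normal
-- forms; here they are made opaque, so that type checking real and complex
-- arithmetic stays cheap.
module Rat where

  infixl 6 _+_ _-_
  infixl 7 _*_
  infix  8 -_

  opaque
    _+_ _*_ : ℚ → ℚ → ℚ
    _+_ = ℚ._+_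
    _*_ = ℚ._*_

    -_ ∣_∣ : ℚ → ℚ
    -_  = ℚ.-_
    ∣_∣ = ℚ.∣_∣

  _-_ : ℚ → ℚ → ℚ
  p - q = p + - q

  opaque
    unfolding _+_

    isCommutativeRing : IsCommutativeRing _≡_ _+_ _*_ -_ 0ℚ 1ℚ
    isCommutativeRing = ℚₚ.+-*-isCommutativeRing

    +-mono-≤ : ∀ {p q r s} → p ℚ.≤ q → r ℚ.≤ s → p + r ℚ.≤ q + s
    +-mono-≤ = ℚₚ.+-mono-≤

    +-mono-<-≤ : ∀ {p q r s} → p ℚ.< q → r ℚ.≤ s → p + r ℚ.< q + s
    +-mono-<-≤ = ℚₚ.+-mono-<-≤

    *-monoˡ-≤ : ∀ {p q r} → 0ℚ ℚ.≤ r → p ℚ.≤ q → r * p ℚ.≤ r * q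
    *-monoˡ-≤ {r = r} 0≤r = ℚₚ.*-monoˡ-≤-nonNeg r {{ℚ.nonNegative 0≤r}}

    0≤∣p∣ : ∀ p → 0ℚ ℚ.≤ ∣ p ∣
    0≤∣p∣ = ℚₚ.0≤∣p∣

    0≤p⇒∣p∣≡p : ∀ {p} → 0ℚ ℚ.≤ p → ∣ p ∣ ≡ p
    0≤p⇒∣p∣≡p = ℚₚ.0≤p⇒∣p∣≡p

    ∣-p∣≡∣p∣ : ∀ p → ∣ - p ∣ ≡ ∣ p ∣
    ∣-p∣≡∣p∣ = ℚₚ.∣-p∣≡∣p∣

    ∣p+q∣≤∣p∣+∣q∣ : ∀ p q → ∣ p + q ∣ ℚ.≤ ∣ p ∣ + ∣ q ∣
    ∣p+q∣≤∣p∣+∣q∣ = ℚₚ.∣p+q∣≤∣p∣+∣q∣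

    ∣p*q∣≡∣p∣*∣q∣ : ∀ p q → ∣ p * q ∣ ≡ ∣ p ∣ * ∣ q ∣
    ∣p*q∣≡∣p∣*∣q∣ = ℚₚ.∣p*q∣≡∣p∣*∣q∣

    divide : ∀ K ε → 0ℚ ℚ.< K → 0ℚ ℚ.< ε → ∃[ δ ] 0ℚ ℚ.< δ × K * δ ≡ ε
    divide K ε 0<K 0<ε = δ , ℚₚ.positive⁻¹ δ {{ℚₚ.pos*pos⇒pos (ℚ.1/ K) ε}} ,
      trans (sym (ℚₚ.*-assoc K (ℚ.1/ K) ε))
        (trans (cong (ℚ._* ε) (ℚₚ.*-inverseʳ K)) (ℚₚ.*-identityˡ ε))
      where
      instance
        K⁺ : ℚ.Positive K
        K⁺ = ℚ.positive 0<K
        ε⁺ : ℚ.Positive ε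
        ε⁺ = ℚ.positive 0<ε
        K≢0 : ℚ.NonZero K
        K≢0 = ℚₚ.pos⇒nonZero K
        K⁻¹⁺ : ℚ.Positive (ℚ.1/ K)
        K⁻¹⁺ = ℚₚ.1/pos⇒pos K
      δ : ℚ
      δ = ℚ.1/ K ℚ.* ε

    neg-antimono-≤ : ∀ {p q} → p ℚ.≤ q → - q ℚ.≤ - p
    neg-antimono-≤ = ℚₚ.neg-antimono-≤

    -0≡0 : - 0ℚ ≡ 0ℚ
    -0≡0 = refl

  commutativeRing : CommutativeRing 0ℓ 0ℓ
  commutativeRing = record { isCommutativeRing = isCommutativeRing }

  open CommutativeRing commutativeRing public
    using ( +-assoc; +-comm; +-identityˡ; +-identityʳ; *-assoc; *-comm; *-identityˡ; *-identityʳ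
          ; zeroˡ; zeroʳ; distribˡ; distribʳ)
    renaming (-‿inverseˡ to +-inverseˡ; -‿inverseʳ to +-inverseʳ)

  ring : AlmostCommutativeRing 0ℓ 0ℓ
  ring = fromCommutativeRing commutativeRing (λ p → dec⇒maybe (0ℚ ℚₚ.≟ p))

  -- Unfolded because the ring solver computes with rational coefficients.
  opaque
    unfolding _+_

    a≡a-b+b : ∀ a b → a ≡ (a - b) + b
    a≡a-b+b = solve-∀ ring

    a-c-via-b : ∀ a b c → a - c ≡ (a - b) + (b - c)
    a-c-via-b = solve-∀ ring

    +-interchange-- : ∀ a b c d → (a + b) - (c + d) ≡ (a - c) + (b - d)
    +-interchange-- = solve-∀ ring

    -‿interchange-- : ∀ a b → (- a) - (- b) ≡ - (a - b)
    -‿interchange-- = solve-∀ ring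

    neg-minus : ∀ a b → - (a - b) ≡ b - a
    neg-minus = solve-∀ ring

    ab-cd : ∀ a b c d → a * b - c * d ≡ a * (b - d) + d * (a - c)
    ab-cd = solve-∀ ring

    neg*neg : ∀ a → - a * - a ≡ a * a
    neg*neg = solve-∀ ring

    double : ∀ a → (1ℚ + 1ℚ) * a ≡ a + a
    double = solve-∀ ring

    +-interchange : ∀ a b c d → (a + b) + (c + d) ≡ (a + c) + (b + d)
    +-interchange = solve-∀ ring

    *-assoc-re : ∀ a b c d e f →
      (a * c + - (b * d)) * e + - ((a * d + b * c) * f) ≡
      a * (c * e + - (d * f)) + - (b * (c * f + d * e))
    *-assoc-re = solve-∀ ring

    *-assoc-im : ∀ a b c d e f →
      (a * c + - (b * d)) * f + (a * d + b * c) * e ≡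
      a * (c * f + d * e) + b * (c * e + - (d * f))
    *-assoc-im = solve-∀ ring

    *-identityˡ-re : ∀ a b → 1ℚ * a + - (0ℚ * b) ≡ a
    *-identityˡ-re = solve-∀ ring

    *-identityˡ-im : ∀ a b → 1ℚ * b + 0ℚ * a ≡ b
    *-identityˡ-im = solve-∀ ring

    distribˡ-re : ∀ a b c d e f → a * (c + e) + - (b * (d + f)) ≡
      (a * c + - (b * d)) + (a * e + - (b * f))
    distribˡ-re = solve-∀ ring

    distribˡ-im : ∀ a b c d e f →
      a * (d + f) + b * (c + e) ≡ (a * d + b * c) + (a * f + b * e)
    distribˡ-im = solve-∀ ring

    ∣z+w∣²-expand : ∀ a b c d →
      ((a * a + b * b) + (c * c + d * d)) + ((a * a + b * b) + (c * c + d * d)) ≡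
      ((a + c) * (a + c) + (b + d) * (b + d)) + ((a - c) * (a - c) + (b - d) * (b - d))
    ∣z+w∣²-expand = solve-∀ ring

    ∣zw∣²-expand : ∀ a b c d →
      (a * c + - (b * d)) * (a * c + - (b * d)) + (a * d + b * c) * (a * d + b * c) ≡
      (a * a + b * b) * (c * c + d * d)
    ∣zw∣²-expand = solve-∀ ring

  0<1 : 0ℚ ℚ.< 1ℚ
  0<1 = ℚₚ.positive⁻¹ 1ℚ

  0<+≤ : ∀ {p q} → 0ℚ ℚ.< p → 0ℚ ℚ.≤ q → 0ℚ ℚ.< p + q
  0<+≤ {p} {q} 0<p 0≤q = subst (ℚ._< p + q) (+-identityˡ 0ℚ) (+-mono-<-≤ 0<p 0≤q)

  0<+ : ∀ {p q} → 0ℚ ℚ.< p → 0ℚ ℚ.< q → 0ℚ ℚ.< p + q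
  0<+ 0<p 0<q = 0<+≤ 0<p (ℚₚ.<⇒≤ 0<q)

  0≤+ : ∀ {p q} → 0ℚ ℚ.≤ p → 0ℚ ℚ.≤ q → 0ℚ ℚ.≤ p + q
  0≤+ {p} {q} 0≤p 0≤q = subst (ℚ._≤ p + q) (+-identityˡ 0ℚ) (+-mono-≤ 0≤p 0≤q)

  opaque
    halve : ∀ ε → 0ℚ ℚ.< ε → ∃[ δ ] 0ℚ ℚ.< δ × δ + δ ≡ ε
    halve ε 0<ε with divide (1ℚ + 1ℚ) ε (0<+ 0<1 0<1) 0<ε
    ... | δ , 0<δ , eq = δ , 0<δ , trans (sym (double δ)) eq

  p≤p+ε : ∀ {p ε} → 0ℚ ℚ.≤ ε → p ℚ.≤ p + ε
  p≤p+ε {p} {ε} 0≤ε = subst (ℚ._≤ p + ε) (+-identityʳ p) (+-mono-≤ (ℚₚ.≤-refl {p}) 0≤ε)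

  *-mono : ∀ {p q r s} → 0ℚ ℚ.≤ p → p ℚ.≤ q → 0ℚ ℚ.≤ r → r ℚ.≤ s → p * r ℚ.≤ q * s
  *-mono {p} {q} {r} {s} 0≤p p≤q 0≤r r≤s = ℚₚ.≤-trans (*-monoˡ-≤ 0≤p r≤s)
    (subst (λ t → t ℚ.≤ q * s) (*-comm s p)
      (subst (λ t → s * p ℚ.≤ t) (*-comm s q) (*-monoˡ-≤ (ℚₚ.≤-trans 0≤r r≤s) p≤q)))

  0≤* : ∀ {p q} → 0ℚ ℚ.≤ p → 0ℚ ℚ.≤ q → 0ℚ ℚ.≤ p * q
  0≤* {p} {q} 0≤p 0≤q = subst (λ t → t ℚ.≤ p * q) (zeroʳ p) (*-monoˡ-≤ 0≤p 0≤q)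

  p≤∣p∣ : ∀ p → p ℚ.≤ ∣ p ∣
  p≤∣p∣ p with ℚₚ.≤-total 0ℚ p
  ... | inj₁ 0≤p = ℚₚ.≤-reflexive (sym (0≤p⇒∣p∣≡p 0≤p))
  ... | inj₂ p≤0 = ℚₚ.≤-trans p≤0 (0≤∣p∣ p)

  0≤p² : ∀ p → 0ℚ ℚ.≤ p * p
  0≤p² p with ℚₚ.≤-total 0ℚ p
  ... | inj₁ 0≤p = 0≤* 0≤p 0≤p
  ... | inj₂ p≤0 = subst (0ℚ ℚ.≤_) (neg*neg p) (0≤* 0≤-p 0≤-p)
    where
    0≤-p : 0ℚ ℚ.≤ - p
    0≤-p = subst (ℚ._≤ - p) -0≡0 (neg-antimono-≤ p≤0)

  ∣p+q∣≤ : ∀ {p q r s} → ∣ p ∣ ℚ.≤ r → ∣ q ∣ ℚ.≤ s → ∣ p + q ∣ ℚ.≤ r + s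
  ∣p+q∣≤ {p} {q} a b = ℚₚ.≤-trans (∣p+q∣≤∣p∣+∣q∣ p q) (+-mono-≤ a b)

  ∣p*q∣≤ : ∀ {p q r s} → ∣ p ∣ ℚ.≤ r → ∣ q ∣ ℚ.≤ s → ∣ p * q ∣ ℚ.≤ r * s
  ∣p*q∣≤ {p} {q} a b = ℚₚ.≤-trans (ℚₚ.≤-reflexive (∣p*q∣≡∣p∣*∣q∣ p q))
    (*-mono (0≤∣p∣ p) a (0≤∣p∣ q) b)

  ∣p-q∣-sym : ∀ p q → ∣ p - q ∣ ≡ ∣ q - p ∣
  ∣p-q∣-sym p q = trans (sym (∣-p∣≡∣p∣ (p - q))) (cong ∣_∣ (neg-minus p q))

  ∣p-p∣≡0 : ∀ p → ∣ p - p ∣ ≡ 0ℚ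
  ∣p-p∣≡0 p = trans (cong ∣_∣ (+-inverseʳ p)) (0≤p⇒∣p∣≡p ℚₚ.≤-refl)

  ∣ab-cd∣≤ : ∀ {a b c d B C δ} → ∣ a ∣ ℚ.≤ B → ∣ d ∣ ℚ.≤ C →
             ∣ a - c ∣ ℚ.≤ δ → ∣ b - d ∣ ℚ.≤ δ → ∣ a * b - c * d ∣ ℚ.≤ (B + C) * δ
  ∣ab-cd∣≤ {a} {b} {c} {d} {B} {C} {δ} a≤B d≤C a-c b-d =
    ℚₚ.≤-trans (ℚₚ.≤-reflexive (cong ∣_∣ (ab-cd a b c d)))
      (ℚₚ.≤-trans (∣p+q∣≤ (∣p*q∣≤ a≤B b-d) (∣p*q∣≤ d≤C a-c))
        (ℚₚ.≤-reflexive (sym (distribʳ δ B C))))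

Eventually : (ℕ → Set) → Set
Eventually P = ∃[ N ] ∀ n → N ℕ.≤ n → P n

ev-zip : ∀ {P Q R : ℕ → Set} → (∀ n → P n → Q n → R n) →
         Eventually P → Eventually Q → Eventually R
ev-zip f (M , p) (N , q) = M ℕ.⊔ N , λ n le →
  f n (p n (ℕₚ.≤-trans (ℕₚ.m≤m⊔n M N) le)) (q n (ℕₚ.≤-trans (ℕₚ.m≤n⊔m M N) le))

ev-map : ∀ {P R : ℕ → Set} → (∀ n → P n → R n) → Eventually P → Eventually R
ev-map f (M , p) = M , λ n le → f n (p n le)

Cauchy : (ℕ → ℚ) → Set
Cauchy s = ∀ ε → 0ℚ ℚ.< ε →
  ∃[ N ] ∀ m n → N ℕ.≤ m → N ℕ.≤ n → Rat.∣ s m Rat.- s n ∣ ℚ.≤ ε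

-- Cauchy sequences of rationals; two of them are identified by _≈ᴿ_ when their
-- difference is a null sequence.
record ℝ : Set where
  no-eta-equality
  constructor mkℝ
  field
    seq    : ℕ → ℚ
    cauchy : Cauchy seq

open ℝ public

infix  4 _≈ᴿ_ _≤ᴿ_
infixl 6 _+ᴿ_
infixl 7 _*ᴿ_
infix  8 -ᴿ_

record _≈ᴿ_ (x y : ℝ) : Set where
  no-eta-equality
  constructor mk≈
  field
    close : ∀ ε → 0ℚ ℚ.< ε → Eventually (λ n → Rat.∣ seq x n Rat.- seq y n ∣ ℚ.≤ ε)

record _≤ᴿ_ (x y : ℝ) : Set where
  no-eta-equality
  constructor mk≤
  field
    below : ∀ ε → 0ℚ ℚ.< ε → Eventually (λ n → seq x n ℚ.≤ seq y n Rat.+ ε)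

open _≈ᴿ_ public
open _≤ᴿ_ public

opaque
  const-cauchy : ∀ q → Cauchy (λ _ → q)
  const-cauchy q ε 0<ε = 0 , λ _ _ _ _ →
    ℚₚ.≤-trans (ℚₚ.≤-reflexive (Rat.∣p-p∣≡0 q)) (ℚₚ.<⇒≤ 0<ε)

fromℚ : ℚ → ℝ
seq    (fromℚ q) _ = q
cauchy (fromℚ q)   = const-cauchy q

0ᴿ 1ᴿ : ℝ
0ᴿ = fromℚ 0ℚ
1ᴿ = fromℚ 1ℚ

opaque
  +-cauchy : ∀ x y → Cauchy (λ n → seq x n Rat.+ seq y n)
  +-cauchy x y ε 0<ε with Rat.halve ε 0<ε
  ... | δ , 0<δ , refl with cauchy x δ 0<δ | cauchy y δ 0<δ
  ... | M , p | N , q = M ℕ.⊔ N , λ m n le le′ →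
      ℚₚ.≤-trans
        (ℚₚ.≤-reflexive
          (cong Rat.∣_∣ (Rat.+-interchange-- (seq x m) (seq y m) (seq x n) (seq y n))))
        (Rat.∣p+q∣≤
          (p m n (ℕₚ.≤-trans (ℕₚ.m≤m⊔n M N) le) (ℕₚ.≤-trans (ℕₚ.m≤m⊔n M N) le′))
          (q m n (ℕₚ.≤-trans (ℕₚ.m≤n⊔m M N) le) (ℕₚ.≤-trans (ℕₚ.m≤n⊔m M N) le′)))

_+ᴿ_ : ℝ → ℝ → ℝ
seq    (x +ᴿ y) n = seq x n Rat.+ seq y n
cauchy (x +ᴿ y)   = +-cauchy x y

opaque
  neg-cauchy : ∀ x → Cauchy (λ n → Rat.- seq x n)
  neg-cauchy x ε 0<ε with cauchy x ε 0<ε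
  ... | N , p = N , λ m n le le′ →
      ℚₚ.≤-trans (ℚₚ.≤-reflexive
        (trans (cong Rat.∣_∣ (Rat.-‿interchange-- (seq x m) (seq x n))) (Rat.∣-p∣≡∣p∣ (seq x m Rat.- seq x n))))
        (p m n le le′)

-ᴿ_ : ℝ → ℝ
seq    (-ᴿ x) n = Rat.- seq x n
cauchy (-ᴿ x)   = neg-cauchy x

opaque
  bounded : ∀ x → ∃[ B ] 0ℚ ℚ.< B × Eventually (λ n → Rat.∣ seq x n ∣ ℚ.≤ B)
  bounded x with cauchy x 1ℚ Rat.0<1
  ... | N , p = 1ℚ Rat.+ Rat.∣ seq x N ∣
              , Rat.0<+≤ Rat.0<1 (Rat.0≤∣p∣ (seq x N))
              , N , λ n le → ℚₚ.≤-trans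
                  (ℚₚ.≤-reflexive (cong Rat.∣_∣ (Rat.a≡a-b+b (seq x n) (seq x N))))
                  (Rat.∣p+q∣≤ (p n N le ℕₚ.≤-refl) (ℚₚ.≤-refl {Rat.∣ seq x N ∣}))

opaque
  *-cauchy : ∀ x y → Cauchy (λ n → seq x n Rat.* seq y n)
  *-cauchy x y ε 0<ε with bounded x | bounded y
  ... | B , 0<B , K , bx | C , 0<C , L , by with Rat.divide (B Rat.+ C) ε (Rat.0<+ 0<B 0<C) 0<ε
  ... | δ , 0<δ , refl with cauchy x δ 0<δ | cauchy y δ 0<δ
  ... | M , p | N , q = (K ℕ.⊔ L) ℕ.⊔ (M ℕ.⊔ N) , λ m n le le′ →
      Rat.∣ab-cd∣≤ {seq x m} {seq y m} {seq x n} {seq y n}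
        (bx m (ℕₚ.≤-trans K≤ le)) (by n (ℕₚ.≤-trans L≤ le′))
        (p m n (ℕₚ.≤-trans M≤ le) (ℕₚ.≤-trans M≤ le′))
        (q m n (ℕₚ.≤-trans N≤ le) (ℕₚ.≤-trans N≤ le′))
    where
    K≤ : K ℕ.≤ (K ℕ.⊔ L) ℕ.⊔ (M ℕ.⊔ N)
    K≤ = ℕₚ.≤-trans (ℕₚ.m≤m⊔n K L) (ℕₚ.m≤m⊔n (K ℕ.⊔ L) (M ℕ.⊔ N))
    L≤ : L ℕ.≤ (K ℕ.⊔ L) ℕ.⊔ (M ℕ.⊔ N)
    L≤ = ℕₚ.≤-trans (ℕₚ.m≤n⊔m K L) (ℕₚ.m≤m⊔n (K ℕ.⊔ L) (M ℕ.⊔ N))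
    M≤ : M ℕ.≤ (K ℕ.⊔ L) ℕ.⊔ (M ℕ.⊔ N)
    M≤ = ℕₚ.≤-trans (ℕₚ.m≤m⊔n M N) (ℕₚ.m≤n⊔m (K ℕ.⊔ L) (M ℕ.⊔ N))
    N≤ : N ℕ.≤ (K ℕ.⊔ L) ℕ.⊔ (M ℕ.⊔ N)
    N≤ = ℕₚ.≤-trans (ℕₚ.m≤n⊔m M N) (ℕₚ.m≤n⊔m (K ℕ.⊔ L) (M ℕ.⊔ N))

_*ᴿ_ : ℝ → ℝ → ℝ
seq    (x *ᴿ y) n = seq x n Rat.* seq y n
cauchy (x *ᴿ y)   = *-cauchy x y

opaque
  ≈ᴿ-pointwise : ∀ {x y} → (∀ n → seq x n ≡ seq y n) → x ≈ᴿ y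
  ≈ᴿ-pointwise {x} {y} eq = mk≈ λ ε 0<ε → 0 , λ n _ →
    ℚₚ.≤-trans (ℚₚ.≤-reflexive
      (trans (cong (λ q → Rat.∣ q Rat.- seq y n ∣) (eq n)) (Rat.∣p-p∣≡0 (seq y n))))
      (ℚₚ.<⇒≤ 0<ε)

  ≤ᴿ-pointwise : ∀ {x y} → (∀ n → seq x n ℚ.≤ seq y n) → x ≤ᴿ y
  ≤ᴿ-pointwise {x} {y} le = mk≤ λ ε 0<ε → 0 , λ n _ →
    ℚₚ.≤-trans (le n) (Rat.p≤p+ε (ℚₚ.<⇒≤ 0<ε))

  ≈ᴿ-refl : ∀ {x} → x ≈ᴿ x
  ≈ᴿ-refl = ≈ᴿ-pointwise λ _ → refl

  ≈ᴿ-sym : ∀ {x y} → x ≈ᴿ y → y ≈ᴿ x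
  ≈ᴿ-sym {x} {y} p = mk≈ λ ε 0<ε → ev-map
    (λ n le → ℚₚ.≤-trans (ℚₚ.≤-reflexive (Rat.∣p-q∣-sym (seq y n) (seq x n))) le) (close p ε 0<ε)

  ≈ᴿ-trans : ∀ {x y z} → x ≈ᴿ y → y ≈ᴿ z → x ≈ᴿ z
  ≈ᴿ-trans {x} {y} {z} p q = mk≈ go
    where
    go : ∀ ε → 0ℚ ℚ.< ε → Eventually (λ n → Rat.∣ seq x n Rat.- seq z n ∣ ℚ.≤ ε)
    go ε 0<ε with Rat.halve ε 0<ε
    ... | δ , 0<δ , refl = ev-zip
      (λ n a b → ℚₚ.≤-trans
        (ℚₚ.≤-reflexive (cong Rat.∣_∣ (Rat.a-c-via-b (seq x n) (seq y n) (seq z n)))) (Rat.∣p+q∣≤ a b))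
      (close p δ 0<δ) (close q δ 0<δ)

  +ᴿ-cong : ∀ {x y u v} → x ≈ᴿ y → u ≈ᴿ v → x +ᴿ u ≈ᴿ y +ᴿ v
  +ᴿ-cong {x} {y} {u} {v} p q = mk≈ go
    where
    go : ∀ ε → 0ℚ ℚ.< ε →
         Eventually (λ n → Rat.∣ seq (x +ᴿ u) n Rat.- seq (y +ᴿ v) n ∣ ℚ.≤ ε)
    go ε 0<ε with Rat.halve ε 0<ε
    ... | δ , 0<δ , refl = ev-zip
      (λ n a b → ℚₚ.≤-trans
        (ℚₚ.≤-reflexive (cong Rat.∣_∣ (Rat.+-interchange-- (seq x n) (seq u n) (seq y n) (seq v n))))
        (Rat.∣p+q∣≤ a b))
      (close p δ 0<δ) (close q δ 0<δ)

  -ᴿ-cong : ∀ {x y} → x ≈ᴿ y → -ᴿ x ≈ᴿ -ᴿ y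
  -ᴿ-cong {x} {y} p = mk≈ λ ε 0<ε → ev-map
    (λ n le → ℚₚ.≤-trans (ℚₚ.≤-reflexive
      (trans (cong Rat.∣_∣ (Rat.-‿interchange-- (seq x n) (seq y n)))
        (Rat.∣-p∣≡∣p∣ (seq x n Rat.- seq y n)))) le)
    (close p ε 0<ε)

  *ᴿ-cong : ∀ {x y u v} → x ≈ᴿ y → u ≈ᴿ v → x *ᴿ u ≈ᴿ y *ᴿ v
  *ᴿ-cong {x} {y} {u} {v} p q = mk≈ go
    where
    go : ∀ ε → 0ℚ ℚ.< ε →
         Eventually (λ n → Rat.∣ seq (x *ᴿ u) n Rat.- seq (y *ᴿ v) n ∣ ℚ.≤ ε)
    go ε 0<ε with bounded x | bounded v
    ... | B , 0<B , bx | C , 0<C , bv with Rat.divide (B Rat.+ C) ε (Rat.0<+ 0<B 0<C) 0<ε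
    ... | δ , 0<δ , refl = ev-zip
      (λ { n (a , b) (c , d) → Rat.∣ab-cd∣≤ {seq x n} {seq u n} {seq y n} {seq v n} a b c d })
      (ev-zip (λ _ → _,_) bx bv)
      (ev-zip (λ _ → _,_) (close p δ 0<δ) (close q δ 0<δ))

ℝ-commutativeRing : CommutativeRing 0ℓ 0ℓ
ℝ-commutativeRing = record
  { Carrier = ℝ
  ; _≈_ = _≈ᴿ_
  ; _+_ = _+ᴿ_
  ; _*_ = _*ᴿ_
  ; -_ = -ᴿ_
  ; 0# = 0ᴿ
  ; 1# = 1ᴿ
  ; isCommutativeRing = record
    { isRing = record
      { +-isAbelianGroup = record
        { isGroup = record
          { isMonoid = record
            { isSemigroup = record
              { isMagma = record
                { isEquivalence = record
                  { refl = ≈ᴿ-refl ; sym = ≈ᴿ-sym ; trans = ≈ᴿ-trans }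
                ; ∙-cong = +ᴿ-cong
                }
              ; assoc = λ x y z → ≈ᴿ-pointwise λ n →
                  Rat.+-assoc (seq x n) (seq y n) (seq z n)
              }
            ; identity = (λ x → ≈ᴿ-pointwise λ n → Rat.+-identityˡ (seq x n))
                       , (λ x → ≈ᴿ-pointwise λ n → Rat.+-identityʳ (seq x n))
            }
          ; inverse = (λ x → ≈ᴿ-pointwise λ n → Rat.+-inverseˡ (seq x n))
                    , (λ x → ≈ᴿ-pointwise λ n → Rat.+-inverseʳ (seq x n))
          ; ⁻¹-cong = -ᴿ-cong
          }
        ; comm = λ x y → ≈ᴿ-pointwise λ n → Rat.+-comm (seq x n) (seq y n)
        }
      ; *-cong = *ᴿ-cong
      ; *-assoc = λ x y z → ≈ᴿ-pointwise λ n → Rat.*-assoc (seq x n) (seq y n) (seq z n)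
      ; *-identity = (λ x → ≈ᴿ-pointwise λ n → Rat.*-identityˡ (seq x n))
                   , (λ x → ≈ᴿ-pointwise λ n → Rat.*-identityʳ (seq x n))
      ; distrib = (λ x y z → ≈ᴿ-pointwise λ n →
                     Rat.distribˡ (seq x n) (seq y n) (seq z n))
                , (λ x y z → ≈ᴿ-pointwise λ n →
                     Rat.distribʳ (seq x n) (seq y n) (seq z n))
      }
    ; *-comm = λ x y → ≈ᴿ-pointwise λ n → Rat.*-comm (seq x n) (seq y n)
    }
  }

opaque
  ≤ᴿ-trans : ∀ {x y z} → x ≤ᴿ y → y ≤ᴿ z → x ≤ᴿ z
  ≤ᴿ-trans {x} {y} {z} p q = mk≤ go
    where
    go : ∀ ε → 0ℚ ℚ.< ε → Eventually (λ n → seq x n ℚ.≤ seq z n Rat.+ ε)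
    go ε 0<ε with Rat.halve ε 0<ε
    ... | δ , 0<δ , refl = ev-zip
      (λ n a b → ℚₚ.≤-trans a (ℚₚ.≤-trans (Rat.+-mono-≤ b (ℚₚ.≤-refl {δ}))
        (ℚₚ.≤-reflexive (Rat.+-assoc (seq z n) δ δ))))
      (below p δ 0<δ) (below q δ 0<δ)

  ≤ᴿ-reflexive : ∀ {x y} → x ≈ᴿ y → x ≤ᴿ y
  ≤ᴿ-reflexive {x} {y} p = mk≤ λ ε 0<ε → ev-map
    (λ n le → ℚₚ.≤-trans
      (ℚₚ.≤-reflexive (trans (Rat.a≡a-b+b (seq x n) (seq y n)) (Rat.+-comm _ (seq y n))))
      (Rat.+-mono-≤ (ℚₚ.≤-refl {seq y n})
        (ℚₚ.≤-trans (Rat.p≤∣p∣ (seq x n Rat.- seq y n)) le)))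
    (close p ε 0<ε)

  +ᴿ-mono-≤ : ∀ {x y u v} → x ≤ᴿ y → u ≤ᴿ v → x +ᴿ u ≤ᴿ y +ᴿ v
  +ᴿ-mono-≤ {x} {y} {u} {v} p q = mk≤ go
    where
    go : ∀ ε → 0ℚ ℚ.< ε → Eventually (λ n → seq (x +ᴿ u) n ℚ.≤ seq (y +ᴿ v) n Rat.+ ε)
    go ε 0<ε with Rat.halve ε 0<ε
    ... | δ , 0<δ , refl = ev-zip
      (λ n a b → ℚₚ.≤-trans (Rat.+-mono-≤ a b)
        (ℚₚ.≤-reflexive (Rat.+-interchange (seq y n) δ (seq v n) δ)))
      (below p δ 0<δ) (below q δ 0<δ)

record ℂ : Set where
  constructor _+i_
  field
    re im : ℝ

open ℂ public

record _≈ᶜ_ (z w : ℂ) : Set where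
  constructor _,_
  field
    re-≈ : re z ≈ᴿ re w
    im-≈ : im z ≈ᴿ im w

open _≈ᶜ_ public

infix  4 _≈ᶜ_
infixl 6 _+ᶜ_
infixl 7 _*ᶜ_
infix  8 -ᶜ_
infix  5 _+i_

_+ᶜ_ _*ᶜ_ : ℂ → ℂ → ℂ
(a +i b) +ᶜ (c +i d) = (a +ᴿ c) +i (b +ᴿ d)
(a +i b) *ᶜ (c +i d) = (a *ᴿ c +ᴿ -ᴿ (b *ᴿ d)) +i (a *ᴿ d +ᴿ b *ᴿ c)

-ᶜ_ : ℂ → ℂ
-ᶜ (a +i b) = (-ᴿ a) +i (-ᴿ b)

0ᶜ 1ᶜ : ℂ
0ᶜ = 0ᴿ +i 0ᴿ
1ᶜ = 1ᴿ +i 0ᴿ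

∣_∣² : ℂ → ℝ
∣ a +i b ∣² = a *ᴿ a +ᴿ b *ᴿ b

module R = CommutativeRing ℝ-commutativeRing

opaque
  *ᶜ-comm : ∀ z w → z *ᶜ w ≈ᶜ w *ᶜ z
  *ᶜ-comm (a +i b) (c +i d) =
      +ᴿ-cong (R.*-comm a c) (-ᴿ-cong (R.*-comm b d))
    , R.trans (R.+-comm (a *ᴿ d) (b *ᴿ c)) (+ᴿ-cong (R.*-comm b c) (R.*-comm a d))

  *ᶜ-assoc : ∀ z w u → (z *ᶜ w) *ᶜ u ≈ᶜ z *ᶜ (w *ᶜ u)
  *ᶜ-assoc (a +i b) (c +i d) (e +i f) =
      (≈ᴿ-pointwise λ n →
        Rat.*-assoc-re (seq a n) (seq b n) (seq c n) (seq d n) (seq e n) (seq f n))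
    , (≈ᴿ-pointwise λ n →
        Rat.*-assoc-im (seq a n) (seq b n) (seq c n) (seq d n) (seq e n) (seq f n))

  *ᶜ-identityˡ : ∀ z → 1ᶜ *ᶜ z ≈ᶜ z
  *ᶜ-identityˡ (a +i b) =
      (≈ᴿ-pointwise λ n → Rat.*-identityˡ-re (seq a n) (seq b n))
    , (≈ᴿ-pointwise λ n → Rat.*-identityˡ-im (seq a n) (seq b n))

  *ᶜ-distribˡ : ∀ z w u → z *ᶜ (w +ᶜ u) ≈ᶜ z *ᶜ w +ᶜ z *ᶜ u
  *ᶜ-distribˡ (a +i b) (c +i d) (e +i f) =
      (≈ᴿ-pointwise λ n →
        Rat.distribˡ-re (seq a n) (seq b n) (seq c n) (seq d n) (seq e n) (seq f n))
    , (≈ᴿ-pointwise λ n →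
        Rat.distribˡ-im (seq a n) (seq b n) (seq c n) (seq d n) (seq e n) (seq f n))

  ≈ᶜ-trans : ∀ {z w u} → z ≈ᶜ w → w ≈ᶜ u → z ≈ᶜ u
  ≈ᶜ-trans (p , q) (r , s) = R.trans p r , R.trans q s

  +ᶜ-cong : ∀ {z z′ w w′} → z ≈ᶜ z′ → w ≈ᶜ w′ → z +ᶜ w ≈ᶜ z′ +ᶜ w′
  +ᶜ-cong (p , q) (r , s) = +ᴿ-cong p r , +ᴿ-cong q s

ℂ-commutativeRing : CommutativeRing 0ℓ 0ℓ
ℂ-commutativeRing = record
  { Carrier = ℂ
  ; _≈_ = _≈ᶜ_
  ; _+_ = _+ᶜ_
  ; _*_ = _*ᶜ_
  ; -_ = -ᶜ_
  ; 0# = 0ᶜ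
  ; 1# = 1ᶜ
  ; isCommutativeRing = record
    { isRing = record
      { +-isAbelianGroup = record
        { isGroup = record
          { isMonoid = record
            { isSemigroup = record
              { isMagma = record
                { isEquivalence = record
                  { refl = R.refl , R.refl
                  ; sym = λ (p , q) → R.sym p , R.sym q
                  ; trans = ≈ᶜ-trans
                  }
                ; ∙-cong = +ᶜ-cong
                }
              ; assoc = λ (a +i b) (c +i d) (e +i f) → R.+-assoc a c e , R.+-assoc b d f
              }
            ; identity = (λ (a +i b) → R.+-identityˡ a , R.+-identityˡ b)
                       , (λ (a +i b) → R.+-identityʳ a , R.+-identityʳ b)
            }
          ; inverse = (λ (a +i b) → R.-‿inverseˡ a , R.-‿inverseˡ b)
                    , (λ (a +i b) → R.-‿inverseʳ a , R.-‿inverseʳ b)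
          ; ⁻¹-cong = λ (p , q) → -ᴿ-cong p , -ᴿ-cong q
          }
        ; comm = λ (a +i b) (c +i d) → R.+-comm a c , R.+-comm b d
        }
      ; *-cong = λ (p , q) (r , s) →
          +ᴿ-cong (*ᴿ-cong p r) (-ᴿ-cong (*ᴿ-cong q s)) , +ᴿ-cong (*ᴿ-cong p s) (*ᴿ-cong q r)
      ; *-assoc = *ᶜ-assoc
      ; *-identity = *ᶜ-identityˡ
                   , λ z → ≈ᶜ-trans (*ᶜ-comm z 1ᶜ) (*ᶜ-identityˡ z)
      ; distrib = *ᶜ-distribˡ
                , λ z w u → ≈ᶜ-trans (*ᶜ-comm (w +ᶜ u) z)
                    (≈ᶜ-trans (*ᶜ-distribˡ z w u) (+ᶜ-cong (*ᶜ-comm z w) (*ᶜ-comm z u)))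
      }
    ; *-comm = *ᶜ-comm
    }
  }

module C = CommutativeRing ℂ-commutativeRing

opaque
  ∣∣²-cong : ∀ {z w} → z ≈ᶜ w → ∣ z ∣² ≈ᴿ ∣ w ∣²
  ∣∣²-cong (p , q) = +ᴿ-cong (*ᴿ-cong p p) (*ᴿ-cong q q)

  0≤∣_∣² : ∀ z n → 0ℚ ℚ.≤ seq ∣ z ∣² n
  0≤∣ a +i b ∣² n = Rat.0≤+ (Rat.0≤p² (seq a n)) (Rat.0≤p² (seq b n))

  ∣-z∣² : ∀ z → ∣ -ᶜ z ∣² ≈ᴿ ∣ z ∣²
  ∣-z∣² (a +i b) = ≈ᴿ-pointwise λ n →
    cong₂ Rat._+_ (Rat.neg*neg (seq a n)) (Rat.neg*neg (seq b n))

  ∣zw∣² : ∀ z w → ∣ z *ᶜ w ∣² ≈ᴿ ∣ z ∣² *ᴿ ∣ w ∣²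
  ∣zw∣² (a +i b) (c +i d) = ≈ᴿ-pointwise λ n →
    Rat.∣zw∣²-expand (seq a n) (seq b n) (seq c n) (seq d n)

  ∣z+w∣²≤ : ∀ z w → ∣ z +ᶜ w ∣² ≤ᴿ (∣ z ∣² +ᴿ ∣ w ∣²) +ᴿ (∣ z ∣² +ᴿ ∣ w ∣²)
  ∣z+w∣²≤ (a +i b) (c +i d) = ≤ᴿ-pointwise λ n → ℚₚ.≤-trans
    (Rat.p≤p+ε (Rat.0≤+ (Rat.0≤p² (seq a n Rat.- seq c n)) (Rat.0≤p² (seq b n Rat.- seq d n))))
    (ℚₚ.≤-reflexive (sym (Rat.∣z+w∣²-expand (seq a n) (seq b n) (seq c n) (seq d n))))

∑ : ∀ {V : Set} → List V → (V → ℝ) → ℝ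
∑ F a = foldr (λ v s → a v +ᴿ s) 0ᴿ F

opaque
  ∑-mono : ∀ {V : Set} {a b : V → ℝ} F → (∀ v → a v ≤ᴿ b v) → ∑ F a ≤ᴿ ∑ F b
  ∑-mono []      a≤b = ≤ᴿ-reflexive R.refl
  ∑-mono (v ∷ F) a≤b = +ᴿ-mono-≤ (a≤b v) (∑-mono F a≤b)

  ∑-+ : ∀ {V : Set} (a b : V → ℝ) F → ∑ F (λ v → a v +ᴿ b v) ≈ᴿ ∑ F a +ᴿ ∑ F b
  ∑-+ a b []      = R.sym (R.+-identityˡ 0ᴿ)
  ∑-+ a b (v ∷ F) = R.trans (+ᴿ-cong (R.refl {a v +ᴿ b v}) (∑-+ a b F))
    (≈ᴿ-pointwise λ n →
      Rat.+-interchange (seq (a v) n) (seq (b v) n) (seq (∑ F a) n) (seq (∑ F b) n))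

  ∑-*ˡ : ∀ {V : Set} c (a : V → ℝ) F → ∑ F (λ v → c *ᴿ a v) ≈ᴿ c *ᴿ ∑ F a
  ∑-*ˡ c a []      = R.sym (R.zeroʳ c)
  ∑-*ˡ c a (v ∷ F) = R.trans (+ᴿ-cong (R.refl {c *ᴿ a v}) (∑-*ˡ c a F))
    (R.sym (R.distribˡ c (a v) (∑ F a)))

  ∑-zero : ∀ {V : Set} {a : V → ℝ} F → (∀ {v} → v ∈ F → a v ≈ᴿ 0ᴿ) → ∑ F a ≈ᴿ 0ᴿ
  ∑-zero []      a≈0 = R.refl
  ∑-zero (v ∷ F) a≈0 = R.trans
    (+ᴿ-cong (a≈0 (here refl)) (∑-zero F (λ u∈F → a≈0 (there u∈F)))) (R.+-identityˡ 0ᴿ)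

  0≤fromℚ : ∀ {ε} → 0ℚ ℚ.< ε → 0ᴿ ≤ᴿ fromℚ ε
  0≤fromℚ 0<ε = ≤ᴿ-pointwise λ _ → ℚₚ.<⇒≤ 0<ε

-- Convergence of the unordered series Σ_v |f v|², in Cauchy form: every finite
-- sum over vertices outside a suitable finite set is at most ε.  Finite subsets
-- are duplicate-free lists.
SquareSummable : ∀ {V : Set} → (V → ℂ) → Set
SquareSummable f = ∀ ε → 0ℚ ℚ.< ε →
  ∃[ F₀ ] ∀ F → Unique F → Disjoint F F₀ → ∑ F (λ v → ∣ f v ∣²) ≤ᴿ fromℚ ε

record ℓ² (V : Set) : Set where
  no-eta-equality
  constructor mkℓ²
  infix 9 _at_
  field
    _at_     : V → ℂ
    summable : SquareSummable _at_

open ℓ² public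

record _≈²_ {V : Set} (f g : ℓ² V) : Set where
  no-eta-equality
  constructor mk≈²
  field
    coords-≈ : ∀ v → f at v ≈ᶜ g at v

open _≈²_ public

infix 4 _≈²_

module _ {V : Set} where

  opaque
    summable-mono : ∀ {f g : V → ℂ} → (∀ v → ∣ g v ∣² ≤ᴿ ∣ f v ∣²) →
                    SquareSummable f → SquareSummable g
    summable-mono g≤f s ε 0<ε with s ε 0<ε
    ... | F₀ , p = F₀ , λ F u d → ≤ᴿ-trans (∑-mono F g≤f) (p F u d)

    summable-zero : SquareSummable {V} (λ _ → 0ᶜ)
    summable-zero ε 0<ε = [] , λ F _ _ →
      ≤ᴿ-trans (≤ᴿ-reflexive (∑-zero F (λ _ → ∣0∣²≈0))) (0≤fromℚ 0<ε)
      where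
      ∣0∣²≈0 : ∣ 0ᶜ ∣² ≈ᴿ 0ᴿ
      ∣0∣²≈0 = R.trans (+ᴿ-cong (R.zeroˡ 0ᴿ) (R.zeroˡ 0ᴿ)) (R.+-identityˡ 0ᴿ)

    summable-+ : ∀ {f g : V → ℂ} → SquareSummable f → SquareSummable g →
                 SquareSummable (λ v → f v +ᶜ g v)
    summable-+ {f} {g} s t ε 0<ε with Rat.halve ε 0<ε
    ... | δ , 0<δ , refl with Rat.halve δ 0<δ
    ... | η , 0<η , refl with s η 0<η | t η 0<η
    ... | F₀ , p | G₀ , q = F₀ ++ G₀ , λ F u d →
      let a = λ v → ∣ f v ∣²
          b = λ v → ∣ g v ∣²
          part : ∑ F (λ v → a v +ᴿ b v) ≤ᴿ fromℚ η +ᴿ fromℚ η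
          part = ≤ᴿ-trans (≤ᴿ-reflexive (∑-+ a b F))
            (+ᴿ-mono-≤ (p F u (λ (x , y) → d (x , ∈-++⁺ˡ y)))
                       (q F u (λ (x , y) → d (x , ∈-++⁺ʳ F₀ y))))
      in ≤ᴿ-trans (∑-mono F (λ v → ∣z+w∣²≤ (f v) (g v)))
           (≤ᴿ-trans (≤ᴿ-reflexive (∑-+ (λ v → a v +ᴿ b v) (λ v → a v +ᴿ b v) F))
             (≤ᴿ-trans (+ᴿ-mono-≤ part part) (≤ᴿ-pointwise λ _ → ℚₚ.≤-refl)))

    scale-≤ : ∀ c ε → 0ℚ ℚ.< ε →
              ∃[ δ ] 0ℚ ℚ.< δ × (∀ s → s ≤ᴿ fromℚ δ → ∣ c ∣² *ᴿ s ≤ᴿ fromℚ ε)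
    scale-≤ c ε 0<ε with bounded ∣ c ∣²
    ... | K , 0<K , c≤K with Rat.divide K ε 0<K 0<ε
    ... | η , 0<η , refl with Rat.halve η 0<η
    ... | δ , 0<δ , refl = δ , 0<δ , λ s s≤δ → mk≤ λ ε′ 0<ε′ → ev-zip
      (λ n ∣c∣≤K s≤η → ℚₚ.≤-trans (Rat.*-monoˡ-≤ (0≤∣ c ∣² n) s≤η)
        (ℚₚ.≤-trans
          (Rat.*-mono (0≤∣ c ∣² n) (ℚₚ.≤-trans (Rat.p≤∣p∣ (seq ∣ c ∣² n)) ∣c∣≤K)
            (ℚₚ.<⇒≤ 0<η) (ℚₚ.≤-refl {δ Rat.+ δ}))
          (Rat.p≤p+ε (ℚₚ.<⇒≤ 0<ε′))))
      c≤K (below s≤δ δ 0<δ)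

    summable-* : ∀ c {f : V → ℂ} → SquareSummable f → SquareSummable (λ v → c *ᶜ f v)
    summable-* c {f} s ε 0<ε with scale-≤ c ε 0<ε
    ... | δ , 0<δ , small with s δ 0<δ
    ... | F₀ , p = F₀ , λ F u d →
      ≤ᴿ-trans (∑-mono F (λ v → ≤ᴿ-reflexive (∣zw∣² c (f v))))
        (≤ᴿ-trans (≤ᴿ-reflexive (∑-*ˡ ∣ c ∣² (λ v → ∣ f v ∣²) F))
          (small (∑ F (λ v → ∣ f v ∣²)) (p F u d)))

ℓ²-leftModule : Set → LeftModule C.ring 0ℓ 0ℓ
ℓ²-leftModule V = record
  { Carrierᴹ = ℓ² V
  ; _≈ᴹ_ = _≈²_
  ; _+ᴹ_ = λ f g → mkℓ² (λ v → f at v +ᶜ g at v) (summable-+ (summable f) (summable g))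
  ; _*ₗ_ = λ c f → mkℓ² (λ v → c *ᶜ f at v) (summable-* c (summable f))
  ; 0ᴹ = mkℓ² (λ _ → 0ᶜ) summable-zero
  ; -ᴹ_ = λ f → mkℓ² (λ v → -ᶜ f at v)
      (summable-mono (λ v → ≤ᴿ-reflexive (∣-z∣² (f at v))) (summable f))
  ; isLeftModule = record
    { isLeftSemimodule = record
      { +ᴹ-isCommutativeMonoid = record
        { isMonoid = record
          { isSemigroup = record
            { isMagma = record
              { isEquivalence = record
                { refl = mk≈² λ _ → C.refl
                ; sym = λ p → mk≈² λ v → C.sym (coords-≈ p v)
                ; trans = λ p q → mk≈² λ v → C.trans (coords-≈ p v) (coords-≈ q v)
                }
              ; ∙-cong = λ p q → mk≈² λ v → C.+-cong (coords-≈ p v) (coords-≈ q v)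
              }
            ; assoc = λ f g h → mk≈² λ v → C.+-assoc (f at v) (g at v) (h at v)
            }
          ; identity = (λ f → mk≈² λ v → C.+-identityˡ (f at v))
                     , (λ f → mk≈² λ v → C.+-identityʳ (f at v))
          }
        ; comm = λ f g → mk≈² λ v → C.+-comm (f at v) (g at v)
        }
      ; isPreleftSemimodule = record
        { *ₗ-cong = λ p q → mk≈² λ v → C.*-cong p (coords-≈ q v)
        ; *ₗ-zeroˡ = λ f → mk≈² λ v → C.zeroˡ (f at v)
        ; *ₗ-distribʳ = λ f c d → mk≈² λ v → C.distribʳ (f at v) c d
        ; *ₗ-identityˡ = λ f → mk≈² λ v → C.*-identityˡ (f at v)
        ; *ₗ-assoc = λ c d f → mk≈² λ v → C.*-assoc c d (f at v)
        ; *ₗ-zeroʳ = λ c → mk≈² λ v → C.zeroʳ c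
        ; *ₗ-distribˡ = λ c f g → mk≈² λ v → C.distribˡ c (f at v) (g at v)
        }
      }
    ; -ᴹ‿cong = λ p → mk≈² λ v → C.-‿cong (coords-≈ p v)
    ; -ᴹ‿inverse = (λ f → mk≈² λ v → C.-‿inverseˡ (f at v))
                 , (λ f → mk≈² λ v → C.-‿inverseʳ (f at v))
    }
  }

-- ‖ f ‖² is the supremum of the sums of |f v|² over the finite subsets of V;
-- it enters only through its upper bounds M.
‖_‖²≤_ : ∀ {V : Set} → ℓ² V → ℝ → Set
‖ f ‖²≤ M = ∀ F → Unique F → ∑ F (λ v → ∣ f at v ∣²) ≤ᴿ M

infix 4 ‖_‖²≤_

module _ {V : Set} where

  open LeftModule (ℓ²-leftModule V) public
    using (_+ᴹ_; _*ₗ_; 0ᴹ; -ᴹ_)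

  infixl 6 _-ᴹ_
  _-ᴹ_ : ℓ² V → ℓ² V → ℓ² V
  f -ᴹ g = f +ᴹ (-ᴹ g)

  infix 4 _⟶_
  _⟶_ : (ℕ → ℓ² V) → ℓ² V → Set
  s ⟶ f = ∀ ε → 0ℚ ℚ.< ε → Eventually (λ n → ‖ s n -ᴹ f ‖²≤ fromℚ ε)

module _ {V : Set} (_≟_ : DecidableEquality V) where

  kronecker : V → V → ℂ
  kronecker v u with v ≟ u
  ... | yes _ = 1ᶜ
  ... | no  _ = 0ᶜ

  basis : V → ℓ² V
  basis v = mkℓ² (λ u → kronecker v u) λ ε 0<ε → (v ∷ []) , λ F _ d →
    ≤ᴿ-trans (≤ᴿ-reflexive (∑-zero F (zero-off F d))) (0≤fromℚ 0<ε)
    where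
    zero-off : ∀ F → Disjoint F (v ∷ []) → ∀ {u} → u ∈ F → ∣ kronecker v u ∣² ≈ᴿ 0ᴿ
    zero-off F d {u} u∈F with v ≟ u
    ... | yes refl = ⊥-elim (d (u∈F , here refl))
    ... | no  _    = R.trans (+ᴿ-cong (R.zeroˡ 0ᴿ) (R.zeroˡ 0ᴿ)) (R.+-identityˡ 0ᴿ)

-- A possibly unbounded operator is given by its graph: T f g says that f is in
-- the domain of T and T f = g.
Operator : Set → Set₁
Operator V = ℓ² V → ℓ² V → Set

_I-_ : ∀ {V} → ℂ → Operator V → Operator V
(z I- T) f g = ∃[ h ] T f h × g ≈² z *ₗ f -ᴹ h

record BoundedInverse {V : Set} (T : Operator V) : Set where
  private
    module M = LeftModule (ℓ²-leftModule V)
  open LeftModuleMorphisms M.rawLeftModule M.rawLeftModule using (IsLeftModuleHomomorphism)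
  field
    inv      : ℓ² V → ℓ² V
    linear   : IsLeftModuleHomomorphism inv
    bound    : ∃[ C ] ∀ g M → ‖ g ‖²≤ M → ‖ inv g ‖²≤ C *ᴿ M
    inverseʳ : ∀ g → T (inv g) g
    inverseˡ : ∀ f g → T f g → inv g ≈² f

open BoundedInverse public using (inv)

_∈ρ_ : ∀ {V} → ℂ → Operator V → Set
z ∈ρ T = BoundedInverse (z I- T)

_∈σ_ : ∀ {V} → ℂ → Operator V → Set
z ∈σ T = ¬ (z ∈ρ T)

infix 4 _∈ρ_ _∈σ_
infix 5 _I-_

record Graph : Set₁ where
  field
    V          : Set
    _≟_        : DecidableEquality V
    _~_        : V → V → Set
    ~-sym      : ∀ {u v} → u ~ v → v ~ u
    ~-irrefl   : ∀ {v} → ¬ (v ~ v)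
    -- Local finiteness.
    neighbours : V → List V
    nbrs-unique : ∀ v → Unique (neighbours v)
    ∈-nbrs     : ∀ {u v} → u ∈ neighbours v ⇔ u ~ v

  _~?_ : Decidable _~_
  u ~? v = map′ (Equivalence.to ∈-nbrs) (Equivalence.from ∈-nbrs)
             (DecMembership._∈?_ _≟_ u (neighbours v))

open Graph public using (V)

Connected : Graph → Set
Connected Γ = ∀ u v → Star (Graph._~_ Γ) u v

Finite CountablyInfinite : Graph → Set
Finite Γ            = ∃[ n ] (Fin n ↔ V Γ)
CountablyInfinite Γ = ℕ ↔ V Γ

-- A is the closure (of the graph) of the operator defined on finite linear
-- combinations Σ cᵢ e_{vᵢ}, given as lists of pairs (cᵢ , vᵢ), by
-- e_v ↦ Σ_{u ~ v} e_u.
module _ (Γ : Graph) where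

  open Graph Γ using (_≟_; neighbours)

  e : V Γ → ℓ² (V Γ)
  e = basis _≟_

  A₀e : V Γ → ℓ² (V Γ)
  A₀e v = foldr (λ u f → e u +ᴹ f) 0ᴹ (neighbours v)

  combine : (V Γ → ℓ² (V Γ)) → List (ℂ × V Γ) → ℓ² (V Γ)
  combine b = foldr (λ (c , v) f → c *ₗ b v +ᴹ f) 0ᴹ

  record A (f g : ℓ² (V Γ)) : Set where
    field
      approx  : ℕ → List (ℂ × V Γ)
      limit   : (λ n → combine e (approx n)) ⟶ f
      limit-A : (λ n → combine A₀e (approx n)) ⟶ g

-- ⟨(zI - A)⁻¹ e_v , e_v⟩, the diagonal entry of the resolvent matrix at v: the
-- inner product of f with e_v is the coordinate f at v.
G : ∀ Γ {z} → z ∈ρ A Γ → V Γ → ℂ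
G Γ z∈ρ v = inv z∈ρ (e Γ v) at v

module Determinant {c ℓ} (K : CommutativeRing c ℓ) where

  open CommutativeRing K hiding (zero)
  open RawSemiringDefs (Semiring.rawSemiring semiring) using (sum; _^_)

  -- Laplace expansion along the first row.
  det : ∀ {n} → (Fin n → Fin n → Carrier) → Carrier
  det {zero}  M = 1#
  det {suc n} M = sum λ j →
    (- 1#) ^ toℕ j * M zero j * det (λ i k → M (suc i) (punchIn j k))

open Determinant ℂ-commutativeRing using (det)

adjacencyMatrix : ∀ Γ → V Γ → V Γ → ℂ
adjacencyMatrix Γ u v with Graph._~?_ Γ u v
... | yes _ = 1ᶜ
... | no  _ = 0ᶜ

-- det(zI - A(Γ)), with the vertices listed by the given enumeration.
P : ℂ → ∀ Γ → Finite Γ → ℂ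
P z Γ (n , enum) = det λ i j →
  z *ᶜ kronecker Finₚ._≟_ i j +ᶜ -ᶜ adjacencyMatrix Γ (vertex i) (vertex j)
  where
  vertex : Fin n → V Γ
  vertex = Inverse.to enum

-- Any two proofs of a negation are definitionally equal, so vertices of Γ ∖ v are
-- equal as soon as they are equal in Γ.
module Deletion (Γ : Graph) (v : V Γ) where

  open Graph Γ hiding (V)

  V∖v : Set
  V∖v = Σ[ u ∈ V Γ ] u ≢ v

  ext : {p q : V∖v} → proj₁ p ≡ proj₁ q → p ≡ q
  ext refl = refl

  restrict : List (V Γ) → List V∖v
  restrict [] = []
  restrict (u ∷ us) with u ≟ v
  ... | yes _   = restrict us
  ... | no  u≢v = (u , u≢v) ∷ restrict us

  ∈-restrict⁺ : ∀ {p : V∖v} us → proj₁ p ∈ us → p ∈ restrict us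
  ∈-restrict⁺ {p} (u ∷ us) m with u ≟ v | m
  ... | yes u≡v | here eq  = ⊥-elim (proj₂ p (trans eq u≡v))
  ... | yes u≡v | there m′ = ∈-restrict⁺ us m′
  ... | no  u≢v | here eq  = here (ext eq)
  ... | no  u≢v | there m′ = there (∈-restrict⁺ us m′)

  ∈-restrict⁻ : ∀ {p : V∖v} us → p ∈ restrict us → proj₁ p ∈ us
  ∈-restrict⁻ (u ∷ us) m with u ≟ v
  ∈-restrict⁻ (u ∷ us) m         | yes _ = there (∈-restrict⁻ us m)
  ∈-restrict⁻ (u ∷ us) (here eq) | no  _ = here (cong proj₁ eq)
  ∈-restrict⁻ (u ∷ us) (there m) | no  _ = there (∈-restrict⁻ us m)

  restrict-unique : ∀ us → Unique us → Unique (restrict us)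
  restrict-unique [] [] = []
  restrict-unique (u ∷ us) (u∉us ∷ uniq) with u ≟ v
  ... | yes _ = restrict-unique us uniq
  ... | no  _ = All.tabulate (λ m eq → All.lookup u∉us (∈-restrict⁻ us m) (cong proj₁ eq))
                ∷ restrict-unique us uniq

  delete : Graph
  delete = record
    { V = V∖v
    ; _≟_ = λ p q → map′ ext (cong proj₁) (proj₁ p ≟ proj₁ q)
    ; _~_ = λ p q → proj₁ p ~ proj₁ q
    ; ~-sym = ~-sym
    ; ~-irrefl = ~-irrefl
    ; neighbours = λ p → restrict (neighbours (proj₁ p))
    ; nbrs-unique = λ p → restrict-unique (neighbours (proj₁ p)) (nbrs-unique (proj₁ p))
    ; ∈-nbrs = λ {p} {q} → mk⇔
        (λ m → Equivalence.to ∈-nbrs (∈-restrict⁻ (neighbours (proj₁ q)) m))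
        (λ p~q → ∈-restrict⁺ (neighbours (proj₁ q)) (Equivalence.from ∈-nbrs p~q))
    }

  finite : Finite Γ → Finite delete
  finite (zero , enum) with Inverse.from enum v
  ... | ()
  finite (suc n , enum) = n , mk↔ₛ′ to′ from′ to-from from-to
    where
    open Inverse enum using (to; from; strictlyInverseˡ; strictlyInverseʳ)
    i : Fin (suc n)
    i = from v
    to-≢ : ∀ j → to (punchIn i j) ≢ v
    to-≢ j eq = Finₚ.punchInᵢ≢i i j (trans (sym (strictlyInverseʳ (punchIn i j))) (cong from eq))
    i≢from : ∀ (p : V∖v) → i ≢ from (proj₁ p)
    i≢from (u , u≢v) eq =
      u≢v (trans (sym (strictlyInverseˡ u)) (trans (cong to (sym eq)) (strictlyInverseˡ v)))
    to′ : Fin n → V∖v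
    to′ j = to (punchIn i j) , to-≢ j
    from′ : V∖v → Fin n
    from′ p = punchOut (i≢from p)
    to-from : ∀ p → to′ (from′ p) ≡ p
    to-from p = ext (trans (cong to (Finₚ.punchIn-punchOut (i≢from p))) (strictlyInverseˡ (proj₁ p)))
    from-to : ∀ j → from′ (to′ j) ≡ j
    from-to j = trans (Finₚ.punchOut-cong i (strictlyInverseʳ (punchIn i j)))
                      (Finₚ.punchOut-punchIn i)

_∖_ : (Γ : Graph) → V Γ → Graph
Γ ∖ v = Deletion.delete Γ v

finite-∖ : ∀ Γ v → Finite Γ → Finite (Γ ∖ v)
finite-∖ = Deletion.finite

-- The disjoint union of the vertex sets expresses that the two graphs have no
-- common vertices.
module Coupling (Γ₁ Γ₂ : Graph) (v₁ : V Γ₁) (v₂ : V Γ₂) where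

  module Γ₁ = Graph Γ₁
  module Γ₂ = Graph Γ₂

  Vertex : Set
  Vertex = V Γ₁ ⊎ V Γ₂

  data _~_ : Vertex → Vertex → Set where
    left     : ∀ {u w} → u Γ₁.~ w → inj₁ u ~ inj₁ w
    right    : ∀ {u w} → u Γ₂.~ w → inj₂ u ~ inj₂ w
    bridge₁₂ : inj₁ v₁ ~ inj₂ v₂
    bridge₂₁ : inj₂ v₂ ~ inj₁ v₁

  ~-sym : ∀ {u w} → u ~ w → w ~ u
  ~-sym (left a)  = left (Γ₁.~-sym a)
  ~-sym (right a) = right (Γ₂.~-sym a)
  ~-sym bridge₁₂  = bridge₂₁
  ~-sym bridge₂₁  = bridge₁₂

  ~-irrefl : ∀ {u} → ¬ (u ~ u)
  ~-irrefl (left a)  = Γ₁.~-irrefl a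
  ~-irrefl (right a) = Γ₂.~-irrefl a

  across : Vertex → List Vertex
  across (inj₁ u) with u Γ₁.≟ v₁
  ... | yes _ = inj₂ v₂ ∷ []
  ... | no  _ = []
  across (inj₂ u) with u Γ₂.≟ v₂
  ... | yes _ = inj₁ v₁ ∷ []
  ... | no  _ = []

  within : Vertex → List Vertex
  within (inj₁ u) = map inj₁ (Γ₁.neighbours u)
  within (inj₂ u) = map inj₂ (Γ₂.neighbours u)

  across-unique : ∀ w → Unique (across w)
  across-unique (inj₁ u) with u Γ₁.≟ v₁
  ... | yes _ = [] ∷ []
  ... | no  _ = []
  across-unique (inj₂ u) with u Γ₂.≟ v₂
  ... | yes _ = [] ∷ []
  ... | no  _ = []

  within-unique : ∀ w → Unique (within w)
  within-unique (inj₁ u) = Uniqueₚ.map⁺ Sumₚ.inj₁-injective (Γ₁.nbrs-unique u)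
  within-unique (inj₂ u) = Uniqueₚ.map⁺ Sumₚ.inj₂-injective (Γ₂.nbrs-unique u)

  within-across : ∀ w → Disjoint (within w) (across w)
  within-across (inj₁ u) (m , m′) with u Γ₁.≟ v₁ | ∈-map⁻ inj₁ m
  within-across (inj₁ u) (m , here ()) | yes _ | _ , _ , refl
  within-across (inj₁ u) (m , there ()) | yes _ | _
  within-across (inj₁ u) (m , ()) | no _ | _
  within-across (inj₂ u) (m , m′) with u Γ₂.≟ v₂ | ∈-map⁻ inj₂ m
  within-across (inj₂ u) (m , here ()) | yes _ | _ , _ , refl
  within-across (inj₂ u) (m , there ()) | yes _ | _
  within-across (inj₂ u) (m , ()) | no _ | _

  within⇒~ : ∀ {u} w → u ∈ within w → u ~ w
  within⇒~ (inj₁ w) m with ∈-map⁻ inj₁ m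
  ... | _ , m′ , refl = left (Equivalence.to Γ₁.∈-nbrs m′)
  within⇒~ (inj₂ w) m with ∈-map⁻ inj₂ m
  ... | _ , m′ , refl = right (Equivalence.to Γ₂.∈-nbrs m′)

  across⇒~ : ∀ {u} w → u ∈ across w → u ~ w
  across⇒~ (inj₁ w) m with w Γ₁.≟ v₁
  across⇒~ (inj₁ w) (here refl) | yes refl = bridge₂₁
  across⇒~ (inj₁ w) ()          | no _
  across⇒~ (inj₂ w) m with w Γ₂.≟ v₂
  across⇒~ (inj₂ w) (here refl) | yes refl = bridge₁₂
  across⇒~ (inj₂ w) ()          | no _

  ~⇒∈ : ∀ {u w} → u ~ w → u ∈ within w ++ across w
  ~⇒∈ (left a)  = ∈-++⁺ˡ (∈-map⁺ inj₁ (Equivalence.from Γ₁.∈-nbrs a))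
  ~⇒∈ (right a) = ∈-++⁺ˡ (∈-map⁺ inj₂ (Equivalence.from Γ₂.∈-nbrs a))
  ~⇒∈ bridge₁₂  = ∈-++⁺ʳ (within (inj₂ v₂)) there-is
    where
    there-is : inj₁ v₁ ∈ across (inj₂ v₂)
    there-is with v₂ Γ₂.≟ v₂
    ... | yes _ = here refl
    ... | no ¬p = ⊥-elim (¬p refl)
  ~⇒∈ bridge₂₁  = ∈-++⁺ʳ (within (inj₁ v₁)) there-is
    where
    there-is : inj₂ v₂ ∈ across (inj₁ v₁)
    there-is with v₁ Γ₁.≟ v₁
    ... | yes _ = here refl
    ... | no ¬p = ⊥-elim (¬p refl)

  ∈⇒~ : ∀ {u} w → u ∈ within w ++ across w → u ~ w
  ∈⇒~ w m with ∈-++⁻ (within w) m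
  ... | inj₁ m′ = within⇒~ w m′
  ... | inj₂ m′ = across⇒~ w m′

  coupling : Graph
  coupling = record
    { V = Vertex
    ; _≟_ = Sumₚ.≡-dec Γ₁._≟_ Γ₂._≟_
    ; _~_ = _~_
    ; ~-sym = ~-sym
    ; ~-irrefl = ~-irrefl
    ; neighbours = λ w → within w ++ across w
    ; nbrs-unique = λ w → Uniqueₚ.++⁺ (within-unique w) (across-unique w) (within-across w)
    ; ∈-nbrs = λ {u} {w} → mk⇔ (∈⇒~ w) ~⇒∈
    }

open Coupling public using (coupling)

{-# OPTIONS --safe #-}
-- Eliminating the second component of (z - A(Γ)) (f₁ , f₂) = (g₁ , g₂) through the
-- resolvent of A(Γ₂) leaves on the finite graph Γ₁ the equation
-- (z - A(Γ₁) - G E) f₁ = g₁ + (R₂ g₂)(v₂) e_{v₁}, where E is the diagonal matrix unit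
-- at v₁; expanding in the row of v₁, the determinant of that matrix is
-- D = P(z,Γ₁) - G P(z,Γ₁∖v₁).  If D is invertible, Cramer's rule gives f₁ and then
-- f₂ = R₂ (g₂ + f₁(v₁) e_{v₂}), a bounded inverse of z - A(Γ).  Conversely, a bounded
-- inverse applied to the unit vectors of Γ₁ gives a right inverse of the matrix, so
-- D is invertible by multiplicativity of the determinant.  Constructively, the first
-- half yields D ≈ 0 from non-invertibility because a Cauchy real that no positive
-- rational bounds away from 0 is null.

module Submission where

open import Defs
open import Algebra.Bundles using (CommutativeRing; Semiring)
import Algebra.Definitions.RawSemiring as RawSemiringDefinitions
open import Algebra.Module.Bundles using (LeftModule)
open import Algebra.Module.Morphism.Structures using (module LeftModuleMorphisms)
import Algebra.Properties.AbelianGroup as AbelianGroupProperties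
import Algebra.Properties.Group as GroupProperties
import Algebra.Properties.Ring as RingProperties
import Algebra.Properties.Semiring.Sum as SemiringSum
import Algebra.Solver.Ring.NaturalCoefficients.Default as NaturalSolver
open import Data.Empty using (⊥-elim)
open import Data.Fin.Base as Fin using (Fin; zero; suc; toℕ; punchIn; punchOut; inject₁)
import Data.Fin.Properties as Finₚ
open import Data.List.Base using (List; []; _∷_; _++_; map; mapMaybe; foldr; allFin)
open import Data.List.Membership.Propositional using (_∈_; _∉_)
open import Data.List.Membership.Propositional.Properties
  using (∈-map⁺; ∈-map⁻; ∈-++⁺ˡ; ∈-++⁺ʳ; ∈-allFin)
open import Data.List.Relation.Binary.Disjoint.Propositional using (Disjoint)
open import Data.List.Relation.Unary.All as All using ([]; _∷_)
open import Data.List.Relation.Unary.AllPairs using ([]; _∷_)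
open import Data.List.Relation.Unary.Any using (here; there)
open import Data.List.Relation.Unary.Unique.Propositional using (Unique)
import Data.List.Relation.Unary.Unique.Propositional.Properties as Uniqueₚ
open import Data.Nat.Base as ℕ using (ℕ; zero; suc; z≤n; s≤s)
import Data.Nat.Properties as ℕₚ
open import Data.Product.Base using (Σ; Σ-syntax; ∃-syntax; _×_; _,_; proj₁; proj₂)
open import Data.Rational.Base as ℚ using (ℚ; 0ℚ; 1ℚ)
import Data.Rational.Properties as ℚₚ
open import Data.Rational.Solver using (module +-*-Solver)
open import Data.Sum using (_⊎_; inj₁; inj₂; isInj₁; isInj₂)
import Data.Sum.Properties as Sumₚ
open import Data.Vec.Functional using (Vector; insertAt; removeAt; updateAt; tail)
open import Data.Vec.Functional.Properties
  using (insertAt-lookup; insertAt-punchIn; insertAt-removeAt; updateAt-updates; updateAt-minimal)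
open import Function.Base using (_∘_; const)
open import Function.Bundles using (_↔_; _⇔_; Inverse; Equivalence; mk⇔)
open import Level using (_⊔_)
import Relation.Binary.Reasoning.Setoid as SetoidReasoning
open import Relation.Binary.Definitions using (DecidableEquality)
open import Relation.Binary.PropositionalEquality as ≡ using (_≡_; _≢_)
open import Relation.Nullary using (¬_; yes; no)

-- Both directions therefore rest on identities for `det` over an arbitrary commutative ring. As
-- `det` is given by expansion along the first row only, the product formula and the principal
-- minors are drawn from one fact: an alternating function of n rows of length n is `det` times its
-- value at the identity matrix. For unbounded degrees the domain of the closure `A Γ₂` has no
-- coordinatewise description: f and its neighbour sums may both be square-summable although f lies
-- outside it. So the approximating finite combinations themselves are cut down to Γ₂, or extended
-- by the finitely many terms on Γ₁. The bridge alters the images by multiples of `e₁` and `e₂`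
-- whose coefficients are single coordinates, and coordinates are continuous. On the finite Γ₁
-- coordinatewise equations suffice. A bounded inverse is two-sided, so the right inverse from
-- Cramer's rule must be shown to be a left inverse as well.

-- Determinants

punchIn-elim : ∀ {ℓ n} (i : Fin (suc n)) (P : Fin (suc n) → Set ℓ) →
               P i → (∀ k → P (punchIn i k)) → ∀ s → P s
punchIn-elim i P pᵢ p s with i Finₚ.≟ s
... | yes ≡.refl = pᵢ
... | no  i≢s    = ≡.subst P (Finₚ.punchIn-punchOut i≢s) (p (punchOut i≢s))

-- For p ≤ k, deleting column p and then k, or column k+1 and then p, removes the same two columns
-- in opposite order. This and the next two identities express that pairing, which drives the
-- cancellation in `det-vanish₀₁`.
punchIn-inject₁ : ∀ {n} (p k : Fin n) → p Fin.≤ k → punchIn (inject₁ p) k ≡ suc k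
punchIn-inject₁ zero    k       p≤k       = ≡.refl
punchIn-inject₁ (suc p) (suc k) (s≤s p≤k) = ≡.cong suc (punchIn-inject₁ p k p≤k)

punchIn-suc : ∀ {n} (p k : Fin n) → p Fin.≤ k → punchIn (suc k) p ≡ inject₁ p
punchIn-suc zero    k       p≤k       = ≡.refl
punchIn-suc (suc p) (suc k) (s≤s p≤k) = ≡.cong suc (punchIn-suc p k p≤k)

punchIn-comm : ∀ {n} (p k : Fin (suc n)) (i : Fin n) → p Fin.≤ k →
               punchIn (inject₁ p) (punchIn k i) ≡ punchIn (suc k) (punchIn p i)
punchIn-comm zero    k       i       p≤k       = ≡.refl
punchIn-comm (suc p) (suc k) zero    (s≤s p≤k) = ≡.refl
punchIn-comm (suc p) (suc k) (suc i) (s≤s p≤k) = ≡.cong suc (punchIn-comm p k i p≤k)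

module Determinants {c ℓ} (K : CommutativeRing c ℓ) where

  open CommutativeRing K hiding (zero)
  open Determinant K using (det) public
  open RawSemiringDefinitions (Semiring.rawSemiring semiring) using (_^_)
  open SemiringSum semiring using (sum; sum-cong-≋; ∑-distrib-+; ∑-comm; *-distribˡ-sum; *-distribʳ-sum)
  open GroupProperties +-group using (inverseˡ-unique)
  open NaturalSolver commutativeSemiring using (solve; _:=_; _:+_; _:*_; con)
  open SetoidReasoning setoid

  Row : ℕ → Set c
  Row = Vector Carrier

  infix 4 _≋_ _≋₂_

  _≋_ : ∀ {n} → Row n → Row n → Set ℓ
  u ≋ v = ∀ j → u j ≈ v j

  _≋₂_ : ∀ {k m} → Vector (Row m) k → Vector (Row m) k → Set ℓ
  M ≋₂ N = ∀ i → M i ≋ N i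

  -- The one combination c u + v covers addition, scaling and (with c = -1 and both rows zero)
  -- preservation of zero, so each notion of linearity needs a single law.
  lin : ∀ {m} → Carrier → Row m → Row m → Row m
  lin c u v j = c * u j + v j

  δ : ∀ {n} → Fin n → Row n
  δ zero    zero    = 1#
  δ zero    (suc j) = 0#
  δ (suc i) zero    = 0#
  δ (suc i) (suc j) = δ i j

  -- Signs are kept as factors `- 1#`, as in the definition of `det`: the solver works in
  -- commutative semirings and sees `- 1#` as a variable, and the cancellation is supplied
  -- afterwards by this law.
  -1+1 : ∀ x → - 1# * x + x ≈ 0#
  -1+1 x = begin
    - 1# * x + x       ≈⟨ +-congˡ (*-identityˡ x) ⟨
    - 1# * x + 1# * x  ≈⟨ distribʳ x (- 1#) 1# ⟨
    (- 1# + 1#) * x    ≈⟨ *-congʳ (-‿inverseˡ 1#) ⟩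
    0# * x             ≈⟨ zeroˡ x ⟩
    0#                 ∎

  x+y≈0⇒x≈-1*y : ∀ {x y} → x + y ≈ 0# → x ≈ - 1# * y
  x+y≈0⇒x≈-1*y {x} {y} eq =
    trans (inverseˡ-unique x y eq) (sym (inverseˡ-unique (- 1# * y) y (-1+1 y)))

  sum-zero : ∀ {n} {t : Row n} → (∀ j → t j ≈ 0#) → sum t ≈ 0#
  sum-zero {zero}  t≈0 = refl
  sum-zero {suc n} t≈0 = trans (+-cong (t≈0 zero) (sum-zero (t≈0 ∘ suc))) (+-identityˡ 0#)

  sum-lin : ∀ {n} a (s t : Row n) → sum (λ j → a * s j + t j) ≈ a * sum s + sum t
  sum-lin a s t = trans (∑-distrib-+ (λ j → a * s j) t) (+-congʳ (sym (*-distribˡ-sum a s)))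

  sum-δ : ∀ {n} (a : Row n) k → sum (λ j → a j * δ j k) ≈ a k
  sum-δ a zero = trans (+-cong (*-identityʳ (a zero)) (sum-zero (λ j → zeroʳ (a (suc j)))))
                       (+-identityʳ (a zero))
  sum-δ a (suc k) = trans (+-cong (zeroʳ (a zero)) (sum-δ (a ∘ suc) k)) (+-identityˡ (a (suc k)))

  δ-sum : ∀ {n} (a : Row n) k → sum (λ j → δ k j * a j) ≈ a k
  δ-sum a zero = trans (+-cong (*-identityˡ (a zero)) (sum-zero (λ j → zeroˡ (a (suc j)))))
                       (+-identityʳ (a zero))
  δ-sum a (suc k) = trans (+-cong (zeroˡ (a zero)) (δ-sum (a ∘ suc) k)) (+-identityˡ (a (suc k)))

  δ-diag : ∀ {n} (i : Fin n) → δ i i ≈ 1#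
  δ-diag zero    = refl
  δ-diag (suc i) = δ-diag i

  δ-off : ∀ {n} {i j : Fin n} → i ≢ j → δ i j ≈ 0#
  δ-off {i = zero}  {zero}  i≢j = ⊥-elim (i≢j ≡.refl)
  δ-off {i = zero}  {suc j} i≢j = refl
  δ-off {i = suc i} {zero}  i≢j = refl
  δ-off {i = suc i} {suc j} i≢j = δ-off (i≢j ∘ ≡.cong suc)

  δ-sym : ∀ {n} (i j : Fin n) → δ i j ≈ δ j i
  δ-sym zero    zero    = refl
  δ-sym zero    (suc j) = refl
  δ-sym (suc i) zero    = refl
  δ-sym (suc i) (suc j) = δ-sym i j

  δ-punchIn : ∀ {n} i (j k : Fin n) → δ (punchIn i j) (punchIn i k) ≡ δ j k
  δ-punchIn zero    j       k       = ≡.refl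
  δ-punchIn (suc i) zero    zero    = ≡.refl
  δ-punchIn (suc i) zero    (suc k) = ≡.refl
  δ-punchIn (suc i) (suc j) zero    = ≡.refl
  δ-punchIn (suc i) (suc j) (suc k) = δ-punchIn i j k

  insertAt-cong : ∀ {n} {u v : Row n} i {x y} → u ≋ v → x ≈ y → insertAt u i x ≋ insertAt v i y
  insertAt-cong {u = u} {v} i {x} {y} u≋v x≈y = punchIn-elim i _
    (trans (reflexive (insertAt-lookup u i x)) (trans x≈y (reflexive (≡.sym (insertAt-lookup v i y)))))
    (λ k → trans (reflexive (insertAt-punchIn u i x k))
             (trans (u≋v k) (reflexive (≡.sym (insertAt-punchIn v i y k)))))

  insertAt-cong₂ : ∀ {k m} {X Y : Vector (Row m) k} i {u v} → X ≋₂ Y → u ≋ v →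
                   insertAt X i u ≋₂ insertAt Y i v
  insertAt-cong₂ {X = X} {Y} i {u} {v} X≋Y u≋v = punchIn-elim i _
    (λ j → trans (reflexive (≡.cong-app (insertAt-lookup X i u) j))
             (trans (u≋v j) (reflexive (≡.cong-app (≡.sym (insertAt-lookup Y i v)) j))))
    (λ k j → trans (reflexive (≡.cong-app (insertAt-punchIn X i u k) j))
               (trans (X≋Y k j) (reflexive (≡.cong-app (≡.sym (insertAt-punchIn Y i v k)) j))))

  insertAt-lin : ∀ {n} i a (u v : Row n) →
                 insertAt (lin a u v) i 0# ≋ lin a (insertAt u i 0#) (insertAt v i 0#)
  insertAt-lin i a u v = punchIn-elim i _
    (trans (reflexive (insertAt-lookup (lin a u v) i 0#))
      (sym (trans (+-cong (*-congˡ (reflexive (insertAt-lookup u i 0#))) (reflexive (insertAt-lookup v i 0#)))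
        (trans (+-identityʳ (a * 0#)) (zeroʳ a)))))
    (λ k → trans (reflexive (insertAt-punchIn (lin a u v) i 0# k))
      (sym (+-cong (*-congˡ (reflexive (insertAt-punchIn u i 0# k))) (reflexive (insertAt-punchIn v i 0# k)))))

  insertAt-0 : ∀ {n} (i : Fin (suc n)) → insertAt {n = n} (const 0#) i 0# ≋ const 0#
  insertAt-0 i = punchIn-elim i _ (reflexive (insertAt-lookup (const 0#) i 0#))
    (λ k → reflexive (insertAt-punchIn (const 0#) i 0# k))

  split-at : ∀ {n} (v : Row (suc n)) j → v ≋ lin (v j) (δ j) (insertAt (removeAt v j) j 0#)
  split-at v j = punchIn-elim j _
    (sym (trans (+-cong (trans (*-congˡ (δ-diag j)) (*-identityʳ (v j)))
                        (reflexive (insertAt-lookup (removeAt v j) j 0#))) (+-identityʳ (v j))))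
    (λ k → sym (trans (+-cong (trans (*-congˡ (δ-off (Finₚ.punchInᵢ≢i j k ∘ ≡.sym))) (zeroʳ (v j)))
                              (reflexive (insertAt-punchIn (removeAt v j) j 0# k))) (+-identityˡ _)))

  record LinearForm {m} (L : Row m → Carrier) : Set (c ⊔ ℓ) where
    field
      cong   : ∀ {u v} → u ≋ v → L u ≈ L v
      linear : ∀ a u v → L (lin a u v) ≈ a * L u + L v

    on-zero : L (const 0#) ≈ 0#
    on-zero = begin
      L (const 0#)                           ≈⟨ cong (λ j → sym (-1+1 0#)) ⟩
      L (lin (- 1#) (const 0#) (const 0#))   ≈⟨ linear (- 1#) _ _ ⟩
      - 1# * L (const 0#) + L (const 0#)     ≈⟨ -1+1 _ ⟩
      0#                                     ∎

  expand-form : ∀ {m} {L : Row m → Carrier} → LinearForm L → ∀ v → L v ≈ sum (λ j → v j * L (δ j))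
  expand-form {zero} lf v = trans (cong (λ ())) on-zero where open LinearForm lf
  expand-form {suc m} {L} lf v = begin
    L v
      ≈⟨ cong (split-at v zero) ⟩
    L (lin (v zero) (δ zero) (shift (v ∘ suc)))
      ≈⟨ linear (v zero) (δ zero) _ ⟩
    v zero * L (δ zero) + L (shift (v ∘ suc))
      ≈⟨ +-congˡ (expand-form shifted (v ∘ suc)) ⟩
    v zero * L (δ zero) + sum (λ j → v (suc j) * L (shift (δ j)))
      ≈⟨ +-congˡ (sum-cong-≋ (λ j → *-congˡ (cong (shift-δ j)))) ⟩
    v zero * L (δ zero) + sum (λ j → v (suc j) * L (δ (suc j)))
      ∎
    where
    open LinearForm lf
    shift : Row m → Row (suc m)
    shift w = insertAt w zero 0#
    shift-δ : ∀ j → shift (δ j) ≋ δ (suc j)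
    shift-δ j zero    = refl
    shift-δ j (suc k) = refl
    shifted : LinearForm (L ∘ shift)
    shifted = record
      { cong   = λ u≋v → cong (insertAt-cong zero u≋v refl)
      ; linear = λ a u w → trans (cong (insertAt-lin zero a u w)) (linear a _ _)
      }

  -- Linearity in row r is stated for any three matrices that agree off r. It then applies alike to
  -- matrices presented through `insertAt`, through `updateAt` or by patterns, which are equal only
  -- pointwise.
  record Multilinear {k m} (F : Vector (Row m) k → Carrier) : Set (c ⊔ ℓ) where
    field
      cong   : ∀ {M N} → M ≋₂ N → F M ≈ F N
      linear : ∀ r a {M M′ M″} → (∀ s → s ≢ r → M s ≋ M′ s) → (∀ s → s ≢ r → M s ≋ M″ s) →
               M r ≋ lin a (M′ r) (M″ r) → F M ≈ a * F M′ + F M″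

  -- Vanishing on equal rows is demanded rather than a change of sign: it implies the latter over
  -- every commutative ring, whereas the converse fails when 2 is a zero divisor.
  record Alternating {k m} (F : Vector (Row m) k → Carrier) : Set (c ⊔ ℓ) where
    field
      multilinear : Multilinear F
      vanish      : ∀ {r s M} → r ≢ s → M r ≋ M s → F M ≈ 0#
    open Multilinear multilinear public

  row-form : ∀ {k m} {F : Vector (Row m) (suc k) → Carrier} → Multilinear F →
             ∀ X i → LinearForm (λ v → F (insertAt X i v))
  row-form {F = F} ml X i = record
    { cong   = λ u≋v → cong (insertAt-cong₂ i (λ _ _ → refl) u≋v)
    ; linear = λ a u v → linear i a (others _ _) (others _ _)
        (λ j → trans (reflexive (≡.cong-app (insertAt-lookup X i _) j))
          (sym (+-cong (*-congˡ (reflexive (≡.cong-app (insertAt-lookup X i u) j)))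
                       (reflexive (≡.cong-app (insertAt-lookup X i v) j)))))
    }
    where
    open Multilinear ml
    others : ∀ u v s → s ≢ i → insertAt X i u s ≋ insertAt X i v s
    others u v = punchIn-elim i _ (λ i≢i → ⊥-elim (i≢i ≡.refl)) λ k _ j →
      reflexive (≡.cong-app (≡.trans (insertAt-punchIn X i u k) (≡.sym (insertAt-punchIn X i v k))) j)

  insert-multilinear : ∀ {k m} {F : Vector (Row m) (suc k) → Carrier} → Multilinear F →
                       ∀ i u → Multilinear (λ Y → F (insertAt Y i u))
  insert-multilinear {F = F} ml i u = record
    { cong   = λ X≋Y → cong (insertAt-cong₂ i X≋Y (λ _ → refl))
    ; linear = λ r a {M} {M′} {M″} e e′ eʳ → linear (punchIn i r) a (others r M M′ e) (others r M M″ e′)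
        (λ j → trans (lookup-in M r j) (trans (eʳ j) (sym (+-cong (*-congˡ (lookup-in M′ r j)) (lookup-in M″ r j)))))
    }
    where
    open Multilinear ml
    lookup-in : ∀ Y r → insertAt Y i u (punchIn i r) ≋ Y r
    lookup-in Y r j = reflexive (≡.cong-app (insertAt-punchIn Y i u r) j)
    others : ∀ r Y Z → (∀ s → s ≢ r → Y s ≋ Z s) →
             ∀ s → s ≢ punchIn i r → insertAt Y i u s ≋ insertAt Z i u s
    others r Y Z e = punchIn-elim i _
      (λ _ j → reflexive (≡.cong-app (≡.trans (insertAt-lookup Y i u) (≡.sym (insertAt-lookup Z i u))) j))
      (λ s s≢r j → trans (lookup-in Y s j) (trans (e s (s≢r ∘ ≡.cong (punchIn i)) j) (sym (lookup-in Z s j))))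

  insert-alternating : ∀ {k m} {F : Vector (Row m) (suc k) → Carrier} → Alternating F →
                       ∀ i u → Alternating (λ Y → F (insertAt Y i u))
  insert-alternating alt i u = record
    { multilinear = insert-multilinear multilinear i u
    ; vanish      = λ {r} {s} {M} r≢s eq → vanish {punchIn i r} {punchIn i s}
        (r≢s ∘ Finₚ.punchIn-injective i r s)
        (λ j → trans (reflexive (≡.cong-app (insertAt-punchIn M i u r) j))
          (trans (eq j) (reflexive (≡.cong-app (≡.sym (insertAt-punchIn M i u s)) j))))
    }
    where open Alternating alt

  record LinearMap {m n} (φ : Row m → Row n) : Set (c ⊔ ℓ) where
    field
      cong   : ∀ {u v} → u ≋ v → φ u ≋ φ v
      linear : ∀ a u v → φ (lin a u v) ≋ lin a (φ u) (φ v)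

  -- Serves two maps of rows: multiplication by a matrix, for the product formula, and insertion of
  -- a zero column, for minors.
  pull-alternating : ∀ {k m n} {F : Vector (Row n) k → Carrier} → Alternating F →
                     {φ : Row m → Row n} → LinearMap φ → Alternating (λ X → F (φ ∘ X))
  pull-alternating alt φ-linear = record
    { multilinear = record
      { cong   = λ X≋Y → cong (λ i → φ.cong (X≋Y i))
      ; linear = λ r a e e′ eʳ → linear r a (λ s s≢r → φ.cong (e s s≢r)) (λ s s≢r → φ.cong (e′ s s≢r))
          (λ j → trans (φ.cong eʳ j) (φ.linear a _ _ j))
      }
    ; vanish = λ r≢s eq → vanish r≢s (φ.cong eq)
    }
    where
    open Alternating alt
    module φ = LinearMap φ-linear

  -- Polarisation: expanding f (a + b) (a + b) ≈ 0 leaves f a b + f b a. Vanishing is assumed only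
  -- for the first two rows, so the lemma is already available while `det` is being shown to be
  -- alternating.
  swap : ∀ {k m} {F : Vector (Row m) (suc (suc k)) → Carrier} → Multilinear F →
         (∀ a X → F (insertAt (insertAt X zero a) zero a) ≈ 0#) →
         ∀ a b X → F (insertAt (insertAt X zero b) zero a) ≈ - 1# * F (insertAt (insertAt X zero a) zero b)
  swap {k} {m} {F} ml equal a b X = x+y≈0⇒x≈-1*y (begin
    f a b + f b a
      ≈⟨ solve 2 (λ p q → p :+ q := con 1 :* (con 1 :* con 0 :+ p) :+ (con 1 :* q :+ con 0)) refl (f a b) (f b a) ⟩
    1# * (1# * 0# + f a b) + (1# * f b a + 0#)
      ≈⟨ +-cong (*-congˡ (+-congʳ (*-congˡ (equal a X)))) (+-congˡ (equal b X)) ⟨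
    1# * (1# * f a a + f a b) + (1# * f b a + f b b)
      ≈⟨ +-cong (*-congˡ (right.linear a 1# a b)) (right.linear b 1# a b) ⟨
    1# * f a s + f b s
      ≈⟨ LinearForm.linear (row-form ml (insertAt X zero s) zero) 1# a b ⟨
    f s s
      ≈⟨ equal s X ⟩
    0# ∎)
    where
    f : Row m → Row m → Carrier
    f u v = F (insertAt (insertAt X zero v) zero u)
    s : Row m
    s = lin 1# a b
    module right u = LinearForm (row-form (insert-multilinear ml zero u) X zero)

  -- The determinant as an alternating form of its rows

  det-cong : ∀ {n} {M N : Vector (Row n) n} → M ≋₂ N → det M ≈ det N
  det-cong {zero}  M≋N = refl
  det-cong {suc n} M≋N = sum-cong-≋ λ j →
    *-cong (*-congˡ {(- 1#) ^ toℕ j} (M≋N zero j)) (det-cong (λ i k → M≋N (suc i) (punchIn j k)))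

  minor : ∀ {n} → Vector (Row (suc n)) (suc n) → Fin (suc n) → Vector (Row n) n
  minor M j i = removeAt (M (suc i)) j

  laplace : ∀ {n} → Vector (Row (suc n)) (suc n) → Row (suc n)
  laplace M j = (- 1#) ^ toℕ j * M zero j * det (minor M j)

  det-multilinear : ∀ n → Multilinear (det {n})
  det-multilinear n = record { cong = det-cong ; linear = lin-det n }
    where
    lin-det : ∀ n r a {M M′ M″} → (∀ s → s ≢ r → M s ≋ M′ s) → (∀ s → s ≢ r → M s ≋ M″ s) →
              M r ≋ lin a (M′ r) (M″ r) → det {n} M ≈ a * det M′ + det M″
    lin-det (suc n) zero a {M} {M′} {M″} e e′ eʳ = trans
      (sum-cong-≋ λ j → trans
        (*-congʳ (*-congˡ (eʳ j)))
        (trans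
          (solve 5 (λ s a x y d → (s :* (a :* x :+ y)) :* d := a :* (s :* x :* d) :+ s :* y :* d) refl
            ((- 1#) ^ toℕ j) a (M′ zero j) (M″ zero j) (det (minor M j)))
          (+-cong (*-congˡ (*-congˡ (det-cong λ i k → e (suc i) (λ ()) (punchIn j k))))
                  (*-congˡ (det-cong λ i k → e′ (suc i) (λ ()) (punchIn j k))))))
      (sum-lin a (laplace M′) (laplace M″))
    lin-det (suc n) (suc r) a {M} {M′} {M″} e e′ eʳ = trans
      (sum-cong-≋ λ j → trans
        (*-congˡ (lin-det n r a {minor M j} {minor M′ j} {minor M″ j}
          (λ s s≢r k → e (suc s) (s≢r ∘ Finₚ.suc-injective) (punchIn j k))
          (λ s s≢r k → e′ (suc s) (s≢r ∘ Finₚ.suc-injective) (punchIn j k))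
          (λ k → eʳ (punchIn j k))))
        (trans
          (solve 5 (λ s a x d d′ → (s :* x) :* (a :* d :+ d′) := a :* (s :* x :* d) :+ s :* x :* d′) refl
            ((- 1#) ^ toℕ j) a (M zero j) (det (minor M′ j)) (det (minor M″ j)))
          (+-cong (*-congˡ (*-congʳ (*-congˡ (e zero (λ ()) j)))) (*-congʳ (*-congˡ (e′ zero (λ ()) j))))))
      (sum-lin a (laplace M′) (laplace M″))

  -- The pairs (j , k) with k ≥ j and those with k < j cancel one another.
  sum-antisymmetric : ∀ {n} (t : Fin (suc n) → Fin n → Carrier) →
    (∀ p k → p Fin.≤ k → t (inject₁ p) k + t (suc k) p ≈ 0#) → sum (λ j → sum (t j)) ≈ 0#
  sum-antisymmetric {zero}  t anti = trans (+-identityʳ 0#) refl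
  sum-antisymmetric {suc n} t anti = begin
    sum (t zero) + sum (λ j → t (suc j) zero + sum (λ k → t (suc j) (suc k)))
      ≈⟨ +-congˡ (∑-distrib-+ (λ j → t (suc j) zero) (λ j → sum (λ k → t (suc j) (suc k)))) ⟩
    sum (t zero) + (sum (λ j → t (suc j) zero) + sum (λ j → sum (λ k → t (suc j) (suc k))))
      ≈⟨ +-assoc _ _ _ ⟨
    (sum (t zero) + sum (λ j → t (suc j) zero)) + sum (λ j → sum (λ k → t (suc j) (suc k)))
      ≈⟨ +-cong (trans (sym (∑-distrib-+ (t zero) (λ j → t (suc j) zero)))
                       (sum-zero (λ k → anti zero k z≤n)))
                (sum-antisymmetric (λ j k → t (suc j) (suc k)) (λ p k p≤k → anti (suc p) (suc k) (s≤s p≤k))) ⟩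
    0# + 0#
      ≈⟨ +-identityʳ 0# ⟩
    0# ∎

  -- Expanding along both equal rows gives a sum over ordered pairs of distinct columns. Exchanging
  -- the two columns keeps the entries and the remaining minor but reverses the sign.
  det-vanish₀₁ : ∀ {n} {M : Vector (Row (suc (suc n))) (suc (suc n))} → M zero ≋ M (suc zero) → det M ≈ 0#
  det-vanish₀₁ {n} {M} eq = begin
    det M
      ≈⟨ sum-cong-≋ (λ j → trans
           (*-cong (*-congˡ (eq j)) refl)
           (*-distribˡ-sum (σ j * a j) (λ k → σ k * a (punchIn j k) * D j k))) ⟩
    sum (λ j → sum (λ k → t j k))
      ≈⟨ sum-antisymmetric t cancel ⟩
    0# ∎
    where
    a : Row (suc (suc n))
    a = M (suc zero)
    σ : ∀ {m} → Fin m → Carrier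
    σ j = (- 1#) ^ toℕ j
    D : Fin (suc (suc n)) → Fin (suc n) → Carrier
    D j k = det (λ i l → M (suc (suc i)) (punchIn j (punchIn k l)))
    t : Fin (suc (suc n)) → Fin (suc n) → Carrier
    t j k = σ j * a j * (σ k * a (punchIn j k) * D j k)
    cancel : ∀ p k → p Fin.≤ k → t (inject₁ p) k + t (suc k) p ≈ 0#
    cancel p k p≤k = begin
      t (inject₁ p) k + t (suc k) p
        ≈⟨ +-cong
             (*-cong (*-congʳ (reflexive (≡.cong ((- 1#) ^_) (Finₚ.toℕ-inject₁ p))))
                     (*-congʳ (*-congˡ (reflexive (≡.cong a (punchIn-inject₁ p k p≤k))))))
             (*-congˡ (*-cong (*-congˡ (reflexive (≡.cong a (punchIn-suc p k p≤k))))
                     (det-cong (λ i l → reflexive (≡.cong (M (suc (suc i))) (≡.sym (punchIn-comm p k l p≤k))))))) ⟩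
      -- `σ (suc k)` unfolds to `- 1# * σ k`, while `inject₁ p` keeps the exponent of p; this shift
      -- by one is the source of the opposite sign.
      σ p * a (inject₁ p) * (σ k * a (suc k) * D (inject₁ p) k)
        + (- 1# * σ k) * a (suc k) * (σ p * a (inject₁ p) * D (inject₁ p) k)
        ≈⟨ solve 6 (λ n s x r y d → (s :* x) :* (r :* y :* d) :+ (n :* r) :* y :* (s :* x :* d)
                      := n :* ((s :* x) :* (r :* y :* d)) :+ (s :* x) :* (r :* y :* d)) refl
             (- 1#) (σ p) (a (inject₁ p)) (σ k) (a (suc k)) (D (inject₁ p) k) ⟩
      - 1# * (σ p * a (inject₁ p) * (σ k * a (suc k) * D (inject₁ p) k))
        + σ p * a (inject₁ p) * (σ k * a (suc k) * D (inject₁ p) k)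
        ≈⟨ -1+1 _ ⟩
      0# ∎

  insert-head : ∀ {k m} (M : Vector (Row m) (suc k)) → insertAt (tail M) zero (M zero) ≋₂ M
  insert-head M zero    j = refl
  insert-head M (suc i) j = refl

  DetVanishes : ℕ → Set (c ⊔ ℓ)
  DetVanishes n = ∀ {r s} {M : Vector (Row n) n} → r ≢ s → M r ≋ M s → det M ≈ 0#

  det-vanish-below : ∀ {n} → DetVanishes n → ∀ {r s} {M : Vector (Row (suc n)) (suc n)} →
                     r ≢ s → M (suc r) ≋ M (suc s) → det M ≈ 0#
  det-vanish-below ih {r} {s} {M} r≢s eq = sum-zero λ j → trans
    (*-congˡ (ih {r} {s} {minor M j} r≢s (λ k → eq (punchIn j k)))) (zeroʳ ((- 1#) ^ toℕ j * M zero j))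

  -- If row 0 equals row 1 the double expansion applies. Otherwise exchanging rows 0 and 1 moves the
  -- coincidence below the first row, where every minor has two equal rows and the induction
  -- hypothesis applies.
  det-vanish-head : ∀ {n} → DetVanishes n → ∀ s {M : Vector (Row (suc n)) (suc n)} →
                    M zero ≋ M (suc s) → det M ≈ 0#
  det-vanish-head {suc n} ih zero    {M} eq = det-vanish₀₁ {M = M} eq
  det-vanish-head {suc n} ih (suc s) {M} eq = begin
    det M
      ≈⟨ det-cong {M = M} {insertAt (insertAt X zero b) zero a}
           (λ { zero j → refl ; (suc zero) j → refl ; (suc (suc i)) j → refl }) ⟩
    det (insertAt (insertAt X zero b) zero a)
      ≈⟨ swap (det-multilinear _) (λ u Y → det-vanish₀₁ {M = insertAt (insertAt Y zero u) zero u} (λ _ → refl)) a b X ⟩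
    - 1# * det (insertAt (insertAt X zero a) zero b)
      ≈⟨ *-congˡ (det-vanish-below ih {zero} {suc s} {insertAt (insertAt X zero a) zero b} (λ ()) eq) ⟩
    - 1# * 0#
      ≈⟨ zeroʳ _ ⟩
    0# ∎
    where
    a = M zero
    b = M (suc zero)
    X = tail (tail M)

  det-vanish : ∀ n → DetVanishes n
  det-vanish (suc n) {zero}  {zero}      r≢s eq = ⊥-elim (r≢s ≡.refl)
  det-vanish (suc n) {zero}  {suc s} {M} r≢s eq = det-vanish-head (det-vanish n) s {M} eq
  det-vanish (suc n) {suc r} {zero}  {M} r≢s eq = det-vanish-head (det-vanish n) r {M} (λ j → sym (eq j))
  det-vanish (suc n) {suc r} {suc s} {M} r≢s eq =
    det-vanish-below (det-vanish n) {r} {s} {M} (r≢s ∘ ≡.cong suc) eq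

  det-alternating : ∀ n → Alternating (det {n})
  det-alternating n = record { multilinear = det-multilinear n ; vanish = λ {r} {s} {M} → det-vanish n {r} {s} {M} }

  -- Uniqueness of alternating forms

  replace-rows : ∀ k {m} {H : Vector (Row m) k → Carrier} (φ : Row m → Row m) →
                 (∀ {X Y} → X ≋₂ Y → H X ≈ H Y) →
                 (∀ X r → H X ≈ H (updateAt X r φ)) → ∀ X → H X ≈ H (φ ∘ X)
  replace-rows zero    φ H-cong step X = H-cong (λ ())
  replace-rows (suc k) {m} {H} φ H-cong step X = begin
    H X
      ≈⟨ step X zero ⟩
    H (updateAt X zero φ)
      ≈⟨ H-cong (λ { zero j → refl ; (suc i) j → refl }) ⟩
    H (insertAt (tail X) zero (φ (X zero)))
      ≈⟨ replace-rows k {H = λ Y → H (insertAt Y zero (φ (X zero)))} φ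
           (λ X≋Y → H-cong (insertAt-cong₂ zero X≋Y (λ _ → refl)))
           (λ Y r → trans (step (insertAt Y zero (φ (X zero))) (suc r))
                          (H-cong (λ { zero j → refl ; (suc i) j → refl })))
           (tail X) ⟩
    H (insertAt (φ ∘ tail X) zero (φ (X zero)))
      ≈⟨ H-cong (λ { zero j → refl ; (suc i) j → refl }) ⟩
    H (φ ∘ X) ∎

  erase : ∀ {m} → Fin (suc m) → Row (suc m) → Row (suc m)
  erase j v = insertAt (removeAt v j) j 0#

  insert-col : ∀ {k m} → Fin (suc m) → Vector (Row m) k → Vector (Row (suc m)) k
  insert-col j X r = insertAt (X r) j 0#

  -- Subtracting from row r its j-th entry times the unit row `δ j` changes nothing, because a
  -- matrix containing `δ j` twice is sent to zero. Done in every other row, this clears column j.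
  erase-col : ∀ {k m} {F : Vector (Row (suc m)) (suc k) → Carrier} → Alternating F → ∀ i j X →
              F (insertAt X i (δ j)) ≈ F (insertAt (erase j ∘ X) i (δ j))
  erase-col {k} {m} {F} alt i j = replace-rows k (erase j) cong step
    where
    H : Vector (Row (suc m)) k → Carrier
    H Y = F (insertAt Y i (δ j))
    open Alternating (insert-alternating alt i (δ j))
    with-row : Vector (Row (suc m)) k → Fin k → Row (suc m) → Vector (Row (suc m)) k
    with-row X r v = updateAt X r (const v)
    step : ∀ X r → H X ≈ H (updateAt X r (erase j))
    step X r = begin
      H X
        ≈⟨ linear r (X r j)
             (λ s s≢r l → reflexive (≡.cong-app (≡.sym (updateAt-minimal s r X s≢r)) l))
             (λ s s≢r l → reflexive (≡.cong-app (≡.sym (updateAt-minimal s r X s≢r)) l))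
             (λ l → trans (split-at (X r) j l) (sym (+-cong
               (*-congˡ (reflexive (≡.cong-app (updateAt-updates r X) l)))
               (reflexive (≡.cong-app (updateAt-updates r X) l))))) ⟩
      X r j * H (with-row X r (δ j)) + H (updateAt X r (erase j))
        ≈⟨ +-congʳ (trans (*-congˡ repeated) (zeroʳ (X r j))) ⟩
      0# + H (updateAt X r (erase j))
        ≈⟨ +-identityˡ _ ⟩
      H (updateAt X r (erase j)) ∎
      where
      Y = with-row X r (δ j)
      repeated : H Y ≈ 0#
      repeated = Alternating.vanish alt {i} {punchIn i r} (Finₚ.punchInᵢ≢i i r ∘ ≡.sym)
        (λ l → reflexive (≡.cong-app (≡.trans (insertAt-lookup Y i (δ j))
          (≡.sym (≡.trans (insertAt-punchIn Y i (δ j) r) (updateAt-updates r X)))) l))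

  -- After `erase-col`, F depends only on the matrix without row i and column j. That it is
  -- alternating there is what permits induction on the size.
  minor-alternating : ∀ {k m} {F : Vector (Row (suc m)) (suc k) → Carrier} → Alternating F → ∀ i j →
                      Alternating (λ X → F (insertAt (insert-col j X) i (δ j)))
  minor-alternating alt i j = pull-alternating (insert-alternating alt i (δ j)) record
    { cong   = λ u≋v → insertAt-cong j u≋v refl
    ; linear = insertAt-lin j
    }

  insert-δ : ∀ {n} (i : Fin (suc n)) → insertAt (insert-col i δ) i (δ i) ≋₂ δ
  insert-δ i = punchIn-elim i _
    (λ j → reflexive (≡.cong-app (insertAt-lookup (insert-col i δ) i (δ i)) j))
    (λ k j → trans (reflexive (≡.cong-app (insertAt-punchIn (insert-col i δ) i (δ i) k) j)) (row k j))
    where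
    row : ∀ k → insertAt (δ k) i 0# ≋ δ (punchIn i k)
    row k = punchIn-elim i _
      (trans (reflexive (insertAt-lookup (δ k) i 0#)) (sym (δ-off (Finₚ.punchInᵢ≢i i k))))
      (λ l → trans (reflexive (insertAt-punchIn (δ k) i 0# l)) (reflexive (≡.sym (δ-punchIn i k l))))

  -- The argument is the permutation matrix with rows δ j, δ 0, ..., δ (j-1), δ (j+1), ..., a cycle
  -- of length j + 1. Exchanging its top two rows brings `δ zero` to the top and leaves the cycle
  -- for j - 1 in one dimension less.
  cycle-sign : ∀ n {F : Vector (Row (suc n)) (suc n) → Carrier} → Alternating F → ∀ j →
               F (insertAt (insert-col j δ) zero (δ j)) ≈ (- 1#) ^ toℕ j * F δ
  cycle-sign n {F} alt zero = trans (cong (insert-δ zero)) (sym (*-identityˡ (F δ)))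
    where open Alternating alt
  cycle-sign (suc n) {F} alt (suc j) = begin
    F (insertAt (insert-col (suc j) δ) zero (δ (suc j)))
      ≈⟨ cong rows ⟩
    F (insertAt (insertAt Z zero (δ zero)) zero (δ (suc j)))
      ≈⟨ swap multilinear (λ a X → vanish {zero} {suc zero} (λ ()) (λ _ → refl)) (δ (suc j)) (δ zero) Z ⟩
    - 1# * F (insertAt (insertAt Z zero (δ (suc j))) zero (δ zero))
      ≈⟨ *-congˡ (cong rows′) ⟩
    - 1# * F′ (insertAt (insert-col j δ) zero (δ j))
      ≈⟨ *-congˡ (cycle-sign n {F′} (minor-alternating alt zero zero) j) ⟩
    - 1# * ((- 1#) ^ toℕ j * F′ δ)
      ≈⟨ *-assoc (- 1#) _ _ ⟨
    - 1# * (- 1#) ^ toℕ j * F′ δ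
      ≈⟨ *-congˡ (cong (insert-δ zero)) ⟩
    - 1# * (- 1#) ^ toℕ j * F δ ∎
    where
    open Alternating alt
    Z : Vector (Row (suc (suc n))) n
    Z r = insertAt (insertAt (δ r) j 0#) zero 0#
    F′ : Vector (Row (suc n)) (suc n) → Carrier
    F′ X = F (insertAt (insert-col zero X) zero (δ zero))
    rows : insertAt (insert-col (suc j) δ) zero (δ (suc j)) ≋₂
           insertAt (insertAt Z zero (δ zero)) zero (δ (suc j))
    rows zero          l       = refl
    rows (suc zero)    zero    = refl
    rows (suc zero)    (suc l) = insertAt-0 j l
    rows (suc (suc r)) zero    = refl
    rows (suc (suc r)) (suc l) = refl
    rows′ : insertAt (insertAt Z zero (δ (suc j))) zero (δ zero) ≋₂
            insertAt (insert-col zero (insertAt (insert-col j δ) zero (δ j))) zero (δ zero)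
    rows′ zero          l       = refl
    rows′ (suc zero)    zero    = refl
    rows′ (suc zero)    (suc l) = refl
    rows′ (suc (suc r)) zero    = refl
    rows′ (suc (suc r)) (suc l) = refl

  -- Expand in the first row, clear column j below it and apply the induction hypothesis to the
  -- minor. `cycle-sign` then supplies exactly the sign in the Laplace expansion, so the terms
  -- reassemble to `det M`.
  alternating-unique : ∀ n {F : Vector (Row n) n → Carrier} → Alternating F → ∀ M → F M ≈ det M * F δ
  alternating-unique zero    {F} alt M = trans (cong (λ ())) (sym (*-identityˡ (F δ)))
    where open Alternating alt
  alternating-unique (suc n) {F} alt M = begin
    F M
      ≈⟨ cong (insert-head M) ⟨
    F (insertAt (tail M) zero (M zero))
      ≈⟨ expand-form (row-form multilinear (tail M) zero) (M zero) ⟩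
    sum (λ j → M zero j * F (insertAt (tail M) zero (δ j)))
      ≈⟨ sum-cong-≋ (λ j → trans
           (*-congˡ (trans (erase-col alt zero j (tail M))
             (trans (alternating-unique n (minor-alternating alt zero j) (minor M j))
                    (*-congˡ (cycle-sign n alt j)))))
           (solve 4 (λ x d s f → x :* (d :* (s :* f)) := s :* x :* d :* f) refl
             (M zero j) (det (minor M j)) ((- 1#) ^ toℕ j) (F δ))) ⟩
    sum (λ j → laplace M j * F δ)
      ≈⟨ *-distribʳ-sum (F δ) (laplace M) ⟨
    det M * F δ ∎
    where open Alternating alt

  det-δ : ∀ n → det {n} δ ≈ 1#
  det-δ zero    = refl
  det-δ (suc n) = begin
    1# * 1# * det (δ {n}) + sum (λ j → laplace (δ {suc n}) (suc j))
      ≈⟨ +-cong (trans (*-congʳ (*-identityˡ 1#)) (trans (*-identityˡ _) (det-δ n)))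
                (sum-zero (λ j → trans (*-congʳ (zeroʳ ((- 1#) ^ toℕ (suc j))))
                                       (zeroˡ (det (minor (δ {suc n}) (suc j)))))) ⟩
    1# + 0#
      ≈⟨ +-identityʳ 1# ⟩
    1# ∎

  -- Products, minors and inverse matrices

  _·_ : ∀ {k m n} → Vector (Row m) k → Vector (Row n) m → Vector (Row n) k
  (M · N) i j = sum (λ k → M i k * N k j)

  -- As a function of the rows of M, det (M · N) is alternating, and at the identity matrix its
  -- value is `det N`.
  det-· : ∀ {n} (M N : Vector (Row n) n) → det (M · N) ≈ det M * det N
  det-· {n} M N = trans (alternating-unique n (pull-alternating (det-alternating n) times-N) M)
    (*-congˡ (det-cong (λ i j → δ-sum (λ k → N k j) i)))
    where
    times-N : LinearMap (λ v j → sum (λ k → v k * N k j))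
    times-N = record
      { cong   = λ u≋v j → sum-cong-≋ (λ k → *-congʳ (u≋v k))
      ; linear = λ a u v j → trans
          (sum-cong-≋ (λ k → trans (distribʳ (N k j) (a * u k) (v k)) (+-congʳ (*-assoc a (u k) (N k j)))))
          (sum-lin a (λ k → u k * N k j) (λ k → v k * N k j))
      }

  -- No sign occurs since row and column carry the same index: the alternating function of the minor
  -- takes the value `det δ`, that is 1, at the identity. Uniqueness stands in for an expansion
  -- along row i.
  det-minor : ∀ {n} (X : Vector (Row (suc n)) n) i →
              det (insertAt X i (δ i)) ≈ det (λ r → removeAt (X r) i)
  det-minor {n} X i = begin
    det (insertAt X i (δ i))
      ≈⟨ erase-col (det-alternating (suc n)) i i X ⟩
    det (insertAt (insert-col i Y) i (δ i))
      ≈⟨ alternating-unique n (minor-alternating (det-alternating (suc n)) i i) Y ⟩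
    det Y * det (insertAt (insert-col i δ) i (δ i))
      ≈⟨ *-congˡ (trans (det-cong (insert-δ i)) (det-δ (suc n))) ⟩
    det Y * 1#
      ≈⟨ *-identityʳ (det Y) ⟩
    det Y ∎
    where
    Y : Vector (Row n) n
    Y r = removeAt (X r) i

  det-replace-self : ∀ {n} (M : Vector (Row (suc n)) (suc n)) k →
                     det (insertAt (removeAt M k) k (M k)) ≈ det M
  det-replace-self M k = det-cong {M = insertAt (removeAt M k) k (M k)} {M} λ i j →
    reflexive (≡.cong-app (insertAt-removeAt M k i) j)

  det-replace-other : ∀ {n} (M : Vector (Row (suc n)) (suc n)) k l →
                      det (insertAt (removeAt M k) k (M (punchIn k l))) ≈ 0#
  det-replace-other {n} M k l =
    det-vanish (suc n) {k} {punchIn k l} {insertAt (removeAt M k) k (M (punchIn k l))}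
      (Finₚ.punchInᵢ≢i k l ∘ ≡.sym)
      (λ j → reflexive (≡.cong-app (≡.trans (insertAt-lookup (removeAt M k) k (M (punchIn k l)))
        (≡.sym (insertAt-punchIn (removeAt M k) k (M (punchIn k l)) l))) j))

  det-replace : ∀ {n} (M : Vector (Row (suc n)) (suc n)) i k →
                det (insertAt (removeAt M k) k (M i)) ≈ δ i k * det M
  det-replace M i k = punchIn-elim k (λ i → det (insertAt (removeAt M k) k (M i)) ≈ δ i k * det M)
    (trans (det-replace-self M k) (sym (trans (*-congʳ (δ-diag k)) (*-identityˡ (det M)))))
    (λ l → trans (det-replace-other M k l)
                 (sym (trans (*-congʳ (δ-off (Finₚ.punchInᵢ≢i k l))) (zeroˡ (det M)))))
    i

  expand-row : ∀ {k m} {F : Vector (Row m) (suc k) → Carrier} → Multilinear F →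
               ∀ X i v → F (insertAt X i v) ≈ sum (λ j → v j * F (insertAt X i (δ j)))
  expand-row ml X i = expand-form (row-form ml X i)

  -- The (j , k) entry of the adjugate matrix is the determinant of M with its k-th
  -- row replaced by the j-th unit row.
  cramer : ∀ {n} (M : Vector (Row (suc n)) (suc n)) i k →
           sum (λ j → M i j * det (insertAt (removeAt M k) k (δ j))) ≈ δ i k * det M
  cramer {n} M i k = trans
    (sym (expand-row {F = det {suc n}} (det-multilinear (suc n)) (removeAt M k) k (M i)))
    (det-replace M i k)

  ·-assoc : ∀ {k l m n} (M : Vector (Row l) k) (N : Vector (Row m) l) (O : Vector (Row n) m) →
            (M · N) · O ≋₂ M · (N · O)
  ·-assoc M N O i j = begin
    sum (λ b → sum (λ a → M i a * N a b) * O b j)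
      ≈⟨ sum-cong-≋ (λ b → *-distribʳ-sum (O b j) (λ a → M i a * N a b)) ⟩
    sum (λ b → sum (λ a → M i a * N a b * O b j))
      ≈⟨ ∑-comm (λ b a → M i a * N a b * O b j) ⟩
    sum (λ a → sum (λ b → M i a * N a b * O b j))
      ≈⟨ sum-cong-≋ (λ a → sum-cong-≋ (λ b → *-assoc (M i a) (N a b) (O b j))) ⟩
    sum (λ a → sum (λ b → M i a * (N a b * O b j)))
      ≈⟨ sum-cong-≋ (λ a → *-distribˡ-sum (M i a) (λ b → N a b * O b j)) ⟨
    sum (λ a → M i a * sum (λ b → N a b * O b j)) ∎

  ·-cancel : ∀ {n} (M X : Vector (Row n) n) → M · X ≋₂ δ → ∀ y i →
             sum (λ j → M i j * sum (λ k → X j k * y k)) ≈ y i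
  ·-cancel M X MX≋δ y i = begin
    -- The vector y is read as a matrix with one column, whose index is `zero {0}` in `Fin 1`.
    sum (λ j → M i j * sum (λ k → X j k * y k)) ≈⟨ ·-assoc M X (λ k _ → y k) i (zero {0}) ⟨
    sum (λ k → (M · X) i k * y k)               ≈⟨ sum-cong-≋ (λ k → *-congʳ {y k} (MX≋δ i k)) ⟩
    sum (λ k → δ i k * y k)                     ≈⟨ δ-sum y i ⟩
    y i                                         ∎

  right-inverse : ∀ {n} (M : Vector (Row (suc n)) (suc n)) d → det M * d ≈ 1# →
                  ∃[ X ] M · X ≋₂ δ
  right-inverse {n} M d det*d≈1 = (λ j k → adj j k * d) , λ i k → begin
    sum (λ j → M i j * (adj j k * d))
      ≈⟨ sum-cong-≋ (λ j → *-assoc (M i j) (adj j k) d) ⟨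
    sum (λ j → M i j * adj j k * d)
      ≈⟨ *-distribʳ-sum d (λ j → M i j * adj j k) ⟨
    sum (λ j → M i j * adj j k) * d
      ≈⟨ *-congʳ (M·adj i k) ⟩
    δ i k * det M * d
      ≈⟨ trans (*-assoc (δ i k) (det M) d) (trans (*-congˡ det*d≈1) (*-identityʳ (δ i k))) ⟩
    δ i k ∎
    where
    adjugate : Σ[ X ∈ Vector (Row (suc n)) (suc n) ]
               ∀ i k → sum (λ j → M i j * X j k) ≈ δ i k * det M
    adjugate = (λ j k → det (insertAt (removeAt M k) k (δ j))) , cramer M
    open Σ adjugate renaming (proj₁ to adj; proj₂ to M·adj)

  det-right-inverse : ∀ {n} {M X : Vector (Row n) n} → M · X ≋₂ δ → det M * det X ≈ 1#
  det-right-inverse {n} {M} {X} MX≋δ = trans (sym (det-· M X)) (trans (det-cong MX≋δ) (det-δ n))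

  -- M and Y are inverses of X on the two sides, so M ≈ M (X Y) ≈ (M X) Y ≈ Y.
  left-inverse : ∀ {n} {M X Y : Vector (Row n) n} → M · X ≋₂ δ → X · Y ≋₂ δ → X · M ≋₂ δ
  left-inverse {n} {M} {X} {Y} MX≋δ XY≋δ i j =
    trans (sum-cong-≋ (λ k → *-congˡ {X i k} (M≋Y k j))) (XY≋δ i j)
    where
    M≋Y : M ≋₂ Y
    M≋Y i j = begin
      M i j                     ≈⟨ sum-δ (M i) j ⟨
      sum (λ k → M i k * δ k j) ≈⟨ sum-cong-≋ (λ k → *-congˡ {M i k} (XY≋δ k j)) ⟨
      (M · (X · Y)) i j         ≈⟨ ·-assoc M X Y i j ⟨
      ((M · X) · Y) i j         ≈⟨ sum-cong-≋ (λ k → *-congʳ {Y k j} (MX≋δ i k)) ⟩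
      sum (λ k → δ i k * Y k j) ≈⟨ δ-sum (λ k → Y k j) i ⟩
      Y i j                     ∎

  -- `det X` is invertible with inverse `det M`, so X has a right inverse of its own. This avoids
  -- transposes and expansions along columns.
  inverse : ∀ {n} (M : Vector (Row (suc n)) (suc n)) d → det M * d ≈ 1# →
            ∃[ X ] M · X ≋₂ δ × X · M ≋₂ δ
  inverse {n} M d det*d≈1 = X , MX≋δ , left-inverse {M = M} {X} {proj₁ inverse-of-X} MX≋δ (proj₂ inverse-of-X)
    where
    open Σ (right-inverse M d det*d≈1) renaming (proj₁ to X; proj₂ to MX≋δ)
    inverse-of-X : ∃[ Y ] X · Y ≋₂ δ
    inverse-of-X = right-inverse X (det M)
      (trans (*-comm (det X) (det M)) (det-right-inverse {M = M} {X} MX≋δ))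

  -- Linearity in row i splits off g times the determinant with that row replaced by `δ i`, which is
  -- a principal minor. With g = -G this produces the term G P(z, Γ₁∖v₁) of the criterion.
  det-shift : ∀ {n} (M N : Vector (Row (suc n)) (suc n)) i g →
              (∀ k → N (punchIn i k) ≋ M (punchIn i k)) → N i ≋ lin g (δ i) (M i) →
              det N ≈ det M + g * det (λ r s → M (punchIn i r) (punchIn i s))
  det-shift {n} M N i g others at-i = begin
    det N
      ≈⟨ linear i g {N} {insertAt (removeAt M i) i (δ i)} {M}
           (punchIn-elim i _ (λ i≢i → ⊥-elim (i≢i ≡.refl)) λ k _ j → trans (others k j)
             (reflexive (≡.cong-app (≡.sym (insertAt-punchIn (removeAt M i) i (δ i) k)) j)))
           (punchIn-elim i _ (λ i≢i → ⊥-elim (i≢i ≡.refl)) λ k _ → others k)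
           (λ j → trans (at-i j) (+-congʳ (*-congˡ
             (reflexive (≡.cong-app (≡.sym (insertAt-lookup (removeAt M i) i (δ i))) j))))) ⟩
    g * det (insertAt (removeAt M i) i (δ i)) + det M
      ≈⟨ +-comm _ _ ⟩
    det M + g * det (insertAt (removeAt M i) i (δ i))
      ≈⟨ +-congˡ (*-congˡ (det-minor (removeAt M i) i)) ⟩
    det M + g * det (λ r s → M (punchIn i r) (punchIn i s)) ∎
    where open Multilinear (det-multilinear (suc n))

-- Real and complex numbers

opaque
  unfolding Rat._+_

  p²≤ε²⇒∣p∣≤ε : ∀ p {ε} → 0ℚ ℚ.< ε → p Rat.* p ℚ.≤ ε Rat.* ε → Rat.∣ p ∣ ℚ.≤ ε
  p²≤ε²⇒∣p∣≤ε p {ε} 0<ε p²≤ε² = ℚₚ.≮⇒≥ λ ε<∣p∣ → ℚₚ.<-irrefl ≡.refl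
    (ℚₚ.<-≤-trans
      (ℚₚ.<-trans (ℚₚ.*-monoʳ-<-pos ε {{ℚ.positive 0<ε}} ε<∣p∣)
                  (ℚₚ.*-monoˡ-<-pos ℚ.∣ p ∣ {{ℚ.positive (ℚₚ.<-trans 0<ε ε<∣p∣)}} ε<∣p∣))
      (≡.subst (ℚ._≤ ε ℚ.* ε) ∣p∣²≡p² p²≤ε²))
    where
    ∣p∣²≡p² : p ℚ.* p ≡ ℚ.∣ p ∣ ℚ.* ℚ.∣ p ∣
    ∣p∣²≡p² = ≡.trans (≡.sym (ℚₚ.0≤p⇒∣p∣≡p (Rat.0≤p² p))) (ℚₚ.∣p*q∣≡∣p∣*∣q∣ p p)

  p≤q+∣p-q∣ : ∀ p q → p ℚ.≤ q Rat.+ Rat.∣ p Rat.- q ∣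
  p≤q+∣p-q∣ p q = ℚₚ.≤-trans
    (ℚₚ.≤-reflexive (≡.trans (Rat.a≡a-b+b p q) (Rat.+-comm (p Rat.- q) q)))
    (Rat.+-mono-≤ (ℚₚ.≤-refl {q}) (Rat.p≤∣p∣ (p Rat.- q)))

  p+r≤q+r⇒p≤q : ∀ p q r → p Rat.+ r ℚ.≤ q Rat.+ r → p ℚ.≤ q
  p+r≤q+r⇒p≤q p q r le = ≡.subst₂ ℚ._≤_ (cancel p) (cancel q) (Rat.+-mono-≤ le (ℚₚ.≤-refl {Rat.- r}))
    where
    cancel : ∀ s → s Rat.+ r Rat.+ Rat.- r ≡ s
    cancel s = ≡.trans (Rat.+-assoc s r (Rat.- r))
      (≡.trans (≡.cong (s Rat.+_) (Rat.+-inverseʳ r)) (Rat.+-identityʳ s))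

  *-pos : ∀ {p q} → 0ℚ ℚ.< p → 0ℚ ℚ.< q → 0ℚ ℚ.< p Rat.* q
  *-pos {p} {q} 0<p 0<q = ℚₚ.positive⁻¹ (p ℚ.* q) {{ℚₚ.pos*pos⇒pos p {{ℚ.positive 0<p}} q {{ℚ.positive 0<q}}}}

  p-0≡p : ∀ p → p Rat.- 0ℚ ≡ p
  p-0≡p p = ≡.trans (≡.cong (p Rat.+_) Rat.-0≡0) (Rat.+-identityʳ p)

  -- Totalised by the value 0 off the positive rationals, so that it can be applied termwise to a
  -- sequence that is positive only from some index on.
  recip : ℚ → ℚ
  recip p with 0ℚ ℚₚ.<? p
  ... | yes 0<p = (ℚ.1/ p) {{ℚₚ.pos⇒nonZero p {{ℚ.positive 0<p}}}}
  ... | no  _   = 0ℚ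

  *-recip : ∀ {p} → 0ℚ ℚ.< p → p Rat.* recip p ≡ 1ℚ
  *-recip {p} 0<p with 0ℚ ℚₚ.<? p
  ... | yes 0<p′ = ℚₚ.*-inverseʳ p {{ℚₚ.pos⇒nonZero p {{ℚ.positive 0<p′}}}}
  ... | no  0≮p  = ⊥-elim (0≮p 0<p)

  recip-diff : ∀ {p q r s} → p Rat.* r ≡ 1ℚ → q Rat.* s ≡ 1ℚ → r Rat.- s ≡ (q Rat.- p) Rat.* (r Rat.* s)
  recip-diff {p} {q} {r} {s} pr≡1 qs≡1 = begin
    r Rat.- s
      ≡⟨ ≡.cong₂ Rat._-_ (Rat.*-identityʳ r) (Rat.*-identityʳ s) ⟨
    r Rat.* 1ℚ Rat.- s Rat.* 1ℚ
      ≡⟨ ≡.cong₂ (λ x y → r Rat.* x Rat.- s Rat.* y) qs≡1 pr≡1 ⟨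
    r Rat.* (q Rat.* s) Rat.- s Rat.* (p Rat.* r)
      ≡⟨ solve 4 (λ p q r s → r :* (q :* s) :- s :* (p :* r) := (q :- p) :* (r :* s)) ≡.refl p q r s ⟩
    (q Rat.- p) Rat.* (r Rat.* s) ∎
    where
    open ≡.≡-Reasoning
    open +-*-Solver using (solve; _:*_; _:-_; _:=_)

  0<recip : ∀ {p} → 0ℚ ℚ.< p → 0ℚ ℚ.< recip p
  0<recip {p} 0<p with 0ℚ ℚₚ.<? p
  ... | yes 0<p′ = ℚₚ.positive⁻¹ _ {{ℚₚ.1/pos⇒pos p {{ℚ.positive 0<p′}}}}
  ... | no  0≮p  = ⊥-elim (0≮p 0<p)

∣recip∣≤ : ∀ {p δ} → 0ℚ ℚ.< δ → δ ℚ.≤ p → Rat.∣ recip p ∣ ℚ.≤ recip δ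
∣recip∣≤ {p} {δ} 0<δ δ≤p = begin
  Rat.∣ recip p ∣                    ≡⟨ Rat.0≤p⇒∣p∣≡p (ℚₚ.<⇒≤ (0<recip 0<p)) ⟩
  recip p                            ≡⟨ Rat.*-identityʳ (recip p) ⟨
  recip p Rat.* 1ℚ                   ≡⟨ ≡.cong (recip p Rat.*_) (*-recip 0<δ) ⟨
  recip p Rat.* (δ Rat.* recip δ)    ≤⟨ Rat.*-monoˡ-≤ (ℚₚ.<⇒≤ (0<recip 0<p)) (Rat.*-mono (ℚₚ.<⇒≤ 0<δ) δ≤p
                                          (ℚₚ.<⇒≤ (0<recip 0<δ)) (ℚₚ.≤-refl {recip δ})) ⟩
  recip p Rat.* (p Rat.* recip δ)    ≡⟨ Rat.*-assoc (recip p) p (recip δ) ⟨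
  recip p Rat.* p Rat.* recip δ      ≡⟨ ≡.cong (Rat._* recip δ) (≡.trans (Rat.*-comm (recip p) p) (*-recip 0<p)) ⟩
  1ℚ Rat.* recip δ                   ≡⟨ Rat.*-identityˡ (recip δ) ⟩
  recip δ ∎
  where
  open ℚₚ.≤-Reasoning
  0<p : 0ℚ ℚ.< p
  0<p = ℚₚ.<-≤-trans 0<δ δ≤p

ev-all : ∀ {P : ℕ → Set} → (∀ n → P n) → Eventually P
ev-all p = 0 , λ n _ → p n

infix 4 _<<_
-- Positivity with a witness: the rational lower bound supplies the modulus of convergence of the
-- reciprocal.
_<<_ : ℚ → ℝ → Set
δ << x = 0ℚ ℚ.< δ × Eventually (λ n → δ ℚ.≤ seq x n)

reciprocal : ∀ x {δ} → δ << x → ∃[ y ] x *ᴿ y ≈ᴿ 1ᴿ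
reciprocal x {δ} (0<δ , N , δ≤x) = y , mk≈ λ ε 0<ε → N , λ n N≤n → ℚₚ.≤-trans
  (ℚₚ.≤-reflexive (≡.trans (≡.cong (λ q → Rat.∣ q Rat.- 1ℚ ∣) (*-recip (0<x n N≤n))) (Rat.∣p-p∣≡0 1ℚ)))
  (ℚₚ.<⇒≤ 0<ε)
  where
  0<x : ∀ n → N ℕ.≤ n → 0ℚ ℚ.< seq x n
  0<x n N≤n = ℚₚ.<-≤-trans 0<δ (δ≤x n N≤n)
  d : ℚ
  d = recip δ
  y-cauchy : Cauchy (λ n → recip (seq x n))
  -- Since |1/p - 1/q| = |q - p| / (p q) and both reciprocals are at most d = 1/δ, a tolerance η
  -- with d² η = ε suffices.
  y-cauchy ε 0<ε with Rat.divide (d Rat.* d) ε (*-pos (0<recip 0<δ) (0<recip 0<δ)) 0<ε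
  ... | η , 0<η , ≡.refl with cauchy x η 0<η
  ... | M , close-x = M ℕ.⊔ N , λ m n m≥ n≥ →
    ℚₚ.≤-trans
      (ℚₚ.≤-reflexive (≡.cong Rat.∣_∣
        (recip-diff (*-recip (0<x m (N≤ m≥))) (*-recip (0<x n (N≤ n≥))))))
      (ℚₚ.≤-trans
        (Rat.∣p*q∣≤ (close-x n m (M≤ n≥) (M≤ m≥))
          (Rat.∣p*q∣≤ (∣recip∣≤ 0<δ (δ≤x m (N≤ m≥))) (∣recip∣≤ 0<δ (δ≤x n (N≤ n≥)))))
        (ℚₚ.≤-reflexive (Rat.*-comm η (d Rat.* d))))
    where
    M≤ : ∀ {m} → M ℕ.⊔ N ℕ.≤ m → M ℕ.≤ m
    M≤ = ℕₚ.≤-trans (ℕₚ.m≤m⊔n M N)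
    N≤ : ∀ {m} → M ℕ.⊔ N ℕ.≤ m → N ℕ.≤ m
    N≤ = ℕₚ.≤-trans (ℕₚ.m≤n⊔m M N)
  y : ℝ
  y = mkℝ (λ n → recip (seq x n)) y-cauchy

opaque
  ≤ᴿ-refl : ∀ {x} → x ≤ᴿ x
  ≤ᴿ-refl = ≤ᴿ-reflexive R.refl

  -- A single term of the sequence, taken far enough, decides whether the sequence
  -- stays below ε or above a positive rational.
  ≤0-stable : ∀ x → ¬ (∃[ δ ] δ << x) → x ≤ᴿ 0ᴿ
  ≤0-stable x ¬0<x = mk≤ go
    where
    go : ∀ ε → 0ℚ ℚ.< ε → Eventually (λ n → seq x n ℚ.≤ 0ℚ Rat.+ ε)
    go ε 0<ε with Rat.halve ε 0<ε
    ... | δ , 0<δ , ≡.refl with Rat.halve δ 0<δ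
    ... | γ , 0<γ , ≡.refl with cauchy x γ 0<γ
    ... | N , close-x with seq x N ℚₚ.≤? γ Rat.+ γ
    ... | yes x≤δ = N , λ n N≤n → begin
      seq x n
        ≤⟨ p≤q+∣p-q∣ (seq x n) (seq x N) ⟩
      seq x N Rat.+ Rat.∣ seq x n Rat.- seq x N ∣
        ≤⟨ Rat.+-mono-≤ x≤δ (close-x n N N≤n ℕₚ.≤-refl) ⟩
      δ Rat.+ γ
        ≤⟨ Rat.+-mono-≤ (ℚₚ.≤-refl {δ}) (Rat.p≤p+ε (ℚₚ.<⇒≤ 0<γ)) ⟩
      δ Rat.+ (γ Rat.+ γ)
        ≡⟨ Rat.+-identityˡ _ ⟨
      0ℚ Rat.+ (δ Rat.+ (γ Rat.+ γ)) ∎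
      where open ℚₚ.≤-Reasoning
    ... | no x≰δ = ⊥-elim (¬0<x (γ , 0<γ , N , λ n N≤n → p+r≤q+r⇒p≤q γ (seq x n) γ
      (ℚₚ.≤-trans (ℚₚ.<⇒≤ (ℚₚ.≰⇒> x≰δ)) (ℚₚ.≤-trans (p≤q+∣p-q∣ (seq x N) (seq x n))
        (Rat.+-mono-≤ (ℚₚ.≤-refl {seq x n}) (close-x N n ℕₚ.≤-refl N≤n))))))

  ≤fromℚ⇒≤0 : ∀ {x} → (∀ ε → 0ℚ ℚ.< ε → x ≤ᴿ fromℚ ε) → x ≤ᴿ 0ᴿ
  ≤fromℚ⇒≤0 {x} x≤ = mk≤ go
    where
    go : ∀ ε → 0ℚ ℚ.< ε → Eventually (λ n → seq x n ℚ.≤ 0ℚ Rat.+ ε)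
    go ε 0<ε with Rat.halve ε 0<ε
    ... | δ , 0<δ , ≡.refl = ev-map
      (λ n le → ℚₚ.≤-trans le (ℚₚ.≤-reflexive (≡.sym (Rat.+-identityˡ _)))) (below (x≤ δ 0<δ) δ 0<δ)

  -- The factor is a squared modulus because its approximating sequence is then nonnegative term by
  -- term, and monotonicity of rational multiplication applies at each index. The slack ε is divided
  -- by a bound K of the factor.
  ∣∣²*-mono-≤ : ∀ c {s t} → s ≤ᴿ t → ∣ c ∣² *ᴿ s ≤ᴿ ∣ c ∣² *ᴿ t
  ∣∣²*-mono-≤ c {s} {t} s≤t = mk≤ go
    where
    go : ∀ ε → 0ℚ ℚ.< ε →
         Eventually (λ n → seq ∣ c ∣² n Rat.* seq s n ℚ.≤ seq ∣ c ∣² n Rat.* seq t n Rat.+ ε)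
    go ε 0<ε with bounded ∣ c ∣²
    ... | K , 0<K , c≤K with Rat.divide K ε 0<K 0<ε
    ... | δ , 0<δ , ≡.refl = ev-zip
      (λ n ∣c∣≤K s≤t+δ → ℚₚ.≤-trans (Rat.*-monoˡ-≤ (0≤∣ c ∣² n) s≤t+δ)
        (ℚₚ.≤-trans (ℚₚ.≤-reflexive (Rat.distribˡ (seq ∣ c ∣² n) (seq t n) δ))
          (Rat.+-mono-≤ (ℚₚ.≤-refl {seq ∣ c ∣² n Rat.* seq t n})
            (Rat.*-mono (0≤∣ c ∣² n) (ℚₚ.≤-trans (Rat.p≤∣p∣ (seq ∣ c ∣² n)) ∣c∣≤K)
              (ℚₚ.<⇒≤ 0<δ) (ℚₚ.≤-refl {δ})))))
      c≤K (below s≤t δ 0<δ)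

  p²≤p²+q² : ∀ p q {r} → p Rat.* p Rat.+ q Rat.* q ℚ.≤ r → p Rat.* p ℚ.≤ r
  p²≤p²+q² p q = ℚₚ.≤-trans (Rat.p≤p+ε (Rat.0≤p² q))

  -- Asking for the tolerance ε² in the squared modulus puts both coordinates within ε, without a
  -- square root.
  ∣z∣²≤0⇒z≈0 : ∀ {z} → ∣ z ∣² ≤ᴿ 0ᴿ → z ≈ᶜ 0ᶜ
  ∣z∣²≤0⇒z≈0 {a +i b} le =
      mk≈ (λ ε 0<ε → ev-map (λ n small → coordinate (seq a n) 0<ε (p²≤p²+q² (seq a n) (seq b n) small))
        (square ε 0<ε))
    , mk≈ (λ ε 0<ε → ev-map (λ n small → coordinate (seq b n) 0<ε
          (p²≤p²+q² (seq b n) (seq a n) (≡.subst (ℚ._≤ ε Rat.* ε) (Rat.+-comm _ _) small)))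
        (square ε 0<ε))
    where
    square : ∀ ε → 0ℚ ℚ.< ε → Eventually (λ n → seq a n Rat.* seq a n Rat.+ seq b n Rat.* seq b n ℚ.≤ ε Rat.* ε)
    square ε 0<ε = ev-map (λ n small → ℚₚ.≤-trans small (ℚₚ.≤-reflexive (Rat.+-identityˡ _)))
      (below le (ε Rat.* ε) (*-pos 0<ε 0<ε))
    coordinate : ∀ p {ε} → 0ℚ ℚ.< ε → p Rat.* p ℚ.≤ ε Rat.* ε → Rat.∣ p Rat.- 0ℚ ∣ ℚ.≤ ε
    coordinate p {ε} 0<ε p²≤ε² =
      ≡.subst (λ q → Rat.∣ q ∣ ℚ.≤ ε) (≡.sym (p-0≡p p)) (p²≤ε²⇒∣p∣≤ε p 0<ε p²≤ε²)

  ∣0∣²≤0 : ∀ {z} → z ≈ᶜ 0ᶜ → ∣ z ∣² ≤ᴿ 0ᴿ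
  ∣0∣²≤0 z≈0 = ≤ᴿ-reflexive (R.trans (∣∣²-cong z≈0)
    (R.trans (+ᴿ-cong (R.zeroˡ 0ᴿ) (R.zeroˡ 0ᴿ)) (R.+-identityˡ 0ᴿ)))

  1≉0 : ¬ (1ᶜ ≈ᶜ 0ᶜ)
  1≉0 (re≈ , _) with Rat.halve 1ℚ Rat.0<1
  ... | δ , 0<δ , eq with close re≈ δ 0<δ
  ... | N , le = ℚₚ.<-irrefl ≡.refl (ℚₚ.<-≤-trans δ<1 1≤δ)
    where
    1≤δ : 1ℚ ℚ.≤ δ
    1≤δ = ≡.subst (ℚ._≤ δ) (≡.trans (≡.cong Rat.∣_∣ (p-0≡p 1ℚ)) (Rat.0≤p⇒∣p∣≡p (ℚₚ.<⇒≤ Rat.0<1)))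
            (le N ℕₚ.≤-refl)
    δ<1 : δ ℚ.< 1ℚ
    δ<1 = ≡.subst₂ ℚ._<_ (Rat.+-identityˡ δ) eq (Rat.+-mono-<-≤ 0<δ (ℚₚ.≤-refl {δ}))

  *ᶜ-conj : ∀ z → z *ᶜ (re z +i -ᴿ im z) ≈ᶜ (∣ z ∣² +i 0ᴿ)
  *ᶜ-conj (a +i b) =
      R.+-congˡ {a *ᴿ a} (R.trans (-ᴿ-cong (R.sym (-‿distribʳ-* b b))) (⁻¹-involutive (b *ᴿ b)))
    , R.trans (R.+-cong (R.sym (-‿distribʳ-* a b)) (R.*-comm b a)) (R.-‿inverseˡ (a *ᴿ b))
    where
    open RingProperties R.ring using (-‿distribʳ-*)
    open AbelianGroupProperties R.+-abelianGroup using (⁻¹-involutive)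

  invertible : ∀ z {δ} → δ << ∣ z ∣² → ∃[ w ] z *ᶜ w ≈ᶜ 1ᶜ
  invertible z 0<∣z∣ with reciprocal ∣ z ∣² 0<∣z∣
  ... | y , eq = (re z +i -ᴿ im z) *ᶜ (y +i 0ᴿ) ,
    C.trans (C.sym (*ᶜ-assoc z (re z +i -ᴿ im z) (y +i 0ᴿ)))
      (C.trans (C.*-congʳ {y +i 0ᴿ} (*ᶜ-conj z))
        ( R.trans (R.+-cong eq (R.trans (-ᴿ-cong (R.zeroˡ 0ᴿ)) ε⁻¹≈ε)) (R.+-identityʳ 1ᴿ)
        , R.trans (R.+-cong (R.zeroʳ ∣ z ∣²) (R.zeroˡ y)) (R.+-identityʳ 0ᴿ)))
    where open AbelianGroupProperties R.+-abelianGroup using (ε⁻¹≈ε)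

  -- The shape of the conclusion is that of `∣z+w∣²≤`, the estimate |z + w|² ≤ 2 (|z|² + |w|²),
  -- which replaces the triangle inequality wherever only squares are at hand. Hence η = ε/4.
  quarter : ∀ ε → 0ℚ ℚ.< ε → ∃[ η ] 0ℚ ℚ.< η ×
            (∀ {x y} → x ≤ᴿ fromℚ η → y ≤ᴿ fromℚ η → (x +ᴿ y) +ᴿ (x +ᴿ y) ≤ᴿ fromℚ ε)
  quarter ε 0<ε with Rat.halve ε 0<ε
  ... | δ , 0<δ , ≡.refl with Rat.halve δ 0<δ
  ... | η , 0<η , ≡.refl = η , 0<η , λ x≤η y≤η →
    let x+y≤ = +ᴿ-mono-≤ x≤η y≤η
    in ≤ᴿ-trans (+ᴿ-mono-≤ x+y≤ x+y≤) (≤ᴿ-pointwise λ _ → ℚₚ.≤-refl)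

-- Convergence of complex sequences

infix 4 _⟶ᶜ_
_⟶ᶜ_ : (ℕ → ℂ) → ℂ → Set
s ⟶ᶜ a = ∀ ε → 0ℚ ℚ.< ε → Eventually (λ n → ∣ s n C.- a ∣² ≤ᴿ fromℚ ε)

module C-ring = RingProperties C.ring
module C-group = AbelianGroupProperties C.+-abelianGroup
open NaturalSolver C.commutativeSemiring public using ()
  renaming (solve to solveᶜ; _:=_ to _:=ᶜ_; _:+_ to _:+ᶜ_; _:*_ to _:*ᶜ_; con to conᶜ)

opaque
  -‿interchange : ∀ a b c d → (a +ᶜ b) C.- (c +ᶜ d) ≈ᶜ (a C.- c) +ᶜ (b C.- d)
  -‿interchange a b c d = C.trans (C.+-congˡ {a +ᶜ b} (C.sym (C-group.⁻¹-∙-comm c d)))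
    (solveᶜ 4 (λ a b c d → (a :+ᶜ b) :+ᶜ (c :+ᶜ d) :=ᶜ (a :+ᶜ c) :+ᶜ (b :+ᶜ d)) C.refl a b (-ᶜ c) (-ᶜ d))

  ⟶ᶜ-cong : ∀ {s t a b} → (∀ n → s n ≈ᶜ t n) → a ≈ᶜ b → s ⟶ᶜ a → t ⟶ᶜ b
  ⟶ᶜ-cong s≈t a≈b s⟶a ε 0<ε = ev-map
    (λ n → ≤ᴿ-trans (≤ᴿ-reflexive (∣∣²-cong (C.sym (C.+-cong (s≈t n) (C.-‿cong a≈b)))))) (s⟶a ε 0<ε)

  ⟶ᶜ-const : ∀ a → (λ _ → a) ⟶ᶜ a
  ⟶ᶜ-const a ε 0<ε = ev-all λ n → ≤ᴿ-trans (∣0∣²≤0 (C.-‿inverseʳ a)) (0≤fromℚ 0<ε)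

  ⟶ᶜ-+ : ∀ {s t a b} → s ⟶ᶜ a → t ⟶ᶜ b → (λ n → s n +ᶜ t n) ⟶ᶜ a +ᶜ b
  ⟶ᶜ-+ {s} {t} {a} {b} s⟶a t⟶b ε 0<ε with quarter ε 0<ε
  ... | η , 0<η , small = ev-zip
    (λ n p q → ≤ᴿ-trans (≤ᴿ-reflexive (∣∣²-cong (-‿interchange (s n) (t n) a b)))
      (≤ᴿ-trans (∣z+w∣²≤ (s n C.- a) (t n C.- b)) (small p q)))
    (s⟶a η 0<η) (t⟶b η 0<η)

  ⟶ᶜ-unique : ∀ {s a b} → s ⟶ᶜ a → s ⟶ᶜ b → a ≈ᶜ b
  ⟶ᶜ-unique {s} {a} {b} s⟶a s⟶b = C-group.x∙y⁻¹≈ε⇒x≈y a b (∣z∣²≤0⇒z≈0 (≤fromℚ⇒≤0 near))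
    where
    via : ∀ x → a C.- b ≈ᶜ -ᶜ (x C.- a) +ᶜ (x C.- b)
    via x = C.sym (C.trans (C.+-congʳ {x C.- b} (C-group.⁻¹-anti-homo‿- x a))
      (C.trans (C.+-assoc a (-ᶜ x) (x C.- b)) (C.+-congˡ {a}
        (C.trans (C.sym (C.+-assoc (-ᶜ x) x (-ᶜ b)))
          (C.trans (C.+-congʳ { -ᶜ b} (C.-‿inverseˡ x)) (C.+-identityˡ (-ᶜ b)))))))
    near : ∀ ε → 0ℚ ℚ.< ε → ∣ a C.- b ∣² ≤ᴿ fromℚ ε
    near ε 0<ε with quarter ε 0<ε
    ... | η , 0<η , small with s⟶a η 0<η | s⟶b η 0<η
    ... | M , p | N , q = ≤ᴿ-trans (≤ᴿ-reflexive (∣∣²-cong (via (s n))))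
      (≤ᴿ-trans (∣z+w∣²≤ (-ᶜ (s n C.- a)) (s n C.- b))
        (small (≤ᴿ-trans (≤ᴿ-reflexive (∣-z∣² (s n C.- a))) (p n (ℕₚ.m≤m⊔n M N))) (q n (ℕₚ.m≤n⊔m M N))))
      where
      n : ℕ
      n = M ℕ.⊔ N

-- Square-summable functions

module _ {A B : Set} where

  lefts : List (A ⊎ B) → List A
  lefts = mapMaybe isInj₁

  rights : List (A ⊎ B) → List B
  rights = mapMaybe isInj₂

  ∈-lefts⁻ : ∀ {u} F → u ∈ lefts F → inj₁ u ∈ F
  ∈-lefts⁻ (inj₁ x ∷ F) (here ≡.refl) = here ≡.refl
  ∈-lefts⁻ (inj₁ x ∷ F) (there u∈F)   = there (∈-lefts⁻ F u∈F)
  ∈-lefts⁻ (inj₂ y ∷ F) u∈F           = there (∈-lefts⁻ F u∈F)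

  ∈-lefts⁺ : ∀ {u} F → inj₁ u ∈ F → u ∈ lefts F
  ∈-lefts⁺ (inj₁ x ∷ F) (here ≡.refl) = here ≡.refl
  ∈-lefts⁺ (inj₁ x ∷ F) (there u∈F)   = there (∈-lefts⁺ F u∈F)
  ∈-lefts⁺ (inj₂ y ∷ F) (there u∈F)   = ∈-lefts⁺ F u∈F

  ∈-rights⁻ : ∀ {u} F → u ∈ rights F → inj₂ u ∈ F
  ∈-rights⁻ (inj₂ x ∷ F) (here ≡.refl) = here ≡.refl
  ∈-rights⁻ (inj₂ x ∷ F) (there u∈F)   = there (∈-rights⁻ F u∈F)
  ∈-rights⁻ (inj₁ y ∷ F) u∈F           = there (∈-rights⁻ F u∈F)

  ∈-rights⁺ : ∀ {u} F → inj₂ u ∈ F → u ∈ rights F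
  ∈-rights⁺ (inj₂ x ∷ F) (here ≡.refl) = here ≡.refl
  ∈-rights⁺ (inj₂ x ∷ F) (there u∈F)   = there (∈-rights⁺ F u∈F)
  ∈-rights⁺ (inj₁ y ∷ F) (there u∈F)   = ∈-rights⁺ F u∈F

  lefts-unique : ∀ F → Unique F → Unique (lefts F)
  lefts-unique []           []         = []
  lefts-unique (inj₁ x ∷ F) (x∉F ∷ uniq) =
    All.tabulate (λ u∈F x≡u → All.lookup x∉F (∈-lefts⁻ F u∈F) (≡.cong inj₁ x≡u)) ∷ lefts-unique F uniq
  lefts-unique (inj₂ y ∷ F) (_   ∷ uniq) = lefts-unique F uniq

  rights-unique : ∀ F → Unique F → Unique (rights F)
  rights-unique []           []         = []
  rights-unique (inj₂ x ∷ F) (x∉F ∷ uniq) =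
    All.tabulate (λ u∈F x≡u → All.lookup x∉F (∈-rights⁻ F u∈F) (≡.cong inj₂ x≡u)) ∷ rights-unique F uniq
  rights-unique (inj₁ y ∷ F) (_   ∷ uniq) = rights-unique F uniq

  opaque
    ∑-split : ∀ (a : A ⊎ B → ℝ) F →
              ∑ F a ≈ᴿ ∑ (lefts F) (λ u → a (inj₁ u)) +ᴿ ∑ (rights F) (λ u → a (inj₂ u))
    ∑-split a [] = R.sym (R.+-identityˡ 0ᴿ)
    ∑-split a (inj₁ x ∷ F) = R.trans (R.+-congˡ {a (inj₁ x)} (∑-split a F)) (R.sym (R.+-assoc _ _ _))
    ∑-split a (inj₂ y ∷ F) = R.trans (R.+-congˡ {a (inj₂ y)} (∑-split a F))
      (R.trans (R.sym (R.+-assoc _ _ _)) (R.trans (R.+-congʳ (R.+-comm _ _)) (R.+-assoc _ _ _)))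

∑-map : ∀ {V W : Set} (ι : V → W) (a : W → ℝ) F → ∑ (map ι F) a ≡ ∑ F (λ v → a (ι v))
∑-map ι a []      = ≡.refl
∑-map ι a (v ∷ F) = ≡.cong (a (ι v) +ᴿ_) (∑-map ι a F)

opaque
  ∑-cong : ∀ {V : Set} {a b : V → ℝ} F → (∀ v → a v ≈ᴿ b v) → ∑ F a ≈ᴿ ∑ F b
  ∑-cong []      a≈b = R.refl
  ∑-cong (v ∷ F) a≈b = +ᴿ-cong (a≈b v) (∑-cong F a≈b)

module _ {V : Set} where

  ≈²-refl : {f : ℓ² V} → f ≈² f
  ≈²-refl = mk≈² λ _ → C.refl

  ≈²-sym : {f g : ℓ² V} → f ≈² g → g ≈² f
  ≈²-sym eq = mk≈² λ v → C.sym (coords-≈ eq v)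

  ≈²-trans : {f g h : ℓ² V} → f ≈² g → g ≈² h → f ≈² h
  ≈²-trans eq eq′ = mk≈² λ v → C.trans (coords-≈ eq v) (coords-≈ eq′ v)

  opaque
    ‖‖-cong : ∀ (f g : ℓ² V) → (∀ v → f at v ≈ᶜ g at v) → ∀ {M} → ‖ f ‖²≤ M → ‖ g ‖²≤ M
    ‖‖-cong f g f≈g f≤ F u =
      ≤ᴿ-trans (≤ᴿ-reflexive (∑-cong F (λ v → ∣∣²-cong (C.sym (f≈g v))))) (f≤ F u)

    ‖‖-mono : ∀ (f : ℓ² V) {M N} → M ≤ᴿ N → ‖ f ‖²≤ M → ‖ f ‖²≤ N
    ‖‖-mono f M≤N f≤ F u = ≤ᴿ-trans (f≤ F u) M≤N

    ‖‖-+ : ∀ (f g : ℓ² V) {M N} → ‖ f ‖²≤ M → ‖ g ‖²≤ N → ‖ f +ᴹ g ‖²≤ (M +ᴿ N) +ᴿ (M +ᴿ N)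
    ‖‖-+ f g {M} {N} f≤ g≤ F u = ≤ᴿ-trans (∑-mono F (λ v → ∣z+w∣²≤ (f at v) (g at v)))
      (≤ᴿ-trans (≤ᴿ-reflexive (∑-+ a+b a+b F)) (+ᴿ-mono-≤ half half))
      where
      a+b : V → ℝ
      a+b v = ∣ f at v ∣² +ᴿ ∣ g at v ∣²
      half : ∑ F a+b ≤ᴿ M +ᴿ N
      half = ≤ᴿ-trans (≤ᴿ-reflexive (∑-+ (λ v → ∣ f at v ∣²) (λ v → ∣ g at v ∣²) F)) (+ᴿ-mono-≤ (f≤ F u) (g≤ F u))

    ‖‖-* : ∀ c (f : ℓ² V) {M} → ‖ f ‖²≤ M → ‖ c *ₗ f ‖²≤ ∣ c ∣² *ᴿ M
    ‖‖-* c f f≤ F u = ≤ᴿ-trans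
      (≤ᴿ-reflexive (R.trans (∑-cong F (λ v → ∣zw∣² c (f at v))) (∑-*ˡ ∣ c ∣² (λ v → ∣ f at v ∣²) F)))
      (∣∣²*-mono-≤ c (f≤ F u))

    ‖‖-zero : ∀ (f : ℓ² V) → (∀ v → f at v ≈ᶜ 0ᶜ) → ‖ f ‖²≤ 0ᴿ
    ‖‖-zero f f≈0 F u = ≤ᴿ-trans (∑-mono F (λ v → ∣0∣²≤0 (f≈0 v))) (≤ᴿ-reflexive (∑-zero F (λ _ → R.refl)))

    coordinate-≤ : ∀ (f : ℓ² V) {M} → ‖ f ‖²≤ M → ∀ v → ∣ f at v ∣² ≤ᴿ M
    coordinate-≤ f f≤ v = ≤ᴿ-trans (≤ᴿ-reflexive (R.sym (R.+-identityʳ ∣ f at v ∣²))) (f≤ (v ∷ []) ([] ∷ []))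

    ⟶-at : ∀ (s : ℕ → ℓ² V) f → s ⟶ f → ∀ v → (λ n → s n at v) ⟶ᶜ f at v
    ⟶-at s f s⟶f v ε 0<ε = ev-map (λ n le → coordinate-≤ (s n -ᴹ f) le v) (s⟶f ε 0<ε)

    ⟶-cong : ∀ (s t : ℕ → ℓ² V) f → (∀ n v → s n at v ≈ᶜ t n at v) → s ⟶ f → t ⟶ f
    ⟶-cong s t f s≈t s⟶f ε 0<ε = ev-map
      (λ n → ‖‖-cong (s n -ᴹ f) (t n -ᴹ f) (λ v → C.+-congʳ { -ᶜ f at v} (s≈t n v)))
      (s⟶f ε 0<ε)

    ⟶-+ : ∀ (s t : ℕ → ℓ² V) f g → s ⟶ f → t ⟶ g → (λ n → s n +ᴹ t n) ⟶ f +ᴹ g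
    ⟶-+ s t f g s⟶f t⟶g ε 0<ε with quarter ε 0<ε
    ... | η , 0<η , small = ev-zip
      (λ n p q → ‖‖-cong ((s n -ᴹ f) +ᴹ (t n -ᴹ g)) ((s n +ᴹ t n) -ᴹ (f +ᴹ g))
          (λ v → C.sym (-‿interchange (s n at v) (t n at v) (f at v) (g at v)))
        (‖‖-mono ((s n -ᴹ f) +ᴹ (t n -ᴹ g)) (small ≤ᴿ-refl ≤ᴿ-refl) (‖‖-+ (s n -ᴹ f) (t n -ᴹ g) p q)))
      (s⟶f η 0<η) (t⟶g η 0<η)

module _ {V : Set} (_≟_ : DecidableEquality V) where

  opaque
    kronecker-diag : ∀ v → kronecker _≟_ v v ≈ᶜ 1ᶜ
    kronecker-diag v with v ≟ v
    ... | yes _  = C.refl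
    ... | no v≢v = ⊥-elim (v≢v ≡.refl)

    kronecker-off : ∀ {v u} → v ≢ u → kronecker _≟_ v u ≈ᶜ 0ᶜ
    kronecker-off {v} {u} v≢u with v ≟ u
    ... | yes v≡u = ⊥-elim (v≢u v≡u)
    ... | no _    = C.refl

    kronecker-sym : ∀ v u → kronecker _≟_ v u ≈ᶜ kronecker _≟_ u v
    kronecker-sym v u with v ≟ u
    ... | yes ≡.refl = C.sym (kronecker-diag v)
    ... | no v≢u     = C.sym (kronecker-off (λ u≡v → v≢u (≡.sym u≡v)))

    ∣1∣²≈1 : ∣ 1ᶜ ∣² ≈ᴿ 1ᴿ
    ∣1∣²≈1 = R.trans (R.+-cong (R.*-identityˡ 1ᴿ) (R.zeroˡ 0ᴿ)) (R.+-identityʳ 1ᴿ)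

    0≤1 : 0ᴿ ≤ᴿ 1ᴿ
    0≤1 = 0≤fromℚ Rat.0<1

    -- A duplicate-free list meets v at most once: after v all further terms vanish, and before it
    -- each term is zero.
    ‖basis‖≤1 : ∀ v → ‖ basis _≟_ v ‖²≤ 1ᴿ
    ‖basis‖≤1 v []      []           = 0≤1
    ‖basis‖≤1 v (u ∷ F) (u∉F ∷ uniq) with v ≟ u
    ... | yes ≡.refl = ≤ᴿ-trans
      (+ᴿ-mono-≤ (≤ᴿ-reflexive ∣1∣²≈1) (≤ᴿ-reflexive (∑-zero F zero-off)))
      (≤ᴿ-reflexive (R.+-identityʳ 1ᴿ))
      where
      zero-off : ∀ {w} → w ∈ F → ∣ kronecker _≟_ v w ∣² ≈ᴿ 0ᴿ
      zero-off w∈F = R.trans (∣∣²-cong (kronecker-off (All.lookup u∉F w∈F)))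
        (R.trans (+ᴿ-cong (R.zeroˡ 0ᴿ) (R.zeroˡ 0ᴿ)) (R.+-identityˡ 0ᴿ))
    ... | no _ = ≤ᴿ-trans (+ᴿ-mono-≤ (∣0∣²≤0 C.refl) (‖basis‖≤1 v F uniq)) (≤ᴿ-reflexive (R.+-identityˡ 1ᴿ))

opaque
  -- `back` carries the exceptional finite set of f to one for its pullback. It is an argument
  -- because no decision procedure for the image of `ι` is given.
  summable-along : ∀ {V W : Set} {f : W → ℂ} (ι : V → W) → (∀ {u v} → ι u ≡ ι v → u ≡ v) →
                   (back : List W → List V) → (∀ {v} F → ι v ∈ F → v ∈ back F) →
                   SquareSummable f → SquareSummable (λ v → f (ι v))
  summable-along {f = f} ι injective back ∈-back s ε 0<ε with s ε 0<ε
  ... | F₀ , p = back F₀ , λ F u d → ≡.subst (_≤ᴿ fromℚ ε) (∑-map ι (λ w → ∣ f w ∣²) F)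
    (p (map ι F) (Uniqueₚ.map⁺ injective u) (disjoint F d))
    where
    disjoint : ∀ F → Disjoint F (back F₀) → Disjoint (map ι F) F₀
    disjoint F d (w∈ιF , w∈F₀) with ∈-map⁻ ι w∈ιF
    ... | _ , v∈F , ≡.refl = d (v∈F , ∈-back F₀ w∈F₀)

module _ {V W : Set} where

  restrict₁ : ℓ² (V ⊎ W) → ℓ² V
  restrict₁ f = mkℓ² (λ v → f at inj₁ v)
    (summable-along inj₁ Sumₚ.inj₁-injective lefts ∈-lefts⁺ (summable f))

  restrict₂ : ℓ² (V ⊎ W) → ℓ² W
  restrict₂ f = mkℓ² (λ w → f at inj₂ w)
    (summable-along inj₂ Sumₚ.inj₂-injective rights ∈-rights⁺ (summable f))

  glue : (V → ℂ) → (W → ℂ) → V ⊎ W → ℂ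
  glue f g (inj₁ v) = f v
  glue f g (inj₂ w) = g w

  opaque
    summable-glue : ∀ {f g} → SquareSummable f → SquareSummable g → SquareSummable (glue f g)
    summable-glue {f} {g} s t ε 0<ε with Rat.halve ε 0<ε
    ... | δ , 0<δ , ≡.refl with s δ 0<δ | t δ 0<δ
    ... | F₀ , p | G₀ , q = map inj₁ F₀ ++ map inj₂ G₀ , λ F u d →
      ≤ᴿ-trans (≤ᴿ-reflexive (∑-split (λ x → ∣ glue f g x ∣²) F))
        (≤ᴿ-trans
          (+ᴿ-mono-≤
            (p (lefts F) (lefts-unique F u)
              (λ (x , y) → d (∈-lefts⁻ F x , ∈-++⁺ˡ (∈-map⁺ inj₁ y))))
            (q (rights F) (rights-unique F u)
              (λ (x , y) → d (∈-rights⁻ F x , ∈-++⁺ʳ (map inj₁ F₀) (∈-map⁺ inj₂ y)))))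
          (≤ᴿ-pointwise λ _ → ℚₚ.≤-refl))

  infixr 5 _⊕_
  _⊕_ : ℓ² V → ℓ² W → ℓ² (V ⊎ W)
  f ⊕ g = mkℓ² (glue (f at_) (g at_)) (summable-glue (summable f) (summable g))

  opaque
    ‖‖-⊕ : ∀ f g {M N} → ‖ f ‖²≤ M → ‖ g ‖²≤ N → ‖ f ⊕ g ‖²≤ M +ᴿ N
    ‖‖-⊕ f g f≤ g≤ F u = ≤ᴿ-trans (≤ᴿ-reflexive (∑-split (λ x → ∣ (f ⊕ g) at x ∣²) F))
      (+ᴿ-mono-≤ (f≤ (lefts F) (lefts-unique F u)) (g≤ (rights F) (rights-unique F u)))

    ‖‖-restrict₁ : ∀ f {M} → ‖ f ‖²≤ M → ‖ restrict₁ f ‖²≤ M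
    ‖‖-restrict₁ f {M} f≤ F u = ≡.subst (_≤ᴿ M) (∑-map inj₁ (λ x → ∣ f at x ∣²) F)
      (f≤ (map inj₁ F) (Uniqueₚ.map⁺ Sumₚ.inj₁-injective u))

    ‖‖-restrict₂ : ∀ f {M} → ‖ f ‖²≤ M → ‖ restrict₂ f ‖²≤ M
    ‖‖-restrict₂ f {M} f≤ F u = ≡.subst (_≤ᴿ M) (∑-map inj₂ (λ x → ∣ f at x ∣²) F)
      (f≤ (map inj₂ F) (Uniqueₚ.map⁺ Sumₚ.inj₂-injective u))

    ⟶-⊕ : ∀ s t f g → s ⟶ f → t ⟶ g → (λ n → s n ⊕ t n) ⟶ f ⊕ g
    ⟶-⊕ s t f g s⟶f t⟶g ε 0<ε with Rat.halve ε 0<ε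
    ... | δ , 0<δ , ≡.refl = ev-zip
      (λ n p q → ‖‖-cong ((s n -ᴹ f) ⊕ (t n -ᴹ g)) ((s n ⊕ t n) -ᴹ (f ⊕ g))
        (λ { (inj₁ _) → C.refl ; (inj₂ _) → C.refl })
        (‖‖-mono ((s n -ᴹ f) ⊕ (t n -ᴹ g)) (≤ᴿ-pointwise λ _ → ℚₚ.≤-refl)
          (‖‖-⊕ (s n -ᴹ f) (t n -ᴹ g) p q)))
      (s⟶f δ 0<δ) (t⟶g δ 0<δ)

    ⟶-restrict₂ : ∀ s f → s ⟶ f → (λ n → restrict₂ (s n)) ⟶ restrict₂ f
    ⟶-restrict₂ s f s⟶f ε 0<ε = ev-map
      (λ n p → ‖‖-cong (restrict₂ (s n -ᴹ f)) (restrict₂ (s n) -ᴹ restrict₂ f) (λ _ → C.refl)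
        (‖‖-restrict₂ (s n -ᴹ f) p))
      (s⟶f ε 0<ε)

opaque
  ⟶-const : ∀ {V : Set} (f : ℓ² V) → (λ _ → f) ⟶ f
  ⟶-const f ε 0<ε = ev-all λ _ → ‖‖-mono (f -ᴹ f) (0≤fromℚ 0<ε)
    (‖‖-zero (f -ᴹ f) (λ v → C.-‿inverseʳ (f at v)))

  ⟶-scale : ∀ {V : Set} (c : ℕ → ℂ) a (f : ℓ² V) → ‖ f ‖²≤ 1ᴿ → c ⟶ᶜ a → (λ n → c n *ₗ f) ⟶ a *ₗ f
  ⟶-scale c a f f≤1 c⟶a ε 0<ε = ev-map
    (λ n p → ‖‖-cong ((c n C.- a) *ₗ f) (c n *ₗ f -ᴹ a *ₗ f) (λ v → C.trans (C.distribʳ (f at v) (c n) (-ᶜ a))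
        (C.+-congˡ {c n *ᶜ f at v} (C.sym (C-ring.-‿distribˡ-* a (f at v)))))
      (‖‖-mono ((c n C.- a) *ₗ f) (≤ᴿ-trans (≤ᴿ-reflexive (R.*-identityʳ _)) p)
        (‖‖-* (c n C.- a) f f≤1)))
    (c⟶a ε 0<ε)

-- Bounded linear maps, with bounds on squared norms

record BoundedLinear {V W : Set} (T : ℓ² V → ℓ² W) : Set where
  field
    cong   : ∀ {f g} → f ≈² g → T f ≈² T g
    linear : ∀ c f g → T (c *ₗ f +ᴹ g) ≈² c *ₗ T f +ᴹ T g
    bound  : ∃[ C ] ∀ f M → ‖ f ‖²≤ M → ‖ T f ‖²≤ C *ᴿ M

module _ {U V W : Set} {T : ℓ² U → ℓ² V} {S : ℓ² V → ℓ² W}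
         (T-bl : BoundedLinear T) (S-bl : BoundedLinear S) where

  private
    module T = BoundedLinear T-bl
    module S = BoundedLinear S-bl

  compose : BoundedLinear (λ f → S (T f))
  compose = record
    { cong   = λ f≈g → S.cong (T.cong f≈g)
    ; linear = λ c f g → ≈²-trans (S.cong (T.linear c f g)) (S.linear c (T f) (T g))
    ; bound  = proj₁ S.bound *ᴿ proj₁ T.bound , λ f M f≤ →
        ‖‖-mono (S (T f)) (≤ᴿ-reflexive (R.sym (R.*-assoc (proj₁ S.bound) (proj₁ T.bound) M)))
          (proj₂ S.bound (T f) (proj₁ T.bound *ᴿ M) (proj₂ T.bound f M f≤))
    }

module _ {V W : Set} {T S : ℓ² V → ℓ² W} (T-bl : BoundedLinear T) (S-bl : BoundedLinear S) where

  private
    module T = BoundedLinear T-bl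
    module S = BoundedLinear S-bl

  add : BoundedLinear (λ f → T f +ᴹ S f)
  add = record
    { cong   = λ f≈g → mk≈² λ v → C.+-cong (coords-≈ (T.cong f≈g) v) (coords-≈ (S.cong f≈g) v)
    ; linear = λ c f g → mk≈² λ v → C.trans
        (C.+-cong (coords-≈ (T.linear c f g) v) (coords-≈ (S.linear c f g) v))
        (solveᶜ 5 (λ c a b x y → (c :*ᶜ a :+ᶜ b) :+ᶜ (c :*ᶜ x :+ᶜ y) :=ᶜ c :*ᶜ (a :+ᶜ x) :+ᶜ (b :+ᶜ y)) C.refl
          c (T f at v) (T g at v) (S f at v) (S g at v))
    ; bound  = (B +ᴿ D) +ᴿ (B +ᴿ D) , λ f M f≤ → ‖‖-mono (T f +ᴹ S f) (≤ᴿ-reflexive (expand M))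
        (‖‖-+ (T f) (S f) (proj₂ T.bound f M f≤) (proj₂ S.bound f M f≤))
    }
    where
    B = proj₁ T.bound
    D = proj₁ S.bound
    expand : ∀ M → (B *ᴿ M +ᴿ D *ᴿ M) +ᴿ (B *ᴿ M +ᴿ D *ᴿ M) ≈ᴿ ((B +ᴿ D) +ᴿ (B +ᴿ D)) *ᴿ M
    expand M = R.sym (R.trans (R.distribʳ M (B +ᴿ D) (B +ᴿ D))
      (R.+-cong (R.distribʳ M B D) (R.distribʳ M B D)))

module _ {V W : Set} where

  scale : ∀ c {T : ℓ² V → ℓ² W} → BoundedLinear T → BoundedLinear (λ f → c *ₗ T f)
  scale c {T} T-bl = record
    { cong   = λ f≈g → mk≈² λ v → C.*-congˡ {c} (coords-≈ (cong f≈g) v)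
    ; linear = λ d f g → mk≈² λ v → C.trans (C.*-congˡ {c} (coords-≈ (linear d f g) v))
        (solveᶜ 4 (λ c d a b → c :*ᶜ (d :*ᶜ a :+ᶜ b) :=ᶜ d :*ᶜ (c :*ᶜ a) :+ᶜ c :*ᶜ b) C.refl
          c d (T f at v) (T g at v))
    ; bound  = ∣ c ∣² *ᴿ proj₁ bound , λ f M f≤ →
        ‖‖-mono (c *ₗ T f) (≤ᴿ-reflexive (R.sym (R.*-assoc ∣ c ∣² (proj₁ bound) M)))
          (‖‖-* c (T f) (proj₂ bound f M f≤))
    }
    where open BoundedLinear T-bl

  zero-map : BoundedLinear (λ (_ : ℓ² V) → 0ᴹ {W})
  zero-map = record
    { cong   = λ _ → ≈²-refl
    ; linear = λ c _ _ → mk≈² λ _ → C.sym (C.trans (C.+-identityʳ (c *ᶜ 0ᶜ)) (C.zeroʳ c))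
    ; bound  = 0ᴿ , λ f M _ → ‖‖-mono 0ᴹ (≤ᴿ-reflexive (R.sym (R.zeroˡ M))) (‖‖-zero 0ᴹ (λ _ → C.refl))
    }

  restrict₁-bl : BoundedLinear (restrict₁ {V} {W})
  restrict₁-bl = record
    { cong   = λ f≈g → mk≈² λ v → coords-≈ f≈g (inj₁ v)
    ; linear = λ c f g → mk≈² λ v → C.refl
    ; bound  = 1ᴿ , λ f M f≤ → ‖‖-mono (restrict₁ f) (≤ᴿ-reflexive (R.sym (R.*-identityˡ M))) (‖‖-restrict₁ f f≤)
    }

  restrict₂-bl : BoundedLinear (restrict₂ {V} {W})
  restrict₂-bl = record
    { cong   = λ f≈g → mk≈² λ v → coords-≈ f≈g (inj₂ v)
    ; linear = λ c f g → mk≈² λ v → C.refl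
    ; bound  = 1ᴿ , λ f M f≤ → ‖‖-mono (restrict₂ f) (≤ᴿ-reflexive (R.sym (R.*-identityˡ M))) (‖‖-restrict₂ f f≤)
    }

  -- The constant is 1 since |f(v)|² is at most the squared norm of f. Matrices on the finite graph
  -- and the transfer across the bridge are built from these maps.
  rank-one : ∀ v (e : ℓ² W) → ‖ e ‖²≤ 1ᴿ → BoundedLinear (λ (f : ℓ² V) → (f at v) *ₗ e)
  rank-one v e e≤1 = record
    { cong   = λ f≈g → mk≈² λ w → C.*-congʳ {e at w} (coords-≈ f≈g v)
    ; linear = λ c f g → mk≈² λ w →
        solveᶜ 4 (λ c a b x → (c :*ᶜ a :+ᶜ b) :*ᶜ x :=ᶜ c :*ᶜ (a :*ᶜ x) :+ᶜ b :*ᶜ x) C.refl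
          c (f at v) (g at v) (e at w)
    ; bound  = 1ᴿ , λ f M f≤ → ‖‖-mono ((f at v) *ₗ e)
        (≤ᴿ-trans (≤ᴿ-reflexive (R.*-identityʳ ∣ f at v ∣²))
          (≤ᴿ-trans (coordinate-≤ f f≤ v) (≤ᴿ-reflexive (R.sym (R.*-identityˡ M)))))
        (‖‖-* (f at v) e e≤1)
    }

  ∑ᴹ : ∀ n → (Fin n → ℓ² W) → ℓ² W
  ∑ᴹ zero    t = 0ᴹ
  ∑ᴹ (suc n) t = t zero +ᴹ ∑ᴹ n (λ i → t (suc i))

  sum-map : ∀ n {T : Fin n → ℓ² V → ℓ² W} → (∀ i → BoundedLinear (T i)) →
            BoundedLinear (λ f → ∑ᴹ n (λ i → T i f))
  sum-map zero    T-bl = zero-map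
  sum-map (suc n) T-bl = add (T-bl zero) (sum-map n (λ i → T-bl (suc i)))

module _ {U V W : Set} {T : ℓ² U → ℓ² V} {S : ℓ² U → ℓ² W}
         (T-bl : BoundedLinear T) (S-bl : BoundedLinear S) where

  private
    module T = BoundedLinear T-bl
    module S = BoundedLinear S-bl

  pair-map : BoundedLinear (λ f → T f ⊕ S f)
  pair-map = record
    { cong   = λ f≈g → mk≈² λ { (inj₁ v) → coords-≈ (T.cong f≈g) v ; (inj₂ w) → coords-≈ (S.cong f≈g) w }
    ; linear = λ c f g → mk≈² λ { (inj₁ v) → coords-≈ (T.linear c f g) v ; (inj₂ w) → coords-≈ (S.linear c f g) w }
    ; bound  = proj₁ T.bound +ᴿ proj₁ S.bound , λ f M f≤ →
        ‖‖-mono (T f ⊕ S f) (≤ᴿ-reflexive (R.sym (R.distribʳ M (proj₁ T.bound) (proj₁ S.bound))))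
          (‖‖-⊕ (T f) (S f) (proj₂ T.bound f M f≤) (proj₂ S.bound f M f≤))
    }

module _ {V : Set} where

  private
    module M = LeftModule (ℓ²-leftModule V)
  open LeftModuleMorphisms M.rawLeftModule M.rawLeftModule using (IsLeftModuleHomomorphism)

  private
    congʳ : ∀ (g : ℓ² V) {f f′} → f ≈² f′ → f +ᴹ g ≈² f′ +ᴹ g
    congʳ g f≈f′ = mk≈² λ v → C.+-congʳ {g at v} (coords-≈ f≈f′ v)
    -1*f≈-f : ∀ (f : ℓ² V) → (-ᶜ 1ᶜ) *ₗ f ≈² -ᴹ f
    -1*f≈-f f = mk≈² λ v → C-ring.-1*x≈-x (f at v)

  map-zero : {T : ℓ² V → ℓ² V} → BoundedLinear T → T 0ᴹ ≈² 0ᴹ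
  map-zero {T} T-bl =
    ≈²-trans (cong (mk≈² λ _ → C.sym (C.trans (C.+-identityʳ ((-ᶜ 1ᶜ) *ᶜ 0ᶜ)) (C.zeroʳ (-ᶜ 1ᶜ)))))
      (≈²-trans (linear (-ᶜ 1ᶜ) 0ᴹ 0ᴹ)
        (≈²-trans (congʳ (T 0ᴹ) (-1*f≈-f (T 0ᴹ))) (M.-ᴹ‿inverseˡ (T 0ᴹ))))
    where open BoundedLinear T-bl

  isHomomorphism : {T : ℓ² V → ℓ² V} → BoundedLinear T → IsLeftModuleHomomorphism T
  isHomomorphism {T} T-bl = record
    { +ᴹ-isGroupHomomorphism = record
      { isMonoidHomomorphism = record
        { isMagmaHomomorphism = record
          { isRelHomomorphism = record { cong = cong }
          ; homo = λ f g → ≈²-trans (cong (congʳ g (≈²-sym (M.*ₗ-identityˡ f))))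
              (≈²-trans (linear 1ᶜ f g) (congʳ (T g) (M.*ₗ-identityˡ (T f))))
          }
        ; ε-homo = map-zero T-bl
        }
      ; ⁻¹-homo = λ f → ≈²-trans (cong (≈²-sym (-1*f≈-f f))) (≈²-trans (on-* (-ᶜ 1ᶜ) f) (-1*f≈-f (T f)))
      }
    ; *ₗ-homo = on-*
    }
    where
    open BoundedLinear T-bl
    on-* : ∀ c f → T (c *ₗ f) ≈² c *ₗ T f
    on-* c f = ≈²-trans (cong (≈²-sym (M.+ᴹ-identityʳ (c *ₗ f))))
      (≈²-trans (linear c f 0ᴹ) (≈²-trans
        (mk≈² λ v → C.+-congˡ {c *ᶜ T f at v} (coords-≈ (map-zero T-bl) v)) (M.+ᴹ-identityʳ (c *ₗ T f))))

  inverse-bl : {T : Operator V} (T⁻¹ : BoundedInverse T) → BoundedLinear (inv T⁻¹)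
  inverse-bl T⁻¹ = record
    { cong   = ⟦⟧-cong
    ; linear = λ c f g → ≈²-trans (+ᴹ-homo (c *ₗ f) g) (congʳ (inv T⁻¹ g) (*ₗ-homo c f))
    ; bound  = BoundedInverse.bound T⁻¹
    }
    where open IsLeftModuleHomomorphism (BoundedInverse.linear T⁻¹)

-- Adjacency operators

open SetoidReasoning C.setoid

∑ᶜ : ∀ {V : Set} → List V → (V → ℂ) → ℂ
∑ᶜ L f = foldr (λ v s → f v +ᶜ s) 0ᶜ L

∑ᶜ-map : ∀ {V W : Set} (ι : V → W) (f : W → ℂ) L → ∑ᶜ (map ι L) f ≡ ∑ᶜ L (f ∘ ι)
∑ᶜ-map ι f []      = ≡.refl
∑ᶜ-map ι f (v ∷ L) = ≡.cong (f (ι v) +ᶜ_) (∑ᶜ-map ι f L)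

foldr-at : ∀ {V W : Set} (t : W → ℓ² V) L x → foldr (λ w f → t w +ᴹ f) 0ᴹ L at x ≡ ∑ᶜ L (λ w → t w at x)
foldr-at t []      x = ≡.refl
foldr-at t (w ∷ L) x = ≡.cong (t w at x +ᶜ_) (foldr-at t L x)

opaque
  ∑ᶜ-cong : ∀ {V : Set} {f g : V → ℂ} L → (∀ v → f v ≈ᶜ g v) → ∑ᶜ L f ≈ᶜ ∑ᶜ L g
  ∑ᶜ-cong []      f≈g = C.refl
  ∑ᶜ-cong (v ∷ L) f≈g = C.+-cong (f≈g v) (∑ᶜ-cong L f≈g)

  ∑ᶜ-++ : ∀ {V : Set} (f : V → ℂ) K L → ∑ᶜ (K ++ L) f ≈ᶜ ∑ᶜ K f +ᶜ ∑ᶜ L f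
  ∑ᶜ-++ f []      L = C.sym (C.+-identityˡ (∑ᶜ L f))
  ∑ᶜ-++ f (v ∷ K) L = C.trans (C.+-congˡ {f v} (∑ᶜ-++ f K L)) (C.sym (C.+-assoc (f v) (∑ᶜ K f) (∑ᶜ L f)))

  ∑ᶜ-lin : ∀ {V : Set} c (f g : V → ℂ) L → ∑ᶜ L (λ v → c *ᶜ f v +ᶜ g v) ≈ᶜ c *ᶜ ∑ᶜ L f +ᶜ ∑ᶜ L g
  ∑ᶜ-lin c f g []      = C.sym (C.trans (C.+-identityʳ (c *ᶜ 0ᶜ)) (C.zeroʳ c))
  ∑ᶜ-lin c f g (v ∷ L) = C.trans (C.+-congˡ {c *ᶜ f v +ᶜ g v} (∑ᶜ-lin c f g L))
    (solveᶜ 5 (λ c a b x y → (c :*ᶜ a :+ᶜ b) :+ᶜ (c :*ᶜ x :+ᶜ y) :=ᶜ c :*ᶜ (a :+ᶜ x) :+ᶜ (b :+ᶜ y)) C.refl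
      c (f v) (g v) (∑ᶜ L f) (∑ᶜ L g))

  ∑ᶜ-zero : ∀ {V : Set} {f : V → ℂ} L → (∀ {v} → v ∈ L → f v ≈ᶜ 0ᶜ) → ∑ᶜ L f ≈ᶜ 0ᶜ
  ∑ᶜ-zero []      f≈0 = C.refl
  ∑ᶜ-zero (v ∷ L) f≈0 = C.trans (C.+-cong (f≈0 (here ≡.refl)) (∑ᶜ-zero L (f≈0 ∘ there))) (C.+-identityˡ 0ᶜ)

  ⟶ᶜ-∑ᶜ : ∀ {V : Set} {s : ℕ → V → ℂ} {f : V → ℂ} L → (∀ v → (λ n → s n v) ⟶ᶜ f v) →
          (λ n → ∑ᶜ L (s n)) ⟶ᶜ ∑ᶜ L f
  ⟶ᶜ-∑ᶜ []      s⟶f = ⟶ᶜ-const 0ᶜ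
  ⟶ᶜ-∑ᶜ (v ∷ L) s⟶f = ⟶ᶜ-+ (s⟶f v) (⟶ᶜ-∑ᶜ L s⟶f)

  ⟶ᶜ-neg : ∀ {s a} → s ⟶ᶜ a → (λ n → -ᶜ s n) ⟶ᶜ -ᶜ a
  ⟶ᶜ-neg {s} {a} s⟶a ε 0<ε = ev-map (λ n p → ≤ᴿ-trans
    (≤ᴿ-reflexive (R.trans (∣∣²-cong (C-group.⁻¹-∙-comm (s n) (-ᶜ a))) (∣-z∣² (s n C.- a)))) p) (s⟶a ε 0<ε)

module _ {V : Set} (_≟_ : DecidableEquality V) where

  opaque
    ∑ᶜ-kronecker : ∀ {L x} (f : V → ℂ) → Unique L → x ∈ L → ∑ᶜ L (λ u → f u *ᶜ kronecker _≟_ u x) ≈ᶜ f x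
    ∑ᶜ-kronecker {u ∷ L} {x} f (u∉L ∷ uniq) (here ≡.refl) = begin
      f u *ᶜ kronecker _≟_ u u +ᶜ ∑ᶜ L (λ w → f w *ᶜ kronecker _≟_ w u)
        ≈⟨ C.+-cong (C.trans (C.*-congˡ {f u} (kronecker-diag _≟_ u)) (C.*-identityʳ (f u)))
             (∑ᶜ-zero L (λ {w} w∈L → C.trans
               (C.*-congˡ {f w} (kronecker-off _≟_ (λ w≡u → All.lookup u∉L w∈L (≡.sym w≡u)))) (C.zeroʳ (f w)))) ⟩
      f u +ᶜ 0ᶜ
        ≈⟨ C.+-identityʳ (f u) ⟩
      f u ∎
    ∑ᶜ-kronecker {u ∷ L} {x} f (u∉L ∷ uniq) (there x∈L) = C.trans
      (C.+-cong (C.trans (C.*-congˡ {f u} (kronecker-off _≟_ (All.lookup u∉L x∈L))) (C.zeroʳ (f u)))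
        (∑ᶜ-kronecker f uniq x∈L))
      (C.+-identityˡ (f x))

    ∑ᶜ-kronecker-∈ : ∀ {L x} → Unique L → x ∈ L → ∑ᶜ L (λ u → kronecker _≟_ u x) ≈ᶜ 1ᶜ
    ∑ᶜ-kronecker-∈ {L} {x} uniq x∈L = C.trans
      (∑ᶜ-cong L (λ u → C.sym (C.*-identityˡ (kronecker _≟_ u x)))) (∑ᶜ-kronecker (λ _ → 1ᶜ) uniq x∈L)

    ∑ᶜ-kronecker-∉ : ∀ {L x} → x ∉ L → ∑ᶜ L (λ u → kronecker _≟_ u x) ≈ᶜ 0ᶜ
    ∑ᶜ-kronecker-∉ {L} x∉L = ∑ᶜ-zero L (λ u∈L → kronecker-off _≟_ (λ { ≡.refl → x∉L u∈L }))

opaque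
  kronecker-injective : ∀ {V W : Set} (_≟_ : DecidableEquality V) (_≟′_ : DecidableEquality W) (ι : V → W) →
                        (∀ {u v} → ι u ≡ ι v → u ≡ v) →
                        ∀ u v → kronecker _≟′_ (ι u) (ι v) ≈ᶜ kronecker _≟_ u v
  kronecker-injective _≟_ _≟′_ ι injective u v with u ≟ v
  ... | yes ≡.refl = kronecker-diag _≟′_ (ι u)
  ... | no  u≢v    = kronecker-off _≟′_ (u≢v ∘ injective)

module Adjacency (Γ : Graph) where

  open Graph Γ using (_≟_; _~_; _~?_; ~-sym; neighbours; nbrs-unique; ∈-nbrs)

  nsum : (V Γ → ℂ) → V Γ → ℂ
  nsum f x = ∑ᶜ (neighbours x) f

  ~⇒∈ : ∀ {u v} → u ~ v → u ∈ neighbours v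
  ~⇒∈ = Equivalence.from ∈-nbrs

  ∈⇒~ : ∀ {u v} → u ∈ neighbours v → u ~ v
  ∈⇒~ = Equivalence.to ∈-nbrs

  opaque
    -- Both sums are the indicator of x ~ v. Symmetry of the adjacency thus turns the definition by
    -- images of basis vectors into a formula for coordinates.
    A₀e-at : ∀ v x → A₀e Γ v at x ≈ᶜ nsum (e Γ v at_) x
    A₀e-at v x = C.trans (C.reflexive (foldr-at (e Γ) (neighbours v) x)) (C.trans symmetric
      (∑ᶜ-cong (neighbours x) (λ u → kronecker-sym _≟_ u v)))
      where
      symmetric : ∑ᶜ (neighbours v) (λ u → kronecker _≟_ u x) ≈ᶜ ∑ᶜ (neighbours x) (λ u → kronecker _≟_ u v)
      symmetric with x ~? v
      ... | yes x~v = C.trans (∑ᶜ-kronecker-∈ _≟_ (nbrs-unique v) (~⇒∈ x~v))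
                        (C.sym (∑ᶜ-kronecker-∈ _≟_ (nbrs-unique x) (~⇒∈ (~-sym x~v))))
      ... | no  x≁v = C.trans (∑ᶜ-kronecker-∉ _≟_ (x≁v ∘ ∈⇒~))
                        (C.sym (∑ᶜ-kronecker-∉ _≟_ (x≁v ∘ ~-sym ∘ ∈⇒~)))

    combine-A₀e : ∀ l x → combine Γ (A₀e Γ) l at x ≈ᶜ nsum (combine Γ (e Γ) l at_) x
    combine-A₀e []            x = C.sym (∑ᶜ-zero (neighbours x) (λ _ → C.refl))
    combine-A₀e ((c , v) ∷ l) x = C.trans
      (C.+-cong (C.*-congˡ {c} (A₀e-at v x)) (combine-A₀e l x))
      (C.sym (∑ᶜ-lin c (e Γ v at_) (combine Γ (e Γ) l at_) (neighbours x)))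

    -- Each coordinate is continuous and, by local finiteness, the neighbour sum is a finite sum of
    -- coordinates, so the formula survives the closure. Its converse can fail when degrees are
    -- unbounded.
    A-at : ∀ {f h} → A Γ f h → ∀ x → h at x ≈ᶜ nsum (f at_) x
    A-at {f} {h} Af≈h x = ⟶ᶜ-unique
      (⟶-at (combine Γ (A₀e Γ) ∘ approx) h limit-A x)
      (⟶ᶜ-cong (λ n → C.sym (combine-A₀e (approx n) x)) C.refl
        (⟶ᶜ-∑ᶜ (neighbours x) (λ u → ⟶-at (combine Γ (e Γ) ∘ approx) f limit u)))
      where open A Af≈h

    nsum-adjacency : ∀ x v → nsum (e Γ v at_) x ≈ᶜ adjacencyMatrix Γ x v
    nsum-adjacency x v = C.trans (∑ᶜ-cong (neighbours x) (λ u → kronecker-sym _≟_ v u)) sum-indicator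
      where
      sum-indicator : ∑ᶜ (neighbours x) (λ u → kronecker _≟_ u v) ≈ᶜ adjacencyMatrix Γ x v
      sum-indicator with x ~? v
      ... | yes x~v = ∑ᶜ-kronecker-∈ _≟_ (nbrs-unique x) (~⇒∈ (~-sym x~v))
      ... | no  x≁v = ∑ᶜ-kronecker-∉ _≟_ (x≁v ∘ ~-sym ∘ ∈⇒~)

  combine-++ : ∀ b k l x → combine Γ b (k ++ l) at x ≈ᶜ combine Γ b k at x +ᶜ combine Γ b l at x
  combine-++ b []            l x = C.sym (C.+-identityˡ (combine Γ b l at x))
  combine-++ b ((c , v) ∷ k) l x = C.trans (C.+-congˡ {c *ᶜ b v at x} (combine-++ b k l x))
    (C.sym (C.+-assoc (c *ᶜ b v at x) (combine Γ b k at x) (combine Γ b l at x)))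

module FiniteGraph (Γ : Graph) (n : ℕ) (enum : Fin n ↔ V Γ) where

  open Inverse enum using (strictlyInverseˡ; strictlyInverseʳ) renaming (to to vertex; from to index) public

  vertices : List (V Γ)
  vertices = map vertex (allFin n)

  vertex-injective : ∀ {i j} → vertex i ≡ vertex j → i ≡ j
  vertex-injective {i} {j} eq = ≡.trans (≡.sym (strictlyInverseʳ i)) (≡.trans (≡.cong index eq) (strictlyInverseʳ j))

  vertices-unique : Unique vertices
  vertices-unique = Uniqueₚ.map⁺ vertex-injective (Uniqueₚ.allFin⁺ n)

  ∈-vertices : ∀ u → u ∈ vertices
  ∈-vertices u = ≡.subst (_∈ vertices) (strictlyInverseˡ u) (∈-map⁺ vertex (∈-allFin (index u)))

  summable-finite : ∀ (f : V Γ → ℂ) → SquareSummable f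
  summable-finite f ε 0<ε = vertices , λ
    { []      _ _ → 0≤fromℚ 0<ε
    ; (u ∷ F) _ d → ⊥-elim (d (here ≡.refl , ∈-vertices u))
    }

-- The adjacency operator of a coupling

module CouplingAdjacency (Γ₁ Γ₂ : Graph) (v₁ : V Γ₁) (v₂ : V Γ₂) where

  Γ : Graph
  Γ = coupling Γ₁ Γ₂ v₁ v₂

  module A₁ = Adjacency Γ₁
  module A₂ = Adjacency Γ₂
  module AΓ = Adjacency Γ
  module G₁ = Graph Γ₁
  module G₂ = Graph Γ₂

  e₁ : ℓ² (V Γ₁)
  e₁ = e Γ₁ v₁

  e₂ : ℓ² (V Γ₂)
  e₂ = e Γ₂ v₂

  opaque
    across₁ : ∀ f u → ∑ᶜ (Coupling.across Γ₁ Γ₂ v₁ v₂ (inj₁ u)) f ≈ᶜ f (inj₂ v₂) *ᶜ e₁ at u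
    across₁ f u with u G₁.≟ v₁
    ... | yes ≡.refl = C.trans (C.+-identityʳ (f (inj₂ v₂)))
      (C.sym (C.trans (C.*-congˡ {f (inj₂ v₂)} (kronecker-diag G₁._≟_ u)) (C.*-identityʳ (f (inj₂ v₂)))))
    ... | no u≢v₁ = C.sym (C.trans (C.*-congˡ {f (inj₂ v₂)} (kronecker-off G₁._≟_ (u≢v₁ ∘ ≡.sym)))
      (C.zeroʳ (f (inj₂ v₂))))

    across₂ : ∀ f w → ∑ᶜ (Coupling.across Γ₁ Γ₂ v₁ v₂ (inj₂ w)) f ≈ᶜ f (inj₁ v₁) *ᶜ e₂ at w
    across₂ f w with w G₂.≟ v₂
    ... | yes ≡.refl = C.trans (C.+-identityʳ (f (inj₁ v₁)))
      (C.sym (C.trans (C.*-congˡ {f (inj₁ v₁)} (kronecker-diag G₂._≟_ w)) (C.*-identityʳ (f (inj₁ v₁)))))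
    ... | no w≢v₂ = C.sym (C.trans (C.*-congˡ {f (inj₁ v₁)} (kronecker-off G₂._≟_ (w≢v₂ ∘ ≡.sym)))
      (C.zeroʳ (f (inj₁ v₁))))

    nsum₁ : ∀ f u → AΓ.nsum f (inj₁ u) ≈ᶜ A₁.nsum (f ∘ inj₁) u +ᶜ f (inj₂ v₂) *ᶜ e₁ at u
    nsum₁ f u = C.trans (∑ᶜ-++ f (map inj₁ (G₁.neighbours u)) (Coupling.across Γ₁ Γ₂ v₁ v₂ (inj₁ u)))
      (C.+-cong (C.reflexive (∑ᶜ-map inj₁ f (G₁.neighbours u))) (across₁ f u))

    nsum₂ : ∀ f w → AΓ.nsum f (inj₂ w) ≈ᶜ A₂.nsum (f ∘ inj₂) w +ᶜ f (inj₁ v₁) *ᶜ e₂ at w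
    nsum₂ f w = C.trans (∑ᶜ-++ f (map inj₂ (G₂.neighbours w)) (Coupling.across Γ₁ Γ₂ v₁ v₂ (inj₂ w)))
      (C.+-cong (C.reflexive (∑ᶜ-map inj₂ f (G₂.neighbours w))) (across₂ f w))

  in₂ : List (ℂ × V Γ₂) → List (ℂ × V Γ)
  in₂ = map (λ (c , w) → c , inj₂ w)

  out₂ : List (ℂ × V Γ) → List (ℂ × V Γ₂)
  out₂ []                 = []
  out₂ ((c , inj₁ u) ∷ l) = out₂ l
  out₂ ((c , inj₂ w) ∷ l) = (c , w) ∷ out₂ l

  opaque
    e-inj₂-inj₂ : ∀ w x → e Γ (inj₂ w) at inj₂ x ≈ᶜ e Γ₂ w at x
    e-inj₂-inj₂ = kronecker-injective G₂._≟_ (Graph._≟_ Γ) inj₂ Sumₚ.inj₂-injective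

    e-inj₁-inj₁ : ∀ u x → e Γ (inj₁ u) at inj₁ x ≈ᶜ e Γ₁ u at x
    e-inj₁-inj₁ = kronecker-injective G₁._≟_ (Graph._≟_ Γ) inj₁ Sumₚ.inj₁-injective

    term-off : ∀ c {u v} → u ≢ v → c *ᶜ e Γ u at v ≈ᶜ 0ᶜ
    term-off c u≢v = C.trans (C.*-congˡ {c} (kronecker-off (Graph._≟_ Γ) u≢v)) (C.zeroʳ c)

    combine-in₂-inj₁ : ∀ l u → combine Γ (e Γ) (in₂ l) at inj₁ u ≈ᶜ 0ᶜ
    combine-in₂-inj₁ []            u = C.refl
    combine-in₂-inj₁ ((c , w) ∷ l) u =
      C.trans (C.+-cong (term-off c {inj₂ w} {inj₁ u} (λ ())) (combine-in₂-inj₁ l u)) (C.+-identityˡ 0ᶜ)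

    combine-in₂-inj₂ : ∀ l x → combine Γ (e Γ) (in₂ l) at inj₂ x ≈ᶜ combine Γ₂ (e Γ₂) l at x
    combine-in₂-inj₂ []            x = C.refl
    combine-in₂-inj₂ ((c , w) ∷ l) x = C.+-cong (C.*-congˡ {c} (e-inj₂-inj₂ w x)) (combine-in₂-inj₂ l x)

    combine-out₂ : ∀ l x → combine Γ₂ (e Γ₂) (out₂ l) at x ≈ᶜ combine Γ (e Γ) l at inj₂ x
    combine-out₂ []                 x = C.refl
    combine-out₂ ((c , inj₁ u) ∷ l) x = C.trans (combine-out₂ l x)
      (C.sym (C.trans (C.+-congʳ {combine Γ (e Γ) l at inj₂ x} (term-off c {inj₁ u} {inj₂ x} (λ ())))
        (C.+-identityˡ (combine Γ (e Γ) l at inj₂ x))))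
    combine-out₂ ((c , inj₂ w) ∷ l) x =
      C.+-cong (C.*-congˡ {c} (C.sym (e-inj₂-inj₂ w x))) (combine-out₂ l x)

  -- A finite combination on Γ restricts to one on Γ₂, and the bridge contributes
  -- its coefficient at v₁ to the neighbour sum at v₂.
  A-restrict₂ : ∀ {f h} → A Γ f h →
                A Γ₂ (restrict₂ f) (restrict₂ h +ᴹ (-ᶜ (f at inj₁ v₁)) *ₗ e₂)
  A-restrict₂ {f} {h} Af≈h = record
    { approx  = out₂ ∘ approx
    ; limit   = ⟶-cong (restrict₂ ∘ s) (combine Γ₂ (e Γ₂) ∘ out₂ ∘ approx) (restrict₂ f)
        (λ n x → C.sym (combine-out₂ (approx n) x)) (⟶-restrict₂ s f limit)
    ; limit-A = ⟶-cong (λ n → restrict₂ (t n) +ᴹ (-ᶜ (s n at inj₁ v₁)) *ₗ e₂)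
        (combine Γ₂ (A₀e Γ₂) ∘ out₂ ∘ approx) (restrict₂ h +ᴹ (-ᶜ (f at inj₁ v₁)) *ₗ e₂)
        (λ n x → C.sym (without-bridge (approx n) x))
        (⟶-+ (restrict₂ ∘ t) (λ n → (-ᶜ (s n at inj₁ v₁)) *ₗ e₂) (restrict₂ h) ((-ᶜ (f at inj₁ v₁)) *ₗ e₂)
          (⟶-restrict₂ t h limit-A)
          (⟶-scale (λ n → -ᶜ (s n at inj₁ v₁)) (-ᶜ (f at inj₁ v₁)) e₂ (‖basis‖≤1 G₂._≟_ v₂)
            (⟶ᶜ-neg (⟶-at s f limit (inj₁ v₁)))))
    }
    where
    open A Af≈h
    s t : ℕ → ℓ² (V Γ)
    s n = combine Γ (e Γ) (approx n)
    t n = combine Γ (A₀e Γ) (approx n)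
    without-bridge : ∀ l x → combine Γ₂ (A₀e Γ₂) (out₂ l) at x ≈ᶜ
      combine Γ (A₀e Γ) l at inj₂ x +ᶜ (-ᶜ (combine Γ (e Γ) l at inj₁ v₁)) *ᶜ e₂ at x
    without-bridge l x = begin
      combine Γ₂ (A₀e Γ₂) (out₂ l) at x
        ≈⟨ A₂.combine-A₀e (out₂ l) x ⟩
      A₂.nsum (combine Γ₂ (e Γ₂) (out₂ l) at_) x
        ≈⟨ ∑ᶜ-cong (G₂.neighbours x) (combine-out₂ l) ⟩
      A₂.nsum (λ w → combine Γ (e Γ) l at inj₂ w) x
        ≈⟨ C-group.//-rightDividesʳ (c *ᶜ e₂ at x) _ ⟨
      A₂.nsum (λ w → combine Γ (e Γ) l at inj₂ w) x +ᶜ c *ᶜ e₂ at x +ᶜ -ᶜ (c *ᶜ e₂ at x)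
        ≈⟨ C.+-cong (nsum₂ (combine Γ (e Γ) l at_) x) (C.sym (C-ring.-‿distribˡ-* c (e₂ at x))) ⟨
      AΓ.nsum (combine Γ (e Γ) l at_) (inj₂ x) +ᶜ (-ᶜ c) *ᶜ e₂ at x
        ≈⟨ C.+-congʳ {(-ᶜ c) *ᶜ e₂ at x} (AΓ.combine-A₀e l (inj₂ x)) ⟨
      combine Γ (A₀e Γ) l at inj₂ x +ᶜ (-ᶜ c) *ᶜ e₂ at x ∎
      where
      c : ℂ
      c = combine Γ (e Γ) l at inj₁ v₁

  module Extend (n : ℕ) (enum : Fin n ↔ V Γ₁) where

    open FiniteGraph Γ₁ n enum

    nsumᴹ : ℓ² (V Γ₁) → ℓ² (V Γ₁)
    nsumᴹ f = mkℓ² (A₁.nsum (f at_)) (summable-finite _)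

    in₁ : ℓ² (V Γ₁) → List (ℂ × V Γ)
    in₁ f = map (λ u → f at u , inj₁ u) vertices

    combine-in₁ : ∀ f L x → combine Γ (e Γ) (map (λ u → f at u , inj₁ u) L) at x ≡
                            ∑ᶜ L (λ u → f at u *ᶜ e Γ (inj₁ u) at x)
    combine-in₁ f []      x = ≡.refl
    combine-in₁ f (u ∷ L) x = ≡.cong (f at u *ᶜ e Γ (inj₁ u) at x +ᶜ_) (combine-in₁ f L x)

    opaque
      combine-in₁-inj₁ : ∀ f x → combine Γ (e Γ) (in₁ f) at inj₁ x ≈ᶜ f at x
      combine-in₁-inj₁ f x = C.trans (C.reflexive (combine-in₁ f vertices (inj₁ x)))
        (C.trans (∑ᶜ-cong vertices (λ u → C.*-congˡ {f at u} (e-inj₁-inj₁ u x)))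
          (∑ᶜ-kronecker G₁._≟_ (f at_) vertices-unique (∈-vertices x)))

      combine-in₁-inj₂ : ∀ f x → combine Γ (e Γ) (in₁ f) at inj₂ x ≈ᶜ 0ᶜ
      combine-in₁-inj₂ f x = C.trans (C.reflexive (combine-in₁ f vertices (inj₂ x)))
        (∑ᶜ-zero vertices (λ {u} _ → term-off (f at u) {inj₁ u} {inj₂ x} (λ ())))

    -- As Γ₁ is finite, f₁ is itself a finite combination. Prefixing it to the combinations that
    -- approximate f₂ gives approximants of the pair; the bridge adds the fixed f₁(v₁) e_{v₂} on Γ₂
    -- and, on Γ₁, multiples of e_{v₁} whose coefficients converge to f₂(v₂).
    A-extend : ∀ f₁ {f₂ h₂} → A Γ₂ f₂ h₂ →
               A Γ (f₁ ⊕ f₂) ((nsumᴹ f₁ +ᴹ (f₂ at v₂) *ₗ e₁) ⊕ (h₂ +ᴹ (f₁ at v₁) *ₗ e₂))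
    A-extend f₁ {f₂} {h₂} Af₂≈h₂ = record
      { approx  = λ n → in₁ f₁ ++ in₂ (approx n)
      ; limit   = ⟶-cong (λ n → f₁ ⊕ s n) (λ n → combine Γ (e Γ) (in₁ f₁ ++ in₂ (approx n))) (f₁ ⊕ f₂)
          (λ n x → C.sym (joined (approx n) x))
          (⟶-⊕ (λ _ → f₁) s f₁ f₂ (⟶-const f₁) limit)
      ; limit-A = ⟶-cong (λ n → (nsumᴹ f₁ +ᴹ (s n at v₂) *ₗ e₁) ⊕ (t n +ᴹ (f₁ at v₁) *ₗ e₂))
          (λ n → combine Γ (A₀e Γ) (in₁ f₁ ++ in₂ (approx n)))
          ((nsumᴹ f₁ +ᴹ (f₂ at v₂) *ₗ e₁) ⊕ (h₂ +ᴹ (f₁ at v₁) *ₗ e₂))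
          (λ n x → C.sym (joined-A (approx n) x))
          (⟶-⊕ (λ n → nsumᴹ f₁ +ᴹ (s n at v₂) *ₗ e₁) (λ n → t n +ᴹ (f₁ at v₁) *ₗ e₂)
               (nsumᴹ f₁ +ᴹ (f₂ at v₂) *ₗ e₁) (h₂ +ᴹ (f₁ at v₁) *ₗ e₂)
            (⟶-+ (λ _ → nsumᴹ f₁) (λ n → (s n at v₂) *ₗ e₁) (nsumᴹ f₁) ((f₂ at v₂) *ₗ e₁)
              (⟶-const (nsumᴹ f₁))
              (⟶-scale (λ n → s n at v₂) (f₂ at v₂) e₁ (‖basis‖≤1 G₁._≟_ v₁) (⟶-at s f₂ limit v₂)))
            (⟶-+ t (λ _ → (f₁ at v₁) *ₗ e₂) h₂ ((f₁ at v₁) *ₗ e₂)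
              limit-A (⟶-const ((f₁ at v₁) *ₗ e₂))))
      }
      where
      open A Af₂≈h₂
      s t : ℕ → ℓ² (V Γ₂)
      s n = combine Γ₂ (e Γ₂) (approx n)
      t n = combine Γ₂ (A₀e Γ₂) (approx n)
      joined : ∀ l x → combine Γ (e Γ) (in₁ f₁ ++ in₂ l) at x ≈ᶜ (f₁ ⊕ combine Γ₂ (e Γ₂) l) at x
      joined l (inj₁ u) = C.trans (AΓ.combine-++ (e Γ) (in₁ f₁) (in₂ l) (inj₁ u))
        (C.trans (C.+-cong (combine-in₁-inj₁ f₁ u) (combine-in₂-inj₁ l u)) (C.+-identityʳ (f₁ at u)))
      joined l (inj₂ w) = C.trans (AΓ.combine-++ (e Γ) (in₁ f₁) (in₂ l) (inj₂ w))
        (C.trans (C.+-cong (combine-in₁-inj₂ f₁ w) (combine-in₂-inj₂ l w))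
          (C.+-identityˡ (combine Γ₂ (e Γ₂) l at w)))
      joined-A : ∀ l x → combine Γ (A₀e Γ) (in₁ f₁ ++ in₂ l) at x ≈ᶜ
        ((nsumᴹ f₁ +ᴹ (combine Γ₂ (e Γ₂) l at v₂) *ₗ e₁) ⊕ (combine Γ₂ (A₀e Γ₂) l +ᴹ (f₁ at v₁) *ₗ e₂)) at x
      joined-A l x@(inj₁ u) = C.trans (AΓ.combine-A₀e (in₁ f₁ ++ in₂ l) x)
        (C.trans (∑ᶜ-cong (Graph.neighbours Γ x) (joined l)) (nsum₁ ((f₁ ⊕ combine Γ₂ (e Γ₂) l) at_) u))
      joined-A l x@(inj₂ w) = C.trans (AΓ.combine-A₀e (in₁ f₁ ++ in₂ l) x)
        (C.trans (∑ᶜ-cong (Graph.neighbours Γ x) (joined l))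
          (C.trans (nsum₂ ((f₁ ⊕ combine Γ₂ (e Γ₂) l) at_) w)
            (C.+-congʳ {f₁ at v₁ *ᶜ e₂ at w} (C.sym (A₂.combine-A₀e l w)))))

module DetC = Determinants ℂ-commutativeRing
open DetC using (δ; det; _≋₂_) renaming (_·_ to _∙_)
open SemiringSum C.semiring using (sum; sum-cong-≋; *-distribˡ-sum; *-distribʳ-sum; ∑-comm)

-- The spectrum of a coupling

opaque
  cancel-pair : ∀ x y → (-ᶜ x) *ᶜ y +ᶜ x *ᶜ y ≈ᶜ 0ᶜ
  cancel-pair x y = C.trans (C.sym (C.distribʳ y (-ᶜ x) x))
    (C.trans (C.*-congʳ {y} (C.-‿inverseˡ x)) (C.zeroˡ y))

  ≈-⇒+≈ : ∀ {x y w} → x ≈ᶜ y C.- w → x +ᶜ w ≈ᶜ y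
  ≈-⇒+≈ {x} {y} {w} eq = C.trans (C.+-congʳ {w} eq) (C-group.//-rightDividesˡ w y)

  +≈⇒≈- : ∀ {x y w} → x +ᶜ w ≈ᶜ y → x ≈ᶜ y C.- w
  +≈⇒≈- {x} {y} {w} eq = C.trans (C.sym (C-group.//-rightDividesʳ w x)) (C.+-congʳ { -ᶜ w} eq)

  -- Both directions of the elimination of the second component: p stands for z f₁,
  -- s for the neighbour sum, t for f₁(v₁), k for e_{v₁}, and r + t G for f₂(v₂).
  eliminate : ∀ p s G t k g r → p +ᶜ ((-ᶜ 1ᶜ) *ᶜ s +ᶜ (-ᶜ G) *ᶜ (t *ᶜ k)) ≈ᶜ g +ᶜ r *ᶜ k →
              g +ᶜ (s +ᶜ (r +ᶜ t *ᶜ G) *ᶜ k) ≈ᶜ p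
  eliminate p s G t k g r eq = begin
    g +ᶜ (s +ᶜ (r +ᶜ t *ᶜ G) *ᶜ k)
      ≈⟨ solveᶜ 6 (λ s G t k g r → g :+ᶜ (s :+ᶜ (r :+ᶜ t :*ᶜ G) :*ᶜ k) :=ᶜ
                     (g :+ᶜ r :*ᶜ k) :+ᶜ (conᶜ 1 :*ᶜ s :+ᶜ G :*ᶜ (t :*ᶜ k))) C.refl s G t k g r ⟩
    (g +ᶜ r *ᶜ k) +ᶜ (1ᶜ *ᶜ s +ᶜ G *ᶜ (t *ᶜ k))
      ≈⟨ C.+-congʳ {1ᶜ *ᶜ s +ᶜ G *ᶜ (t *ᶜ k)} eq ⟨
    (p +ᶜ ((-ᶜ 1ᶜ) *ᶜ s +ᶜ (-ᶜ G) *ᶜ (t *ᶜ k))) +ᶜ (1ᶜ *ᶜ s +ᶜ G *ᶜ (t *ᶜ k))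
      ≈⟨ solveᶜ 5 (λ p a b c d → (p :+ᶜ (a :+ᶜ b)) :+ᶜ (c :+ᶜ d) :=ᶜ p :+ᶜ ((a :+ᶜ c) :+ᶜ (b :+ᶜ d))) C.refl
           p ((-ᶜ 1ᶜ) *ᶜ s) ((-ᶜ G) *ᶜ (t *ᶜ k)) (1ᶜ *ᶜ s) (G *ᶜ (t *ᶜ k)) ⟩
    p +ᶜ (((-ᶜ 1ᶜ) *ᶜ s +ᶜ 1ᶜ *ᶜ s) +ᶜ ((-ᶜ G) *ᶜ (t *ᶜ k) +ᶜ G *ᶜ (t *ᶜ k)))
      ≈⟨ C.+-congˡ {p} (C.+-cong (cancel-pair 1ᶜ s) (cancel-pair G (t *ᶜ k))) ⟩
    p +ᶜ (0ᶜ +ᶜ 0ᶜ)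
      ≈⟨ C.trans (C.+-congˡ {p} (C.+-identityʳ 0ᶜ)) (C.+-identityʳ p) ⟩
    p ∎

  introduce : ∀ p s G t k g r → g +ᶜ (s +ᶜ (r +ᶜ t *ᶜ G) *ᶜ k) ≈ᶜ p →
              p +ᶜ ((-ᶜ 1ᶜ) *ᶜ s +ᶜ (-ᶜ G) *ᶜ (t *ᶜ k)) ≈ᶜ g +ᶜ r *ᶜ k
  introduce p s G t k g r eq = begin
    p +ᶜ ((-ᶜ 1ᶜ) *ᶜ s +ᶜ (-ᶜ G) *ᶜ (t *ᶜ k))
      ≈⟨ C.+-congʳ {(-ᶜ 1ᶜ) *ᶜ s +ᶜ (-ᶜ G) *ᶜ (t *ᶜ k)} eq ⟨
    (g +ᶜ (s +ᶜ (r +ᶜ t *ᶜ G) *ᶜ k)) +ᶜ ((-ᶜ 1ᶜ) *ᶜ s +ᶜ (-ᶜ G) *ᶜ (t *ᶜ k))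
      ≈⟨ solveᶜ 8 (λ s G t k g r a b → (g :+ᶜ (s :+ᶜ (r :+ᶜ t :*ᶜ G) :*ᶜ k)) :+ᶜ (a :+ᶜ b) :=ᶜ
                     (g :+ᶜ r :*ᶜ k) :+ᶜ ((a :+ᶜ conᶜ 1 :*ᶜ s) :+ᶜ (b :+ᶜ G :*ᶜ (t :*ᶜ k)))) C.refl
           s G t k g r ((-ᶜ 1ᶜ) *ᶜ s) ((-ᶜ G) *ᶜ (t *ᶜ k)) ⟩
    (g +ᶜ r *ᶜ k) +ᶜ (((-ᶜ 1ᶜ) *ᶜ s +ᶜ 1ᶜ *ᶜ s) +ᶜ ((-ᶜ G) *ᶜ (t *ᶜ k) +ᶜ G *ᶜ (t *ᶜ k)))
      ≈⟨ C.+-congˡ {g +ᶜ r *ᶜ k} (C.+-cong (cancel-pair 1ᶜ s) (cancel-pair G (t *ᶜ k))) ⟩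
    (g +ᶜ r *ᶜ k) +ᶜ (0ᶜ +ᶜ 0ᶜ)
      ≈⟨ C.trans (C.+-congˡ {g +ᶜ r *ᶜ k} (C.+-identityʳ 0ᶜ)) (C.+-identityʳ (g +ᶜ r *ᶜ k)) ⟩
    g +ᶜ r *ᶜ k ∎

  kronecker-δ : ∀ {n} (i j : Fin n) → kronecker Finₚ._≟_ i j ≈ᶜ δ i j
  kronecker-δ i j with i Finₚ.≟ j
  ... | yes ≡.refl = C.sym (DetC.δ-diag i)
  ... | no i≢j     = C.sym (DetC.δ-off i≢j)

  adjacency-∖ : ∀ Γ v (p q : V (Γ ∖ v)) →
                adjacencyMatrix (Γ ∖ v) p q ≈ᶜ adjacencyMatrix Γ (proj₁ p) (proj₁ q)
  adjacency-∖ Γ v p q with Graph._~?_ (Γ ∖ v) p q | Graph._~?_ Γ (proj₁ p) (proj₁ q)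
  ... | yes _   | yes _   = C.refl
  ... | no _    | no _    = C.refl
  ... | yes p~q | no p≁q  = ⊥-elim (p≁q p~q)
  ... | no p≁q  | yes p~q = ⊥-elim (p≁q p~q)

  ∑ᶜ-sum : ∀ {V : Set} {n} (c : Fin n → ℂ) (f : Fin n → V → ℂ) L →
           ∑ᶜ L (λ v → sum (λ j → c j *ᶜ f j v)) ≈ᶜ sum (λ j → c j *ᶜ ∑ᶜ L (f j))
  ∑ᶜ-sum c f []      = C.sym (DetC.sum-zero {t = λ j → c j *ᶜ 0ᶜ} (λ j → C.zeroʳ (c j)))
  ∑ᶜ-sum c f (v ∷ L) = C.trans (C.+-congˡ {sum (λ j → c j *ᶜ f j v)} (∑ᶜ-sum c f L))
    (C.trans (C.sym (SemiringSum.∑-distrib-+ C.semiring (λ j → c j *ᶜ f j v) (λ j → c j *ᶜ ∑ᶜ L (f j))))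
      (sum-cong-≋ (λ j → C.sym (C.distribˡ (c j) (f j v) (∑ᶜ L (f j))))))

∑ᴹ-at : ∀ {V : Set} n (t : Fin n → ℓ² V) x → ∑ᴹ {V} {V} n t at x ≡ sum (λ i → t i at x)
∑ᴹ-at zero    t x = ≡.refl
∑ᴹ-at (suc n) t x = ≡.cong (t zero at x +ᶜ_) (∑ᴹ-at n (t ∘ suc) x)

-- Matrices acting on functions on a finite graph

module FiniteMatrix (Γ : Graph) (n : ℕ) (enum : Fin n ↔ V Γ) where

  open FiniteGraph Γ n enum public
  open Adjacency Γ using (nsum; nsum-adjacency)
  open Graph Γ using (_≟_)

  opaque
    e-vertex : ∀ i j → e Γ (vertex i) at vertex j ≈ᶜ δ i j
    e-vertex i j = C.trans (kronecker-injective Finₚ._≟_ _≟_ vertex vertex-injective i j) (kronecker-δ i j)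

    at-vertices : ∀ (P : V Γ → Set) → (∀ i → P (vertex i)) → ∀ u → P u
    at-vertices P p u = ≡.subst P (strictlyInverseˡ u) (p (index u))

    expand : ∀ (f : V Γ → ℂ) u → f u ≈ᶜ sum (λ j → f (vertex j) *ᶜ e Γ (vertex j) at u)
    expand f = at-vertices (λ u → f u ≈ᶜ sum (λ j → f (vertex j) *ᶜ e Γ (vertex j) at u)) λ i → C.sym (C.trans
      (sum-cong-≋ (λ j → C.*-congˡ {f (vertex j)} (e-vertex j i))) (DetC.sum-δ (f ∘ vertex) i))

    nsum-matrix : ∀ f u → nsum f u ≈ᶜ sum (λ j → adjacencyMatrix Γ u (vertex j) *ᶜ f (vertex j))
    nsum-matrix f u = C.trans (∑ᶜ-cong (Graph.neighbours Γ u) (expand f))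
      (C.trans (∑ᶜ-sum (f ∘ vertex) (λ j → e Γ (vertex j) at_) (Graph.neighbours Γ u))
        (sum-cong-≋ (λ j → C.trans (C.*-congˡ {f (vertex j)} (nsum-adjacency u (vertex j)))
          (*ᶜ-comm (f (vertex j)) (adjacencyMatrix Γ u (vertex j))))))

  -- Written as a combination of rank-one maps, so that boundedness follows from closure under sums
  -- and scaling.
  matrix-map : (Fin n → Fin n → ℂ) → ℓ² (V Γ) → ℓ² (V Γ)
  matrix-map X f = ∑ᴹ {V Γ} {V Γ} n λ i → ∑ᴹ {V Γ} {V Γ} n λ j → X i j *ₗ ((f at vertex j) *ₗ e Γ (vertex i))

  matrix-map-bl : ∀ X → BoundedLinear (matrix-map X)
  matrix-map-bl X = sum-map n (λ i → sum-map n (λ j →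
    scale (X i j) (rank-one (vertex j) (e Γ (vertex i)) (‖basis‖≤1 _≟_ (vertex i)))))

  opaque
    matrix-map-at : ∀ X f k → matrix-map X f at vertex k ≈ᶜ sum (λ j → X k j *ᶜ f at vertex j)
    matrix-map-at X f k = begin
      matrix-map X f at vertex k
        ≡⟨ ∑ᴹ-at n (λ i → ∑ᴹ {V Γ} {V Γ} n λ j → X i j *ₗ ((f at vertex j) *ₗ e Γ (vertex i))) (vertex k) ⟩
      sum (λ i → ∑ᴹ {V Γ} {V Γ} n (λ j → X i j *ₗ ((f at vertex j) *ₗ e Γ (vertex i))) at vertex k)
        ≈⟨ sum-cong-≋ (λ i → C.trans
             (C.reflexive (∑ᴹ-at n (λ j → X i j *ₗ ((f at vertex j) *ₗ e Γ (vertex i))) (vertex k)))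
             (C.trans (sum-cong-≋ (λ j → entry i j))
               (C.sym (*-distribʳ-sum (δ i k) (λ j → X i j *ᶜ f at vertex j))))) ⟩
      sum (λ i → sum (λ j → X i j *ᶜ f at vertex j) *ᶜ δ i k)
        ≈⟨ DetC.sum-δ (λ i → sum (λ j → X i j *ᶜ f at vertex j)) k ⟩
      sum (λ j → X k j *ᶜ f at vertex j) ∎
      where
      entry : ∀ i j → X i j *ᶜ (f at vertex j *ᶜ e Γ (vertex i) at vertex k) ≈ᶜ X i j *ᶜ f at vertex j *ᶜ δ i k
      entry i j = C.trans (C.sym (*ᶜ-assoc (X i j) (f at vertex j) (e Γ (vertex i) at vertex k)))
        (C.*-congˡ {X i j *ᶜ f at vertex j} (e-vertex i k))

-- Elimination of the second component

module Resolvent (Γ₁ Γ₂ : Graph) (v₁ : V Γ₁) (v₂ : V Γ₂) (m : ℕ) (enum : Fin (suc m) ↔ V Γ₁)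
                 (z : ℂ) (z∈ρ : z ∈ρ A Γ₂) where

  open CouplingAdjacency Γ₁ Γ₂ v₁ v₂
  open FiniteMatrix Γ₁ (suc m) enum
  open Extend (suc m) enum using (nsumᴹ; A-extend)

  R₂ : ℓ² (V Γ₂) → ℓ² (V Γ₂)
  R₂ = inv z∈ρ

  module R₂ = BoundedLinear (inverse-bl z∈ρ)

  g₀ : ℂ
  g₀ = G Γ₂ z∈ρ v₂

  i₁ : Fin (suc m)
  i₁ = index v₁

  -- The Schur complement z - A(Γ₁) - G(z) E of z - A(Γ₂), where E is the diagonal
  -- matrix unit at v₁.
  B N : Fin (suc m) → Fin (suc m) → ℂ
  B i j = z *ᶜ kronecker Finₚ._≟_ i j +ᶜ -ᶜ adjacencyMatrix Γ₁ (vertex i) (vertex j)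
  N i j = (-ᶜ g₀) *ᶜ (δ i i₁ *ᶜ δ i₁ j) +ᶜ B i j

  opaque
    -- `finite-∖` enumerates the remaining vertices through `punchIn` at the index of v₁, the very
    -- indexing of the principal minor, so the two matrices agree entry by entry.
    det-N : det N ≈ᶜ P z Γ₁ (suc m , enum) +ᶜ -ᶜ (G Γ₂ z∈ρ v₂ *ᶜ P z (Γ₁ ∖ v₁) (finite-∖ Γ₁ v₁ (suc m , enum)))
    det-N = C.trans (DetC.det-shift B N i₁ (-ᶜ g₀) others at-i₁)
      (C.+-congˡ {P z Γ₁ (suc m , enum)} (C.trans (C.*-congˡ { -ᶜ g₀} minor)
        (C.sym (C-ring.-‿distribˡ-* g₀ (P z (Γ₁ ∖ v₁) (finite-∖ Γ₁ v₁ (suc m , enum)))))))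
      where
      others : ∀ k j → N (punchIn i₁ k) j ≈ᶜ B (punchIn i₁ k) j
      others k j = C.trans
        (C.+-congʳ {B (punchIn i₁ k) j} (C.trans (C.*-congˡ { -ᶜ g₀} (C.trans
          (C.*-congʳ {δ i₁ j} (DetC.δ-off (Finₚ.punchInᵢ≢i i₁ k))) (C.zeroˡ (δ i₁ j)))) (C.zeroʳ (-ᶜ g₀))))
        (C.+-identityˡ (B (punchIn i₁ k) j))
      at-i₁ : ∀ j → N i₁ j ≈ᶜ (-ᶜ g₀) *ᶜ δ i₁ j +ᶜ B i₁ j
      at-i₁ j = C.+-congʳ {B i₁ j} (C.*-congˡ { -ᶜ g₀}
        (C.trans (C.*-congʳ {δ i₁ j} (DetC.δ-diag i₁)) (C.*-identityˡ (δ i₁ j))))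
      minor : det (λ r s → B (punchIn i₁ r) (punchIn i₁ s)) ≈ᶜ P z (Γ₁ ∖ v₁) (finite-∖ Γ₁ v₁ (suc m , enum))
      minor = DetC.det-cong λ r s → C.+-cong
        (C.*-congˡ {z} (kronecker-injective Finₚ._≟_ Finₚ._≟_ (punchIn i₁) (Finₚ.punchIn-injective i₁ _ _) r s))
        (C.-‿cong (C.sym (adjacency-∖ Γ₁ v₁ (Inverse.to (proj₂ (finite-∖ Γ₁ v₁ (suc m , enum))) r)
                                           (Inverse.to (proj₂ (finite-∖ Γ₁ v₁ (suc m , enum))) s))))

  -- The action of `N` freed from the enumeration, so that it can be compared with neighbour sums;
  -- `f v₁ *ᶜ e₁ at u` is the matrix unit at v₁ applied to f.
  schur : (V Γ₁ → ℂ) → V Γ₁ → ℂ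
  schur f u = z *ᶜ f u +ᶜ ((-ᶜ 1ᶜ) *ᶜ A₁.nsum f u +ᶜ (-ᶜ g₀) *ᶜ (f v₁ *ᶜ e₁ at u))

  opaque
    e₁-vertex : ∀ i → e₁ at vertex i ≈ᶜ δ i i₁
    e₁-vertex i = ≡.subst (λ v → e Γ₁ v at vertex i ≈ᶜ δ i i₁) (strictlyInverseˡ v₁)
      (C.trans (e-vertex i₁ i) (DetC.δ-sym i₁ i))

    N-schur : ∀ f i → sum (λ j → N i j *ᶜ f (vertex j)) ≈ᶜ schur f (vertex i)
    N-schur f i = begin
      sum (λ j → N i j *ᶜ F j)
        ≈⟨ sum-cong-≋ term ⟩
      sum (λ j → z *ᶜ (δ i j *ᶜ F j) +ᶜ ((-ᶜ 1ᶜ) *ᶜ (a j *ᶜ F j) +ᶜ b j))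
        ≈⟨ DetC.sum-lin z (λ j → δ i j *ᶜ F j) (λ j → (-ᶜ 1ᶜ) *ᶜ (a j *ᶜ F j) +ᶜ b j) ⟩
      z *ᶜ sum (λ j → δ i j *ᶜ F j) +ᶜ sum (λ j → (-ᶜ 1ᶜ) *ᶜ (a j *ᶜ F j) +ᶜ b j)
        ≈⟨ C.+-cong (C.*-congˡ {z} (DetC.δ-sum F i)) (DetC.sum-lin (-ᶜ 1ᶜ) (λ j → a j *ᶜ F j) b) ⟩
      z *ᶜ F i +ᶜ ((-ᶜ 1ᶜ) *ᶜ sum (λ j → a j *ᶜ F j) +ᶜ sum b)
        ≈⟨ C.+-congˡ {z *ᶜ F i} (C.+-cong
             (C.*-congˡ { -ᶜ 1ᶜ} (C.sym (nsum-matrix f (vertex i))))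
             (C.trans (C.sym (*-distribˡ-sum ((-ᶜ g₀) *ᶜ δ i i₁) (λ j → δ i₁ j *ᶜ F j)))
               (C.trans (C.*-congˡ {(-ᶜ g₀) *ᶜ δ i i₁} (DetC.δ-sum F i₁)) last))) ⟩
      schur f (vertex i) ∎
      where
      F a b : Fin (suc m) → ℂ
      F j = f (vertex j)
      a j = adjacencyMatrix Γ₁ (vertex i) (vertex j)
      b j = (-ᶜ g₀) *ᶜ δ i i₁ *ᶜ (δ i₁ j *ᶜ F j)
      term : ∀ j → N i j *ᶜ F j ≈ᶜ
             z *ᶜ (δ i j *ᶜ F j) +ᶜ ((-ᶜ 1ᶜ) *ᶜ (a j *ᶜ F j) +ᶜ b j)
      term j = C.trans
        (C.*-congʳ {F j} (C.+-congˡ {(-ᶜ g₀) *ᶜ (δ i i₁ *ᶜ δ i₁ j)}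
          (C.+-cong (C.*-congˡ {z} (kronecker-δ i j)) (C.sym (C-ring.-1*x≈-x (a j))))))
        (solveᶜ 8 (λ z d n a γ x y f → (γ :*ᶜ (x :*ᶜ y) :+ᶜ (z :*ᶜ d :+ᶜ n :*ᶜ a)) :*ᶜ f :=ᶜ
                     z :*ᶜ (d :*ᶜ f) :+ᶜ (n :*ᶜ (a :*ᶜ f) :+ᶜ γ :*ᶜ x :*ᶜ (y :*ᶜ f))) C.refl
          z (δ i j) (-ᶜ 1ᶜ) (a j) (-ᶜ g₀) (δ i i₁) (δ i₁ j) (F j))
      last : (-ᶜ g₀) *ᶜ δ i i₁ *ᶜ F i₁ ≈ᶜ (-ᶜ g₀) *ᶜ (f v₁ *ᶜ e₁ at vertex i)
      last = C.trans (*ᶜ-assoc (-ᶜ g₀) (δ i i₁) (F i₁)) (C.*-congˡ { -ᶜ g₀}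
        (C.trans (*ᶜ-comm (δ i i₁) (F i₁))
          (C.*-cong (C.reflexive (≡.cong f (strictlyInverseˡ v₁))) (C.sym (e₁-vertex i)))))

    -- Here the Green's function enters the elimination: the second component feels the first only
    -- through t = f₁(v₁), and acts back on Γ₁ only through its value at v₂.
    R₂-at-v₂ : ∀ g t → R₂ (g +ᴹ t *ₗ e₂) at v₂ ≈ᶜ R₂ g at v₂ +ᶜ t *ᶜ g₀
    R₂-at-v₂ g t = C.trans
      (coords-≈ (R₂.cong {g +ᴹ t *ₗ e₂} {t *ₗ e₂ +ᴹ g} (mk≈² λ w → C.+-comm (g at w) (t *ᶜ e₂ at w))) v₂)
      (C.trans (coords-≈ (R₂.linear t e₂ g) v₂) (C.+-comm (t *ᶜ R₂ e₂ at v₂) (R₂ g at v₂)))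

  reduced : ℓ² (V Γ) → ℓ² (V Γ₁)
  reduced g = restrict₁ g +ᴹ (R₂ (restrict₂ g) at v₂) *ₗ e₁

  module _ {f g : ℓ² (V Γ)} (zf-Af≈g : (z I- A Γ) f g) where

    private
      h = proj₁ zf-Af≈g
      Af≈h = proj₁ (proj₂ zf-Af≈g)
      a = f at inj₁ v₁

    opaque
      -- Cutting down to Γ₂ removes the bridge term f₁(v₁) e_{v₂} from the image, so it reappears on
      -- the right-hand side. The cut pair lies in the graph of z - A(Γ₂), and `inverseˡ` identifies
      -- its first entry.
      second-component : R₂ (restrict₂ g +ᴹ a *ₗ e₂) ≈² restrict₂ f
      second-component = BoundedInverse.inverseˡ z∈ρ (restrict₂ f) (restrict₂ g +ᴹ a *ₗ e₂)
        (restrict₂ h +ᴹ (-ᶜ a) *ₗ e₂ , A-restrict₂ Af≈h , mk≈² λ w → +≈⇒≈- (begin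
          (g at inj₂ w +ᶜ a *ᶜ e₂ at w) +ᶜ (h at inj₂ w +ᶜ (-ᶜ a) *ᶜ e₂ at w)
            ≈⟨ solveᶜ 4 (λ g x h y → (g :+ᶜ x) :+ᶜ (h :+ᶜ y) :=ᶜ (g :+ᶜ h) :+ᶜ (y :+ᶜ x)) C.refl
                 (g at inj₂ w) (a *ᶜ e₂ at w) (h at inj₂ w) ((-ᶜ a) *ᶜ e₂ at w) ⟩
          (g at inj₂ w +ᶜ h at inj₂ w) +ᶜ ((-ᶜ a) *ᶜ e₂ at w +ᶜ a *ᶜ e₂ at w)
            ≈⟨ C.+-cong (≈-⇒+≈ (coords-≈ (proj₂ (proj₂ zf-Af≈g)) (inj₂ w))) (cancel-pair a (e₂ at w)) ⟩
          z *ᶜ f at inj₂ w +ᶜ 0ᶜ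
            ≈⟨ C.+-identityʳ (z *ᶜ f at inj₂ w) ⟩
          z *ᶜ f at inj₂ w ∎))

      -- The equation at u involves the second component only through f(v₂). Rewriting that value by
      -- `second-component` and `R₂-at-v₂` closes the system over Γ₁.
      first-component : ∀ u → schur (restrict₁ f at_) u ≈ᶜ reduced g at u
      first-component u = introduce (z *ᶜ f at inj₁ u) (A₁.nsum (restrict₁ f at_) u) g₀ a (e₁ at u)
        (g at inj₁ u) (R₂ (restrict₂ g) at v₂)
        (C.trans (C.+-congˡ {g at inj₁ u} (C.sym (C.trans (AΓ.A-at Af≈h (inj₁ u))
            (C.trans (nsum₁ (f at_) u) (C.+-congˡ {A₁.nsum (restrict₁ f at_) u} (C.*-congʳ {e₁ at u}
              (C.trans (C.sym (coords-≈ second-component v₂)) (R₂-at-v₂ (restrict₂ g) a))))))))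
          (≈-⇒+≈ (coords-≈ (proj₂ (proj₂ zf-Af≈g)) (inj₁ u))))

  opaque
    -- A right inverse X of N already refutes D ≈ 0, because det N · det X ≈ 1; no eigenvector of
    -- A(Γ) has to be constructed.
    ∈ρ⇒det≉0 : ∀ {D} → det N ≈ᶜ D → z ∈ρ A Γ → ¬ (D ≈ᶜ 0ᶜ)
    ∈ρ⇒det≉0 N≈D Γ∈ρ D≈0 = 1≉0 (C.trans (C.sym (DetC.det-right-inverse {M = N} {X} NX≋δ))
      (C.trans (C.*-congʳ {det X} (C.trans N≈D D≈0)) (C.zeroˡ (det X))))
      where
      g f : Fin (suc m) → ℓ² (V Γ)
      g j = e Γ₁ (vertex j) ⊕ 0ᴹ
      f j = inv Γ∈ρ (g j)
      X : Fin (suc m) → Fin (suc m) → ℂ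
      X i j = f j at inj₁ (vertex i)
      -- The data vanish on Γ₂, so the correction term of `reduced` drops out and column j of N X is
      -- the bare unit vector.
      R₂0≈0 : ∀ j → R₂ (restrict₂ (g j)) at v₂ ≈ᶜ 0ᶜ
      R₂0≈0 j = C.trans (coords-≈ (R₂.cong {restrict₂ (g j)} {0ᴹ} (mk≈² λ _ → C.refl)) v₂)
        (coords-≈ (map-zero (inverse-bl z∈ρ)) v₂)
      NX≋δ : (N ∙ X) ≋₂ δ
      NX≋δ i j = C.trans (N-schur (restrict₁ (f j) at_) i)
        (C.trans (first-component {f j} {g j} (BoundedInverse.inverseʳ Γ∈ρ (g j)) (vertex i))
          (C.trans (C.+-cong (C.trans (e-vertex j i) (DetC.δ-sym j i))
                     (C.trans (C.*-congʳ {e₁ at vertex i} (R₂0≈0 j)) (C.zeroˡ (e₁ at vertex i))))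
            (C.+-identityʳ (δ i j))))

  module _ {d : ℂ} (N*d≈1 : det N *ᶜ d ≈ᶜ 1ᶜ) where

    private
      inverse-N : ∃[ X ] (N ∙ X) ≋₂ δ × (X ∙ N) ≋₂ δ
      inverse-N = DetC.inverse N d N*d≈1

      X : Fin (suc m) → Fin (suc m) → ℂ
      X = proj₁ inverse-N

    T₁ : ℓ² (V Γ) → ℓ² (V Γ₁)
    T₁ g = matrix-map X (reduced g)

    T₂ : ℓ² (V Γ) → ℓ² (V Γ₂)
    T₂ g = R₂ (restrict₂ g +ᴹ (T₁ g at v₁) *ₗ e₂)

    T₁-bl : BoundedLinear T₁
    T₁-bl = compose
      (add restrict₁-bl (compose (compose restrict₂-bl (inverse-bl z∈ρ)) (rank-one v₂ e₁ (‖basis‖≤1 G₁._≟_ v₁))))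
      (matrix-map-bl X)

    T₂-bl : BoundedLinear T₂
    T₂-bl = compose (add restrict₂-bl (compose T₁-bl (rank-one v₁ e₂ (‖basis‖≤1 G₂._≟_ v₂)))) (inverse-bl z∈ρ)

    opaque
      -- Solvability comes from N X ≈ δ, whereas uniqueness, in `T₁-schur`, comes from X N ≈ δ; this
      -- is why a two-sided inverse matrix is required.
      schur-T₁ : ∀ g u → schur (T₁ g at_) u ≈ᶜ reduced g at u
      schur-T₁ g = at-vertices (λ u → schur (T₁ g at_) u ≈ᶜ reduced g at u) λ i → begin
        schur (T₁ g at_) (vertex i)
          ≈⟨ N-schur (T₁ g at_) i ⟨
        sum (λ j → N i j *ᶜ T₁ g at vertex j)
          ≈⟨ sum-cong-≋ (λ j → C.*-congˡ {N i j} (matrix-map-at X (reduced g) j)) ⟩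
        sum (λ j → N i j *ᶜ sum (λ k → X j k *ᶜ reduced g at vertex k))
          ≈⟨ DetC.·-cancel N X (proj₁ (proj₂ inverse-N)) (λ k → reduced g at vertex k) i ⟩
        reduced g at vertex i ∎

      T₁-schur : ∀ f₁ g → (∀ u → schur (f₁ at_) u ≈ᶜ reduced g at u) → T₁ g ≈² f₁
      T₁-schur f₁ g eq = mk≈² (at-vertices (λ u → T₁ g at u ≈ᶜ f₁ at u) λ i → begin
        T₁ g at vertex i
          ≈⟨ matrix-map-at X (reduced g) i ⟩
        sum (λ j → X i j *ᶜ reduced g at vertex j)
          ≈⟨ sum-cong-≋ (λ j → C.*-congˡ {X i j} (C.trans (N-schur (f₁ at_) j) (eq (vertex j)))) ⟨
        sum (λ j → X i j *ᶜ sum (λ k → N j k *ᶜ f₁ at vertex k))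
          ≈⟨ DetC.·-cancel X N (proj₂ (proj₂ inverse-N)) (λ k → f₁ at vertex k) i ⟩
        f₁ at vertex i ∎)

      solution : ∀ g → (z I- A Γ) (T₁ g ⊕ T₂ g) g
      solution g = h , A-extend (T₁ g) Af₂≈h₂ , mk≈² λ
        { (inj₁ u) → +≈⇒≈- (first u) ; (inj₂ w) → +≈⇒≈- (second w) }
        where
        image : (z I- A Γ₂) (T₂ g) (restrict₂ g +ᴹ (T₁ g at v₁) *ₗ e₂)
        image = BoundedInverse.inverseʳ z∈ρ (restrict₂ g +ᴹ (T₁ g at v₁) *ₗ e₂)
        h₂ : ℓ² (V Γ₂)
        h₂ = proj₁ image
        Af₂≈h₂ : A Γ₂ (T₂ g) h₂
        Af₂≈h₂ = proj₁ (proj₂ image)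
        h : ℓ² (V Γ)
        -- The image under A(Γ): on each side the image within that graph, plus the value at the far
        -- end of the bridge times the unit vector at the near end.
        h = (nsumᴹ (T₁ g) +ᴹ (T₂ g at v₂) *ₗ e₁) ⊕ (h₂ +ᴹ (T₁ g at v₁) *ₗ e₂)
        first : ∀ u → g at inj₁ u +ᶜ h at inj₁ u ≈ᶜ z *ᶜ T₁ g at u
        first u = C.trans
          (C.+-congˡ {g at inj₁ u} (C.+-congˡ {A₁.nsum (T₁ g at_) u}
            (C.*-congʳ {e₁ at u} (R₂-at-v₂ (restrict₂ g) (T₁ g at v₁)))))
          (eliminate (z *ᶜ T₁ g at u) (A₁.nsum (T₁ g at_) u) g₀ (T₁ g at v₁) (e₁ at u) (g at inj₁ u)
            (R₂ (restrict₂ g) at v₂) (schur-T₁ g u))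
        second : ∀ w → g at inj₂ w +ᶜ h at inj₂ w ≈ᶜ z *ᶜ T₂ g at w
        second w = C.trans
          (solveᶜ 3 (λ g h x → g :+ᶜ (h :+ᶜ x) :=ᶜ (g :+ᶜ x) :+ᶜ h) C.refl
            (g at inj₂ w) (h₂ at w) (T₁ g at v₁ *ᶜ e₂ at w))
          (≈-⇒+≈ (coords-≈ (proj₂ (proj₂ image)) w))

      uniqueness : ∀ f g → (z I- A Γ) f g → T₁ g ⊕ T₂ g ≈² f
      uniqueness f g zf-Af≈g = mk≈² λ { (inj₁ u) → coords-≈ T₁≈ u ; (inj₂ w) → coords-≈ T₂≈ w }
        where
        T₁≈ : T₁ g ≈² restrict₁ f
        T₁≈ = T₁-schur (restrict₁ f) g (first-component {f} {g} zf-Af≈g)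
        T₂≈ : T₂ g ≈² restrict₂ f
        T₂≈ = ≈²-trans
          (R₂.cong {restrict₂ g +ᴹ (T₁ g at v₁) *ₗ e₂} {restrict₂ g +ᴹ (f at inj₁ v₁) *ₗ e₂}
            (mk≈² λ w → C.+-congˡ {g at inj₂ w} (C.*-congʳ {e₂ at w} (coords-≈ T₁≈ v₁))))
          (second-component {f} {g} zf-Af≈g)

    resolvent : z ∈ρ A Γ
    resolvent = record
      { inv      = λ g → T₁ g ⊕ T₂ g
      ; linear   = isHomomorphism T-bl
      ; bound    = BoundedLinear.bound T-bl
      ; inverseʳ = solution
      ; inverseˡ = uniqueness
      }
      where
      T-bl : BoundedLinear (λ g → T₁ g ⊕ T₂ g)
      T-bl = pair-map T₁-bl T₂-bl

  opaque
    ∈σ⇒det≈0 : ∀ {D} → det N ≈ᶜ D → z ∈σ A Γ → D ≈ᶜ 0ᶜ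
    ∈σ⇒det≈0 N≈D Γ∈σ = C.trans (C.sym N≈D) (∣z∣²≤0⇒z≈0 (≤0-stable ∣ det N ∣² (λ (_ , 0<∣N∣) →
      Γ∈σ (resolvent (proj₂ (invertible (det N) 0<∣N∣))))))

theorem1p1 : (Γ₁ Γ₂ : Graph) →
    Connected Γ₁ → Connected Γ₂ →
    (fin₁ : Finite Γ₁) → Finite Γ₂ ⊎ CountablyInfinite Γ₂ →
    (v₁ : V Γ₁) (v₂ : V Γ₂) →
    (z : ℂ) (z∈ρ : z ∈ρ A Γ₂) →
    z ∈σ A (coupling Γ₁ Γ₂ v₁ v₂) ⇔
    (P z Γ₁ fin₁ +ᶜ -ᶜ (G Γ₂ z∈ρ v₂ *ᶜ P z (Γ₁ ∖ v₁) (finite-∖ Γ₁ v₁ fin₁)) ≈ᶜ 0ᶜ)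
-- The vertex v₁ excludes the empty enumeration; in the other case the size has the form `suc m`
-- that deleting a row and a column requires.
theorem1p1 Γ₁ Γ₂ _ _ (zero , enum) _ v₁ v₂ z z∈ρ = ⊥-elim (no-vertex (Inverse.from enum v₁))
  where
  no-vertex : ¬ Fin 0
  no-vertex ()
theorem1p1 Γ₁ Γ₂ _ _ (suc m , enum) _ v₁ v₂ z z∈ρ =
  mk⇔ (∈σ⇒det≈0 det-N) (λ D≈0 Γ∈ρ → ∈ρ⇒det≉0 det-N Γ∈ρ D≈0)
  where open Resolvent Γ₁ Γ₂ v₁ v₂ m enum z z∈ρ
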